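{- Let $R\cong \mathbb Z_{p_1^{t_1}}\times\cdots\times\mathbb Z_{p_r^{t_r}}$ for (not necessarily distinct) prime numbers $p_1,\dots,p_r$ and positive integers $r,t_1,\dots,t_r$. Then the zero-divisor graph $\Gamma(R)$ has $$\prod_{i=1}^r (t_i+1) - 2$$ non-zero eigenvalues (counted with multiplicity), and the nullity of $\Gamma(R)$ equals $$\eta(\Gamma(R)) = \prod_{i=1}^r p_i^{t_i-1}\Big(\prod_{i=1}^r p_i - \prod_{i=1}^r (p_i-1)\Big) - \prod_{i=1}^r (t_i+1) + 1 .$$
   Context: $\mathbb Z_n$ denotes the ring of integers modulo $n$. For a finite commutative ring $R$ with $1\ne0$, the zero-divisor graph $\Gamma(R)$ has as vertex set the set of non-zero zero-divisors of $R$, and two (not necessarily distinct) vertices $x,y$ are adjacent iff $xy=0$; loops are kept, so the adjacency matrix $A(\Gamma(R))$ has diagonal entry $1$ at $x$ iff $x^2=0$. The eigenvalues of a graph are those of its adjacency matrix. The nullity $\eta(G)$ of a graph $G$ is the multiplicity of the eigenvalue $0$ of its adjacency matrix (it is $0$ for the graph with no vertices). -}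

module Defs where

open import Algebra.Apartness.Bundles using (HeytingField; HeytingCommutativeRing)
open import Algebra.Bundles using (CommutativeRing; RawRing)
open import Algebra.Morphism.Structures using (module RingMorphisms)
import Algebra.Definitions.RawSemiring as RawSemiringDefs
open import Data.Bool.Base using (if_then_else_)
open import Data.Fin.Base using (Fin; zero; suc; toℕ)
open import Data.Fin.Subset using (Subset; _∈_; _∉_; ∣_∣)
import Data.Fin.Properties as Fin
open import Data.Integer.Base as ℤ using (ℤ; +_)
open import Data.Integer.Divisibility.Signed as ℤ using (divides)
import Data.Integer.Properties as ℤ
open import Data.Integer.Tactic.RingSolver using (solve-∀)
open import Data.List.Base as List using (List; []; _∷_)
open import Data.Nat.Base as ℕ using (ℕ; zero; suc)
open import Data.Product.Base using (Σ; ∃-syntax; _×_; _,_; proj₁)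
open import Data.Vec.Functional as Vector using (Vector)
open import Function.Base using (_$_)
open import Function.Bundles using (Bijection)
open import Level using (Level; _⊔_; 0ℓ) renaming (suc to lsuc)
open import Relation.Binary.Bundles using (Setoid)
import Relation.Binary.Construct.On as On
open import Relation.Binary.Core using (Rel)
open import Relation.Binary.Definitions using (Decidable; Symmetric; _Respects₂_)
open import Relation.Binary.PropositionalEquality as ≡ using (_≡_)
open import Relation.Nullary.Decidable using (does)

private
  variable
    c c′ ℓ ℓ₁ ℓ₂ ℓ₁′ ℓ₂′ : Level

∏ : ∀ {r} → Vector ℕ r → ℕ
∏ = Vector.foldr ℕ._*_ 1

infix 4 _≡_[mod_]
record _≡_[mod_] (x y : ℤ) (n : ℕ) : Set where
  constructor congruent
  field n∣x-y : + n ℤ.∣ (x ℤ.- y)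

-- ℤ/nℤ is presented as ℤ with congruence modulo n as its setoid equality.
module _ (n : ℕ) where

  private
    _≋_ : Rel ℤ 0ℓ
    x ≋ y = x ≡ y [mod n ]

    ≡⇒≋ : ∀ {x y} → x ≡ y → x ≋ y
    ≡⇒≋ {x} ≡.refl = congruent $ divides (+ 0) (ℤ.+-inverseʳ x)

    ≋-sym : ∀ {x y} → x ≋ y → y ≋ x
    ≋-sym {x} {y} (congruent (divides q e)) = congruent $ divides (ℤ.- q)
      (≡.trans (lem x y) (≡.trans (≡.cong ℤ.-_ e) (ℤ.neg-distribˡ-* q (+ n))))
      where
      lem : ∀ x y → y ℤ.- x ≡ ℤ.- (x ℤ.- y)
      lem = solve-∀

    ≋-trans : ∀ {x y z} → x ≋ y → y ≋ z → x ≋ z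
    ≋-trans {x} {y} {z} (congruent (divides q e)) (congruent (divides q′ e′)) = congruent $ divides (q ℤ.+ q′)
      (≡.trans (lem x y z) (≡.trans (≡.cong₂ ℤ._+_ e e′)
        (≡.sym (ℤ.*-distribʳ-+ (+ n) q q′))))
      where
      lem : ∀ x y z → x ℤ.- z ≡ (x ℤ.- y) ℤ.+ (y ℤ.- z)
      lem = solve-∀

    +-cong : ∀ {x y u v} → x ≋ y → u ≋ v → (x ℤ.+ u) ≋ (y ℤ.+ v)
    +-cong {x} {y} {u} {v} (congruent (divides q e)) (congruent (divides q′ e′)) = congruent $ divides (q ℤ.+ q′)
      (≡.trans (lem x y u v) (≡.trans (≡.cong₂ ℤ._+_ e e′)
        (≡.sym (ℤ.*-distribʳ-+ (+ n) q q′))))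
      where
      lem : ∀ x y u v → (x ℤ.+ u) ℤ.- (y ℤ.+ v) ≡ (x ℤ.- y) ℤ.+ (u ℤ.- v)
      lem = solve-∀

    *-cong : ∀ {x y u v} → x ≋ y → u ≋ v → (x ℤ.* u) ≋ (y ℤ.* v)
    *-cong {x} {y} {u} {v} (congruent (divides q e)) (congruent (divides q′ e′)) =
      congruent $ divides (q ℤ.* u ℤ.+ y ℤ.* q′)
      (≡.trans (lem x y u v) (≡.trans
        (≡.cong₂ (λ a b → a ℤ.* u ℤ.+ y ℤ.* b) e e′) (lem′ q q′ (+ n) u y)))
      where
      lem : ∀ x y u v → x ℤ.* u ℤ.- y ℤ.* v ≡ (x ℤ.- y) ℤ.* u ℤ.+ y ℤ.* (u ℤ.- v)
      lem = solve-∀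
      lem′ : ∀ q q′ n u y →
        (q ℤ.* n) ℤ.* u ℤ.+ y ℤ.* (q′ ℤ.* n) ≡ (q ℤ.* u ℤ.+ y ℤ.* q′) ℤ.* n
      lem′ = solve-∀

    neg-cong : ∀ {x y} → x ≋ y → (ℤ.- x) ≋ (ℤ.- y)
    neg-cong {x} {y} (congruent (divides q e)) = congruent $ divides (ℤ.- q)
      (≡.trans (lem x y) (≡.trans (≡.cong ℤ.-_ e) (ℤ.neg-distribˡ-* q (+ n))))
      where
      lem : ∀ x y → (ℤ.- x) ℤ.- (ℤ.- y) ≡ ℤ.- (x ℤ.- y)
      lem = solve-∀

  ℤ/_ : CommutativeRing 0ℓ 0ℓ
  ℤ/_ = record
    { Carrier = ℤ ; _≈_ = _≋_
    ; _+_ = ℤ._+_ ; _*_ = ℤ._*_ ; -_ = ℤ.-_ ; 0# = + 0 ; 1# = + 1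
    ; isCommutativeRing = record
      { isRing = record
        { +-isAbelianGroup = record
          { isGroup = record
            { isMonoid = record
              { isSemigroup = record
                { isMagma = record
                  { isEquivalence = record
                    { refl = ≡⇒≋ ≡.refl ; sym = ≋-sym ; trans = ≋-trans }
                  ; ∙-cong = +-cong
                  }
                ; assoc = λ x y z → ≡⇒≋ (ℤ.+-assoc x y z)
                }
              ; identity = (λ x → ≡⇒≋ (ℤ.+-identityˡ x))
                         , (λ x → ≡⇒≋ (ℤ.+-identityʳ x))
              }
            ; inverse = (λ x → ≡⇒≋ (ℤ.+-inverseˡ x))
                      , (λ x → ≡⇒≋ (ℤ.+-inverseʳ x))
            ; ⁻¹-cong = neg-cong
            }
          ; comm = λ x y → ≡⇒≋ (ℤ.+-comm x y)
          }
        ; *-cong = *-cong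
        ; *-assoc = λ x y z → ≡⇒≋ (ℤ.*-assoc x y z)
        ; *-identity = (λ x → ≡⇒≋ (ℤ.*-identityˡ x))
                     , (λ x → ≡⇒≋ (ℤ.*-identityʳ x))
        ; distrib = (λ x y z → ≡⇒≋ (ℤ.*-distribˡ-+ x y z))
                  , (λ x y z → ≡⇒≋ (ℤ.*-distribʳ-+ x y z))
        }
      ; *-comm = λ x y → ≡⇒≋ (ℤ.*-comm x y)
      }
    }

Πᴿ : ∀ {r} → (Fin r → CommutativeRing c ℓ) → CommutativeRing c ℓ
Πᴿ {r = r} S = record
  { Carrier = ∀ i → S.Carrier i
  ; _≈_ = λ x y → ∀ i → S._≈_ i (x i) (y i)
  ; _+_ = λ x y i → S._+_ i (x i) (y i)
  ; _*_ = λ x y i → S._*_ i (x i) (y i)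
  ; -_ = λ x i → S.-_ i (x i)
  ; 0# = λ i → S.0# i
  ; 1# = λ i → S.1# i
  ; isCommutativeRing = record
    { isRing = record
      { +-isAbelianGroup = record
        { isGroup = record
          { isMonoid = record
            { isSemigroup = record
              { isMagma = record
                { isEquivalence = record
                  { refl = λ i → S.refl i
                  ; sym = λ e i → S.sym i (e i)
                  ; trans = λ e f i → S.trans i (e i) (f i)
                  }
                ; ∙-cong = λ e f i → S.+-cong i (e i) (f i)
                }
              ; assoc = λ x y z i → S.+-assoc i (x i) (y i) (z i)
              }
            ; identity = (λ x i → S.+-identityˡ i (x i))
                       , (λ x i → S.+-identityʳ i (x i))
            }
          ; inverse = (λ x i → S.-‿inverseˡ i (x i))
                    , (λ x i → S.-‿inverseʳ i (x i))
          ; ⁻¹-cong = λ e i → S.-‿cong i (e i)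
          }
        ; comm = λ x y i → S.+-comm i (x i) (y i)
        }
      ; *-cong = λ e f i → S.*-cong i (e i) (f i)
      ; *-assoc = λ x y z i → S.*-assoc i (x i) (y i) (z i)
      ; *-identity = (λ x i → S.*-identityˡ i (x i))
                   , (λ x i → S.*-identityʳ i (x i))
      ; distrib = (λ x y z i → S.distribˡ i (x i) (y i) (z i))
                , (λ x y z i → S.distribʳ i (x i) (y i) (z i))
      }
    ; *-comm = λ x y i → S.*-comm i (x i) (y i)
    }
  }
  where
  module S (i : Fin r) = CommutativeRing (S i)

infix 4 _≅_

_≅_ : ∀ {c ℓ c′ ℓ′} → CommutativeRing c ℓ → CommutativeRing c′ ℓ′ →
      Set (c ⊔ ℓ ⊔ c′ ⊔ ℓ′)
R ≅ S = Σ (R.Carrier → S.Carrier) IsRingIsomorphism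
  where
  module R = CommutativeRing R
  module S = CommutativeRing S
  open RingMorphisms R.rawRing S.rawRing using (IsRingIsomorphism)

-- Undirected, without multiple edges; loops are allowed.
record Graph c ℓ₁ ℓ₂ : Set (lsuc (c ⊔ ℓ₁ ⊔ ℓ₂)) where
  field
    vertices : Setoid c ℓ₁
  open Setoid vertices public using () renaming (Carrier to Vertex; _≈_ to _≈ᵛ_)
  infix 4 _~_
  field
    _~_    : Rel Vertex ℓ₂
    ~-sym  : Symmetric _~_
    ~-resp : _~_ Respects₂ _≈ᵛ_

-- An ordering of the vertices, together with a decision procedure for
-- adjacency: what is needed to write down the adjacency matrix.
record Finite (G : Graph c ℓ₁ ℓ₂) : Set (c ⊔ ℓ₁ ⊔ ℓ₂) where
  open Graph G
  field
    order       : ℕ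
    enumeration : Bijection (≡.setoid (Fin order)) vertices
    _~?_        : Decidable _~_

  vertex : Fin order → Vertex
  vertex = Bijection.to enumeration

module _ (R : CommutativeRing c ℓ) where
  open CommutativeRing R

  IsZeroDivisor : Carrier → Set (c ⊔ ℓ)
  IsZeroDivisor x = ∃[ y ] (y ≉ 0# × x * y ≈ 0#)

  Γ : Graph (c ⊔ ℓ) ℓ ℓ
  Γ = record
    { vertices = On.setoid {B = Σ Carrier λ x → x ≉ 0# × IsZeroDivisor x} setoid proj₁
    ; _~_      = λ x y → proj₁ x * proj₁ y ≈ 0#
    ; ~-sym    = λ {x} {y} e → trans (*-comm (proj₁ y) (proj₁ x)) e
    ; ~-resp   = (λ e f → trans (*-congˡ (sym e)) f)
               , (λ e f → trans (*-congʳ (sym e)) f)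
    }

Matrix : Set c → ℕ → Set c
Matrix A n = Vector (Vector A n) n

-- Laplace expansion along the first row.
det : (S : RawRing c ℓ) → ∀ {n} → Matrix (RawRing.Carrier S) n → RawRing.Carrier S
det S {zero}  M = RawRing.1# S
det S {suc n} M =
  sum λ j → (- 1#) ^ toℕ j * (M zero j * det S (λ i → Vector.removeAt (M (suc i)) j))
  where
  open RawRing S
  open RawSemiringDefs rawSemiring using (sum; _^_)

adjacencyMatrix : ∀ {k ℓk} (K : CommutativeRing k ℓk) {G : Graph c ℓ₁ ℓ₂} (fin : Finite G) →
                  Matrix (CommutativeRing.Carrier K) (Finite.order fin)
adjacencyMatrix K fin i j = if does (vertex i ~? vertex j) then 1# else 0#
  where
  open CommutativeRing K using (0#; 1#)
  open Finite fin

module Polynomial (K : CommutativeRing c ℓ) where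
  open CommutativeRing K

  -- Coefficients in order of increasing degree; trailing zeros are permitted,
  -- and are ignored by _≈ₚ_.
  Poly : Set c
  Poly = List Carrier

  coeff : Poly → ℕ → Carrier
  coeff []      _       = 0#
  coeff (a ∷ p) zero    = a
  coeff (a ∷ p) (suc n) = coeff p n

  infix 4 _≈ₚ_
  _≈ₚ_ : Rel Poly ℓ
  p ≈ₚ q = ∀ n → coeff p n ≈ coeff q n

  infixl 6 _+ₚ_
  _+ₚ_ : Poly → Poly → Poly
  []      +ₚ q       = q
  (a ∷ p) +ₚ []      = a ∷ p
  (a ∷ p) +ₚ (b ∷ q) = a + b ∷ p +ₚ q

  infixl 7 _*ₚ_
  _*ₚ_ : Poly → Poly → Poly
  []      *ₚ q = []
  (a ∷ p) *ₚ q = List.map (a *_) q +ₚ (0# ∷ p *ₚ q)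

  rawRing[X] : RawRing c ℓ
  rawRing[X] = record
    { Carrier = Poly ; _≈_ = _≈ₚ_
    ; _+_ = _+ₚ_ ; _*_ = _*ₚ_ ; -_ = List.map (-_) ; 0# = [] ; 1# = 1# ∷ []
    }

  open RawSemiringDefs (RawRing.rawSemiring rawRing[X]) public
    using () renaming (_^_ to _^ₚ_; product to ∏ₚ)

  eval : Poly → Carrier → Carrier
  eval []      x = 0#
  eval (a ∷ p) x = a + x * eval p x

  X-_ : Carrier → Poly
  X- a = - a ∷ 1# ∷ []

  charPoly : ∀ {n} → Matrix Carrier n → Poly
  charPoly A = det rawRing[X] λ i j →
    if does (i Fin.≟ j) then X- (A i j) else (- A i j ∷ [])

-- The real numbers are a Heyting field, not a discrete one, so "non-zero" is
-- apartness from 0#.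
module FieldEigenvalues (K : HeytingField c ℓ₁ ℓ₂) where
  open HeytingField K

  commutativeRing : CommutativeRing c ℓ₁
  commutativeRing = HeytingCommutativeRing.commutativeRing heytingCommutativeRing

  open RawSemiringDefs (RawRing.rawSemiring (CommutativeRing.rawRing commutativeRing))
    using () renaming (_×_ to _·_)
  open Polynomial commutativeRing public

  CharacteristicZero : Set ℓ₂
  CharacteristicZero = ∀ n → (suc n · 1#) # 0#

  IsRootMultiplicity : Poly → Carrier → ℕ → Set (c ⊔ ℓ₁ ⊔ ℓ₂)
  IsRootMultiplicity p a m =
    ∃[ q ] (p ≈ₚ ((X- a) ^ₚ m) *ₚ q × eval q a # 0#)

  -- μ lists the eigenvalues of A, each as often as its multiplicity.
  IsSpectrum : ∀ {n} → Matrix Carrier n → Vector Carrier n → Set ℓ₁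
  IsSpectrum A μ = charPoly A ≈ₚ ∏ₚ (λ i → X- (μ i))

  NonZeroCount : ∀ {n} → Vector Carrier n → ℕ → Set (ℓ₁ ⊔ ℓ₂)
  NonZeroCount {n} μ m = ∃[ S ]
    (∣ S ∣ ≡ m × (∀ i → i ∈ S → μ i # 0#) × (∀ i → i ∉ S → μ i ≈ 0#))

  IsNullity : {G : Graph c′ ℓ₁′ ℓ₂′} → Finite G → ℕ → Set (c ⊔ ℓ₁ ⊔ ℓ₂)
  IsNullity fin m =
    IsRootMultiplicity (charPoly (adjacencyMatrix commutativeRing fin)) 0# m

-- A vertex x of the graph is adjacent to y iff the valuations of x and y add up
-- to at least t in every factor, so the adjacency matrix A depends only on the
-- vector of valuations of a vertex.  Let rep pick one vertex from each of the
-- ∏ (t i + 1) - 2 valuation classes and let R be its matrix.  Then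
-- X I - A = (X I + (1 - X) R) (I - (1 - X) R - A), where the first factor has
-- determinant X ^ η, η being the number of vertices other than representatives.
-- At X = 0 the second factor becomes I - R - A, which is invertible as soon as
-- A v = f has a class function v as solution for every class function f.  For
-- the whole ring in place of the vertices that system is a tensor product of
-- triangular systems with class sizes on the diagonal.  Extending f by 0 to the
-- units forces v to vanish at 0, and no unit is adjacent to a vertex, so that
-- solution restricts to the vertices.
module Submission where

open import Defs
open import Algebra.Apartness.Bundles using (HeytingField)
import Algebra.Apartness.Properties.HeytingCommutativeRing
open import Algebra.Bundles using (CommutativeMonoid; CommutativeRing; RawRing)
import Algebra.Definitions.RawSemiring as RawSemiringDefs
open import Algebra.Morphism.Structures using (module RingMorphisms)
import Algebra.Properties.CommutativeMonoid.Sum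
import Algebra.Properties.CommutativeSemigroup
import Algebra.Properties.Ring
import Algebra.Properties.Semiring.Sum
import Algebra.Solver.Ring.NaturalCoefficients.Default
open import Data.Bool.Base using (true; false; if_then_else_)
open import Data.Fin.Base using (Fin; zero; suc; toℕ; fromℕ<; punchIn; pinch)
import Data.Fin.Properties as Fin
open import Data.Fin.Subset using (Subset; inside; outside; _∈_; _∉_; ∣_∣)
open import Data.Fin.Subset.Properties using (drop-there)
open import Data.Integer.Base as ℤ using (ℤ; +_)
import Data.Integer.DivMod as ℤ
open import Data.Integer.Divisibility.Signed as ℤ using (divides)
import Data.Integer.Properties as ℤ
open import Data.Integer.Tactic.RingSolver using (solve-∀)
open import Data.List.Base as List using ([]; _∷_)
open import Data.Nat.Base as ℕ using (ℕ; zero; suc)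
open import Data.Nat.Divisibility as ℕ using (_∣_; divides)
open import Data.Nat.Primality using (Prime; prime⇒nonZero; prime⇒nonTrivial; euclidsLemma)
import Data.Nat.Properties as ℕ
import Data.Nat.Tactic.RingSolver as ℕ
open import Data.Product.Base using (∃-syntax; Σ-syntax; _×_; _,_; proj₁; proj₂)
open import Data.Sum.Base using (_⊎_; inj₁; inj₂; [_,_]′)
open import Data.Vec.Base as Vec using (Vec; []; _∷_; here; there)
open import Data.Vec.Functional as Vector using (Vector; head; tail; updateAt; insertAt; removeAt)
open import Data.Vec.Functional.Properties using (updateAt-updates; updateAt-minimal)
import Data.Vec.Properties as Vec
open import Function.Base using (_∘_; const)
open import Function.Bundles using (Bijection)
open import Level using (_⊔_)
open import Relation.Binary.Definitions using (DecidableEquality; tri<; tri≈; tri>)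
open import Relation.Binary.PropositionalEquality as ≡ using (_≡_; _≢_)
import Relation.Binary.Reasoning.Setoid
open import Relation.Nullary.Decidable using (Dec; does; yes; no; dec-true; dec-false)
open import Relation.Nullary.Negation using (¬_; contradiction)

-- Finite sums over boxes of natural-number vectors

-- The nullity is an algebraic multiplicity, so computing a rank would not settle it, and equality
-- in `K` is not decidable, so that elimination cannot even choose a pivot. Hence the factorisation
-- X ^ η q of the characteristic polynomial is written down explicitly, and q(0) is shown to be
-- invertible by solving linear systems with arbitrary right-hand side. The coefficient 1 - X is
-- chosen so that the rows of representatives in the first factor are rows of the identity; its
-- determinant is then exactly a power of X. The diagonal of the triangular systems consists of
-- positive integers, which characteristic zero makes invertible. Whether an eigenvalue vanishes
-- cannot be decided in general either; for a root of X ^ η q the decision is extracted from the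
-- invertibility of q(0). As to the constants, the 2 counts the classes of the units and of zero,
-- which contain no vertex. The final + 1 is 2 - 1: besides the units, only the single element zero
-- is missing from the vertices.

if-yes : ∀ {a p} {A : Set a} {P : Set p} (P? : Dec P) {x y : A} → P → (if does P? then x else y) ≡ x
if-yes P? p rewrite dec-true P? p = ≡.refl

if-no : ∀ {a p} {A : Set a} {P : Set p} (P? : Dec P) {x y : A} → ¬ P → (if does P? then x else y) ≡ y
if-no P? ¬p rewrite dec-false P? ¬p = ≡.refl

infix 4 _≟ᵛ_
_≟ᵛ_ : ∀ {r} → DecidableEquality (Vec ℕ r)
_≟ᵛ_ = Vec.≡-dec ℕ._≟_

lookup-ext : ∀ {r} {xs ys : Vec ℕ r} → (∀ j → Vec.lookup xs j ≡ Vec.lookup ys j) → xs ≡ ys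
lookup-ext {xs = xs} {ys} e = ≡.trans (≡.sym (Vec.tabulate∘lookup xs))
  (≡.trans (Vec.tabulate-cong e) (Vec.tabulate∘lookup ys))

infix 4 _<ᵇ_
-- Members of a box are vectors of plain naturals with the bounds kept apart, so that residues,
-- valuations and representatives have one type and are compared without casts.
_<ᵇ_ : ∀ {r} → Vec ℕ r → Vector ℕ r → Set
ys <ᵇ q = ∀ j → Vec.lookup ys j ℕ.< q j

module FiniteSums {c ℓ} (M : CommutativeMonoid c ℓ) where
  open CommutativeMonoid M
  open Algebra.Properties.CommutativeMonoid.Sum M
  open Relation.Binary.Reasoning.Setoid setoid

  sum-≈ε : ∀ {n} {f : Vector Carrier n} → (∀ i → f i ≈ ε) → sum f ≈ ε
  sum-≈ε {n} f≈ε = trans (sum-cong-≋ {n} f≈ε) (sum-replicate-zero n)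

  sum-single : ∀ {n} {f : Vector Carrier n} i → (∀ j → j ≢ i → f j ≈ ε) → sum f ≈ f i
  sum-single zero    f≈ε = trans (∙-congˡ (sum-≈ε λ j → f≈ε (suc j) λ ())) (identityʳ _)
  sum-single (suc i) f≈ε = trans
    (∙-cong (f≈ε zero λ ()) (sum-single i λ j j≢i → f≈ε (suc j) (j≢i ∘ Fin.suc-injective)))
    (identityˡ _)

  ∑ᵇ : ∀ {r} → Vector ℕ r → (Vec ℕ r → Carrier) → Carrier
  ∑ᵇ {zero}  q F = F []
  ∑ᵇ {suc r} q F = sum {q zero} λ y → ∑ᵇ (tail q) λ ys → F (toℕ y ∷ ys)

  ∑ᵇ-cong : ∀ {r} (q : Vector ℕ r) {F G} → (∀ ys → ys <ᵇ q → F ys ≈ G ys) → ∑ᵇ q F ≈ ∑ᵇ q G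
  ∑ᵇ-cong {zero}  q e = e [] λ ()
  ∑ᵇ-cong {suc r} q e = sum-cong-≋ {q zero} λ y → ∑ᵇ-cong (tail q) λ ys ys<q →
    e (toℕ y ∷ ys) λ { zero → Fin.toℕ<n y ; (suc j) → ys<q j }

  ∑ᵇ-ε : ∀ {r} (q : Vector ℕ r) → ∑ᵇ q (const ε) ≈ ε
  ∑ᵇ-ε {zero}  q = refl
  ∑ᵇ-ε {suc r} q = sum-≈ε {q zero} λ y → ∑ᵇ-ε (tail q)

  ∑ᵇ-∙ : ∀ {r} (q : Vector ℕ r) F G → ∑ᵇ q (λ ys → F ys ∙ G ys) ≈ ∑ᵇ q F ∙ ∑ᵇ q G
  ∑ᵇ-∙ {zero}  q F G = refl
  ∑ᵇ-∙ {suc r} q F G = trans (sum-cong-≋ {q zero} λ y → ∑ᵇ-∙ (tail q) (λ ys → F (toℕ y ∷ ys)) (λ ys → G (toℕ y ∷ ys)))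
    (∑-distrib-+ {q zero} _ _)

  ∑ᵇ-sum : ∀ {r n} (q : Vector ℕ r) (F : Fin n → Vec ℕ r → Carrier) →
           ∑ᵇ q (λ ys → sum λ i → F i ys) ≈ sum λ i → ∑ᵇ q (F i)
  ∑ᵇ-sum {n = zero}  q F = ∑ᵇ-ε q
  ∑ᵇ-sum {n = suc n} q F = trans (∑ᵇ-∙ q (F zero) (λ ys → sum λ i → F (suc i) ys)) (∙-congˡ (∑ᵇ-sum q (F ∘ suc)))

  ∑ᵇ-single : ∀ {r} (q : Vector ℕ r) {F} ys → ys <ᵇ q →
              (∀ zs → zs <ᵇ q → zs ≢ ys → F zs ≈ ε) → ∑ᵇ q F ≈ F ys
  ∑ᵇ-single {zero}  q [] ys<q F≈ε = refl
  ∑ᵇ-single {suc r} q {F} (y ∷ ys) ys<q F≈ε = begin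
    sum {q zero} (λ z → ∑ᵇ (tail q) λ zs → F (toℕ z ∷ zs))
      ≈⟨ sum-single i (λ z z≢i → trans (∑ᵇ-cong (tail q) λ zs zs<q →
           F≈ε (toℕ z ∷ zs) (λ { zero → Fin.toℕ<n z ; (suc j) → zs<q j })
             λ eq → z≢i (Fin.toℕ-injective (≡.trans (Vec.∷-injectiveˡ eq) (≡.sym i≡y))))
           (∑ᵇ-ε (tail q))) ⟩
    ∑ᵇ (tail q) (λ zs → F (toℕ i ∷ zs))
      ≈⟨ ∑ᵇ-single (tail q) ys (ys<q ∘ suc) (λ zs zs<q zs≢ys →
           F≈ε (toℕ i ∷ zs) (λ { zero → Fin.toℕ<n i ; (suc j) → zs<q j }) (zs≢ys ∘ Vec.∷-injectiveʳ)) ⟩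
    F (toℕ i ∷ ys)   ≡⟨ ≡.cong (λ z → F (z ∷ ys)) i≡y ⟩
    F (y ∷ ys)       ∎
    where
    i : Fin (q zero)
    i = fromℕ< (ys<q zero)
    i≡y : toℕ i ≡ y
    i≡y = Fin.toℕ-fromℕ< (ys<q zero)

  -- Each `F (e i)` is spread over the box as a sum concentrated at `e i`. After exchanging the two
  -- sums, injectivity leaves at most one term at each point, and a point without a term has `F`
  -- trivial by hypothesis.
  sum-reindex : ∀ {r n} (q : Vector ℕ r) (e : Fin n → Vec ℕ r) → (∀ i → e i <ᵇ q) →
                (∀ {i j} → e i ≡ e j → i ≡ j) → ∀ F →
                (∀ ys → ys <ᵇ q → (∀ i → e i ≢ ys) → F ys ≈ ε) →
                sum (F ∘ e) ≈ ∑ᵇ q F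
  sum-reindex {n = n} q e e<q e-inj F F≈ε = begin
    sum (λ i → F (e i))
      ≈⟨ sum-cong-≋ {n} (λ i → sym (trans (∑ᵇ-single q (e i) (e<q i) (off i)) (at i))) ⟩
    sum (λ i → ∑ᵇ q (term i))
      ≈⟨ ∑ᵇ-sum q term ⟨
    ∑ᵇ q (λ ys → sum (λ i → term i ys))
      ≈⟨ ∑ᵇ-cong q collect ⟩
    ∑ᵇ q F ∎
    where
    term : Fin n → Vec ℕ _ → Carrier
    term i ys = if does (e i ≟ᵛ ys) then F ys else ε
    on : ∀ i {ys} → e i ≡ ys → term i ys ≈ F ys
    on i {ys} eq = reflexive (if-yes (e i ≟ᵛ ys) eq)
    at : ∀ i → term i (e i) ≈ F (e i)
    at i = on i ≡.refl
    off′ : ∀ i ys → e i ≢ ys → term i ys ≈ ε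
    off′ i ys neq = reflexive (if-no (e i ≟ᵛ ys) neq)
    off : ∀ i ys → ys <ᵇ q → ys ≢ e i → term i ys ≈ ε
    off i ys _ neq = off′ i ys (neq ∘ ≡.sym)
    collect : ∀ ys → ys <ᵇ q → sum (λ i → term i ys) ≈ F ys
    collect ys ys<q with Fin.any? (λ i → e i ≟ᵛ ys)
    ... | yes (i , eq) = trans (sum-single i λ j j≢i → off′ j ys λ eq′ → j≢i (e-inj (≡.trans eq′ (≡.sym eq)))) (on i eq)
    ... | no none = trans (sum-≈ε λ i → off′ i ys λ eq → none (i , eq))
      (sym (F≈ε ys ys<q λ i eq → none (i , eq)))

  -- Over a box with a single factor `∑ᵇ` reduces definitionally to an ordinary sum.
  sum-reindex₁ : ∀ {n} q (e : Fin n → ℕ) → (∀ i → e i ℕ.< q) → (∀ {i j} → e i ≡ e j → i ≡ j) →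
                 ∀ (F : ℕ → Carrier) → (∀ y → y ℕ.< q → (∀ i → e i ≢ y) → F y ≈ ε) →
                 sum (F ∘ e) ≈ sum {q} (F ∘ toℕ)
  sum-reindex₁ q e e<q e-inj F F≈ε = sum-reindex (const q) (λ i → e i ∷ []) (λ { i zero → e<q i })
    (e-inj ∘ Vec.∷-injectiveˡ) (F ∘ Vec.head)
    λ { (y ∷ []) y<q e≢y → F≈ε y (y<q zero) λ i eq → e≢y i (≡.cong (_∷ []) eq) }

-- The polynomial ring

module PolynomialRing {c ℓ} (K : CommutativeRing c ℓ) where
  open CommutativeRing K
  open Polynomial K
  open Algebra.Properties.Ring ring using (-0#≈0#)
  open Algebra.Properties.CommutativeSemigroup +-commutativeSemigroup using (interchange; x∙yz≈y∙xz)
  open Algebra.Properties.CommutativeSemigroup *-commutativeSemigroup using () renaming (x∙yz≈y∙xz to x*yz≈y*xz)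
  open Relation.Binary.Reasoning.Setoid setoid

  infixr 7 _•_
  _•_ : Carrier → Poly → Poly
  a • p = List.map (a *_) p

  coeff-+ : ∀ p q n → coeff (p +ₚ q) n ≈ coeff p n + coeff q n
  coeff-+ []      q       n       = sym (+-identityˡ _)
  coeff-+ (a ∷ p) []      n       = sym (+-identityʳ _)
  coeff-+ (a ∷ p) (b ∷ q) zero    = refl
  coeff-+ (a ∷ p) (b ∷ q) (suc n) = coeff-+ p q n

  coeff-• : ∀ a p n → coeff (a • p) n ≈ a * coeff p n
  coeff-• a []      n       = sym (zeroʳ a)
  coeff-• a (b ∷ p) zero    = refl
  coeff-• a (b ∷ p) (suc n) = coeff-• a p n

  coeff-neg : ∀ p n → coeff (List.map (-_) p) n ≈ - coeff p n
  coeff-neg []      n       = sym -0#≈0#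
  coeff-neg (b ∷ p) zero    = refl
  coeff-neg (b ∷ p) (suc n) = coeff-neg p n

  coeff-*-zero : ∀ p q → coeff (p *ₚ q) 0 ≈ coeff p 0 * coeff q 0
  coeff-*-zero []      q = sym (zeroˡ _)
  coeff-*-zero (a ∷ p) q =
    trans (coeff-+ (a • q) _ 0) (trans (+-identityʳ _) (coeff-• a q 0))

  coeff-*-suc : ∀ a p q n → coeff ((a ∷ p) *ₚ q) (suc n) ≈ a * coeff q (suc n) + coeff (p *ₚ q) n
  coeff-*-suc a p q n = trans (coeff-+ (a • q) _ (suc n)) (+-congʳ (coeff-• a q (suc n)))

  *ₚ-congˡ : ∀ p {q q′} → q ≈ₚ q′ → p *ₚ q ≈ₚ p *ₚ q′
  *ₚ-congˡ []      e n = refl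
  *ₚ-congˡ (a ∷ p) {q} {q′} e zero = trans (coeff-*-zero (a ∷ p) q)
    (trans (*-congˡ (e 0)) (sym (coeff-*-zero (a ∷ p) q′)))
  *ₚ-congˡ (a ∷ p) {q} {q′} e (suc n) = trans (coeff-*-suc a p q n)
    (trans (+-cong (*-congˡ (e (suc n))) (*ₚ-congˡ p e n)) (sym (coeff-*-suc a p q′ n)))

  -- Multiplication recurses on its left factor; this is the mirror image of `coeff-*-suc`, and the
  -- two recurrences together give commutativity.
  coeff-*-sucʳ : ∀ p b q n → coeff (p *ₚ (b ∷ q)) (suc n) ≈ b * coeff p (suc n) + coeff (p *ₚ q) n
  coeff-*-sucʳ [] b q n = sym (trans (+-identityʳ _) (zeroʳ b))
  coeff-*-sucʳ (a ∷ p) b q zero = begin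
    coeff ((a ∷ p) *ₚ (b ∷ q)) 1             ≈⟨ coeff-*-suc a p (b ∷ q) 0 ⟩
    a * coeff q 0 + coeff (p *ₚ (b ∷ q)) 0   ≈⟨ +-congˡ (coeff-*-zero p (b ∷ q)) ⟩
    a * coeff q 0 + coeff p 0 * b            ≈⟨ +-comm _ _ ⟩
    coeff p 0 * b + a * coeff q 0            ≈⟨ +-cong (*-comm _ _) (sym (coeff-*-zero (a ∷ p) q)) ⟩
    b * coeff p 0 + coeff ((a ∷ p) *ₚ q) 0   ∎
  coeff-*-sucʳ (a ∷ p) b q (suc n) = begin
    coeff ((a ∷ p) *ₚ (b ∷ q)) (2 ℕ.+ n)          ≈⟨ coeff-*-suc a p (b ∷ q) (suc n) ⟩
    a * coeff q (suc n) + coeff (p *ₚ (b ∷ q)) (suc n)        ≈⟨ +-congˡ (coeff-*-sucʳ p b q n) ⟩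
    a * coeff q (suc n) + (b * coeff p (suc n) + coeff (p *ₚ q) n)  ≈⟨ x∙yz≈y∙xz _ _ _ ⟩
    b * coeff p (suc n) + (a * coeff q (suc n) + coeff (p *ₚ q) n)  ≈⟨ +-congˡ (coeff-*-suc a p q n) ⟨
    b * coeff p (suc n) + coeff ((a ∷ p) *ₚ q) (suc n)        ∎

  *ₚ-zeroʳ : ∀ p → p *ₚ [] ≈ₚ []
  *ₚ-zeroʳ []      n       = refl
  *ₚ-zeroʳ (a ∷ p) zero    = refl
  *ₚ-zeroʳ (a ∷ p) (suc n) = *ₚ-zeroʳ p n

  *ₚ-comm : ∀ p q → p *ₚ q ≈ₚ q *ₚ p
  *ₚ-comm p []      n       = *ₚ-zeroʳ p n
  *ₚ-comm p (b ∷ q) zero    = trans (coeff-*-zero p (b ∷ q))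
    (trans (*-comm _ _) (sym (coeff-*-zero (b ∷ q) p)))
  *ₚ-comm p (b ∷ q) (suc n) = trans (coeff-*-sucʳ p b q n)
    (trans (+-congˡ (*ₚ-comm p q n)) (sym (coeff-*-suc b q p n)))

  -- Equal polynomials may be lists of different lengths, which makes a recursion on two left
  -- factors awkward; commutativity moves the change to the right factor.
  *ₚ-cong : ∀ {p p′ q q′} → p ≈ₚ p′ → q ≈ₚ q′ → p *ₚ q ≈ₚ p′ *ₚ q′
  *ₚ-cong {p} {p′} {q} {q′} e f n = begin
    coeff (p *ₚ q) n    ≈⟨ *ₚ-congˡ p f n ⟩
    coeff (p *ₚ q′) n   ≈⟨ *ₚ-comm p q′ n ⟩
    coeff (q′ *ₚ p) n   ≈⟨ *ₚ-congˡ q′ e n ⟩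
    coeff (q′ *ₚ p′) n  ≈⟨ *ₚ-comm q′ p′ n ⟩
    coeff (p′ *ₚ q′) n  ∎

  *ₚ-distribˡ : ∀ p q s → p *ₚ (q +ₚ s) ≈ₚ p *ₚ q +ₚ p *ₚ s
  *ₚ-distribˡ [] q s n = refl
  *ₚ-distribˡ (a ∷ p) q s zero = begin
    coeff ((a ∷ p) *ₚ (q +ₚ s)) 0        ≈⟨ coeff-*-zero (a ∷ p) (q +ₚ s) ⟩
    a * coeff (q +ₚ s) 0                 ≈⟨ *-congˡ (coeff-+ q s 0) ⟩
    a * (coeff q 0 + coeff s 0)          ≈⟨ distribˡ _ _ _ ⟩
    a * coeff q 0 + a * coeff s 0        ≈⟨ +-cong (coeff-*-zero (a ∷ p) q) (coeff-*-zero (a ∷ p) s) ⟨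
    coeff ((a ∷ p) *ₚ q) 0 + coeff ((a ∷ p) *ₚ s) 0  ≈⟨ coeff-+ ((a ∷ p) *ₚ q) _ 0 ⟨
    coeff ((a ∷ p) *ₚ q +ₚ (a ∷ p) *ₚ s) 0           ∎
  *ₚ-distribˡ (a ∷ p) q s (suc n) = begin
    coeff ((a ∷ p) *ₚ (q +ₚ s)) (suc n)  ≈⟨ coeff-*-suc a p _ n ⟩
    a * coeff (q +ₚ s) (suc n) + coeff (p *ₚ (q +ₚ s)) n
      ≈⟨ +-cong (trans (*-congˡ (coeff-+ q s (suc n))) (distribˡ _ _ _))
                (trans (*ₚ-distribˡ p q s n) (coeff-+ (p *ₚ q) _ n)) ⟩
    (a * coeff q (suc n) + a * coeff s (suc n)) + (coeff (p *ₚ q) n + coeff (p *ₚ s) n)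
      ≈⟨ interchange _ _ _ _ ⟩
    (a * coeff q (suc n) + coeff (p *ₚ q) n) + (a * coeff s (suc n) + coeff (p *ₚ s) n)
      ≈⟨ +-cong (coeff-*-suc a p q n) (coeff-*-suc a p s n) ⟨
    coeff ((a ∷ p) *ₚ q) (suc n) + coeff ((a ∷ p) *ₚ s) (suc n)  ≈⟨ coeff-+ ((a ∷ p) *ₚ q) _ (suc n) ⟨
    coeff ((a ∷ p) *ₚ q +ₚ (a ∷ p) *ₚ s) (suc n)                 ∎

  *ₚ-•ʳ : ∀ p a q → p *ₚ (a • q) ≈ₚ a • (p *ₚ q)
  *ₚ-•ʳ [] a q n = refl
  *ₚ-•ʳ (b ∷ p) a q zero = begin
    coeff ((b ∷ p) *ₚ (a • q)) 0  ≈⟨ coeff-*-zero (b ∷ p) (a • q) ⟩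
    b * coeff (a • q) 0           ≈⟨ *-congˡ (coeff-• a q 0) ⟩
    b * (a * coeff q 0)           ≈⟨ x*yz≈y*xz _ _ _ ⟩
    a * (b * coeff q 0)           ≈⟨ *-congˡ (coeff-*-zero (b ∷ p) q) ⟨
    a * coeff ((b ∷ p) *ₚ q) 0    ≈⟨ coeff-• a ((b ∷ p) *ₚ q) 0 ⟨
    coeff (a • ((b ∷ p) *ₚ q)) 0  ∎
  *ₚ-•ʳ (b ∷ p) a q (suc n) = begin
    coeff ((b ∷ p) *ₚ (a • q)) (suc n)                     ≈⟨ coeff-*-suc b p _ n ⟩
    b * coeff (a • q) (suc n) + coeff (p *ₚ (a • q)) n
      ≈⟨ +-cong (trans (*-congˡ (coeff-• a q (suc n))) (x*yz≈y*xz _ _ _))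
                (trans (*ₚ-•ʳ p a q n) (coeff-• a (p *ₚ q) n)) ⟩
    a * (b * coeff q (suc n)) + a * coeff (p *ₚ q) n       ≈⟨ distribˡ _ _ _ ⟨
    a * (b * coeff q (suc n) + coeff (p *ₚ q) n)           ≈⟨ *-congˡ (coeff-*-suc b p q n) ⟨
    a * coeff ((b ∷ p) *ₚ q) (suc n)                       ≈⟨ coeff-• a ((b ∷ p) *ₚ q) (suc n) ⟨
    coeff (a • ((b ∷ p) *ₚ q)) (suc n)                     ∎

  -- Commuting `s` to the front makes left distributivity and the rule for scalars on the right
  -- applicable; the induction enters through the shifted summand.
  *ₚ-assoc : ∀ p q s → (p *ₚ q) *ₚ s ≈ₚ p *ₚ (q *ₚ s)
  *ₚ-assoc [] q s n = refl
  *ₚ-assoc (a ∷ p) q s n = begin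
    coeff ((a • q +ₚ (0# ∷ p *ₚ q)) *ₚ s) n
      ≈⟨ *ₚ-comm (a • q +ₚ (0# ∷ p *ₚ q)) s n ⟩
    coeff (s *ₚ (a • q +ₚ (0# ∷ p *ₚ q))) n
      ≈⟨ *ₚ-distribˡ s (a • q) (0# ∷ p *ₚ q) n ⟩
    coeff (s *ₚ (a • q) +ₚ s *ₚ (0# ∷ p *ₚ q)) n
      ≈⟨ coeff-+ (s *ₚ (a • q)) _ n ⟩
    coeff (s *ₚ (a • q)) n + coeff (s *ₚ (0# ∷ p *ₚ q)) n
      ≈⟨ +-cong (scaled n) (shifted n) ⟩
    coeff (a • (q *ₚ s)) n + coeff (0# ∷ p *ₚ (q *ₚ s)) n
      ≈⟨ coeff-+ (a • (q *ₚ s)) _ n ⟨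
    coeff ((a ∷ p) *ₚ (q *ₚ s)) n  ∎
    where
    scaled : s *ₚ (a • q) ≈ₚ a • (q *ₚ s)
    scaled n = begin
      coeff (s *ₚ (a • q)) n   ≈⟨ *ₚ-•ʳ s a q n ⟩
      coeff (a • (s *ₚ q)) n   ≈⟨ coeff-• a (s *ₚ q) n ⟩
      a * coeff (s *ₚ q) n     ≈⟨ *-congˡ (*ₚ-comm s q n) ⟩
      a * coeff (q *ₚ s) n     ≈⟨ coeff-• a (q *ₚ s) n ⟨
      coeff (a • (q *ₚ s)) n   ∎
    shifted : s *ₚ (0# ∷ p *ₚ q) ≈ₚ 0# ∷ p *ₚ (q *ₚ s)
    shifted zero = trans (coeff-*-zero s _) (zeroʳ _)
    shifted (suc n) = begin
      coeff (s *ₚ (0# ∷ p *ₚ q)) (suc n)               ≈⟨ coeff-*-sucʳ s 0# (p *ₚ q) n ⟩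
      0# * coeff s (suc n) + coeff (s *ₚ (p *ₚ q)) n   ≈⟨ trans (+-congʳ (zeroˡ _)) (+-identityˡ _) ⟩
      coeff (s *ₚ (p *ₚ q)) n                          ≈⟨ *ₚ-comm s (p *ₚ q) n ⟩
      coeff ((p *ₚ q) *ₚ s) n                          ≈⟨ *ₚ-assoc p q s n ⟩
      coeff (p *ₚ (q *ₚ s)) n                          ∎

  const-*ₚ : ∀ a q n → coeff ((a ∷ []) *ₚ q) n ≈ a * coeff q n
  const-*ₚ a q zero    = coeff-*-zero (a ∷ []) q
  const-*ₚ a q (suc n) = trans (coeff-*-suc a [] q n) (+-identityʳ _)

  *ₚ-identityˡ : ∀ q → (1# ∷ []) *ₚ q ≈ₚ q
  *ₚ-identityˡ q n = trans (const-*ₚ 1# q n) (*-identityˡ _)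

  polynomialRing : CommutativeRing c ℓ
  polynomialRing = record
    { Carrier = Poly ; _≈_ = _≈ₚ_
    ; _+_ = _+ₚ_ ; _*_ = _*ₚ_ ; -_ = List.map (-_) ; 0# = [] ; 1# = 1# ∷ []
    ; isCommutativeRing = record
      { isRing = record
        { +-isAbelianGroup = record
          { isGroup = record
            { isMonoid = record
              { isSemigroup = record
                { isMagma = record
                  { isEquivalence = record
                    { refl = λ n → refl ; sym = λ e n → sym (e n) ; trans = λ e f n → trans (e n) (f n) }
                  ; ∙-cong = λ {p} {q} {u} {v} e f n → trans (coeff-+ p u n)
                      (trans (+-cong (e n) (f n)) (sym (coeff-+ q v n)))
                  }
                ; assoc = λ p q s n → begin
                    coeff ((p +ₚ q) +ₚ s) n              ≈⟨ coeff-+ (p +ₚ q) s n ⟩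
                    coeff (p +ₚ q) n + coeff s n         ≈⟨ +-congʳ (coeff-+ p q n) ⟩
                    coeff p n + coeff q n + coeff s n    ≈⟨ +-assoc _ _ _ ⟩
                    coeff p n + (coeff q n + coeff s n)  ≈⟨ +-congˡ (coeff-+ q s n) ⟨
                    coeff p n + coeff (q +ₚ s) n         ≈⟨ coeff-+ p (q +ₚ s) n ⟨
                    coeff (p +ₚ (q +ₚ s)) n              ∎
                }
              ; identity = (λ p n → refl) , λ p n → trans (coeff-+ p [] n) (+-identityʳ _)
              }
            ; inverse = (λ p n → trans (coeff-+ (List.map (-_) p) p n)
                          (trans (+-congʳ (coeff-neg p n)) (-‿inverseˡ _)))
                      , (λ p n → trans (coeff-+ p (List.map (-_) p) n)
                          (trans (+-congˡ (coeff-neg p n)) (-‿inverseʳ _)))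
            ; ⁻¹-cong = λ {p} {q} e n → trans (coeff-neg p n) (trans (-‿cong (e n)) (sym (coeff-neg q n)))
            }
          ; comm = λ p q n → trans (coeff-+ p q n) (trans (+-comm _ _) (sym (coeff-+ q p n)))
          }
        ; *-cong = λ {p} {p′} {q} {q′} → *ₚ-cong {p} {p′} {q} {q′}
        ; *-assoc = *ₚ-assoc
        ; *-identity = *ₚ-identityˡ , λ p n → trans (*ₚ-comm p (1# ∷ []) n) (*ₚ-identityˡ p n)
        ; distrib = *ₚ-distribˡ , λ p q s n → begin
            coeff ((q +ₚ s) *ₚ p) n              ≈⟨ *ₚ-comm (q +ₚ s) p n ⟩
            coeff (p *ₚ (q +ₚ s)) n              ≈⟨ *ₚ-distribˡ p q s n ⟩
            coeff (p *ₚ q +ₚ p *ₚ s) n           ≈⟨ coeff-+ (p *ₚ q) _ n ⟩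
            coeff (p *ₚ q) n + coeff (p *ₚ s) n  ≈⟨ +-cong (*ₚ-comm p q n) (*ₚ-comm p s n) ⟩
            coeff (q *ₚ p) n + coeff (s *ₚ p) n  ≈⟨ coeff-+ (q *ₚ p) _ n ⟨
            coeff (q *ₚ p +ₚ s *ₚ p) n           ∎
        }
      ; *-comm = *ₚ-comm
      }
    }

-- Determinants

-- A pair `(j , k)` encodes two distinct columns, `j` and `punchIn j k`. The pair
-- `(punchIn j k , pinch k j)` encodes the same two in the opposite order.
punchIn-pinch : ∀ {n} (j : Fin (suc n)) k → punchIn (punchIn j k) (pinch k j) ≡ j
punchIn-pinch {suc n} zero    k       = ≡.refl
punchIn-pinch {suc n} (suc j) zero    = ≡.refl
punchIn-pinch {suc n} (suc j) (suc k) = ≡.cong suc (punchIn-pinch j k)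

-- Deleting two columns in either order leaves the same columns in the same places, so both orders
-- have the same minor.
punchIn-punchIn : ∀ {n} (j : Fin (suc (suc n))) k l →
                  punchIn j (punchIn k l) ≡ punchIn (punchIn j k) (punchIn (pinch k j) l)
punchIn-punchIn zero    k       l       = ≡.refl
punchIn-punchIn (suc j) zero    l       = ≡.refl
punchIn-punchIn (suc j) (suc k) zero    = ≡.refl
punchIn-punchIn (suc j) (suc k) (suc l) = ≡.cong suc (punchIn-punchIn j k l)

module Determinant {c ℓ} (S : CommutativeRing c ℓ) where
  open CommutativeRing S hiding (zero)
  open RawSemiringDefs (RawRing.rawSemiring rawRing) using (_^_; product)
  open Algebra.Properties.Ring ring
  open Algebra.Properties.Semiring.Sum semiring
  open FiniteSums +-commutativeMonoid using (sum-≈ε; sum-single)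
  open Algebra.Solver.Ring.NaturalCoefficients.Default commutativeSemiring
  open Relation.Binary.Reasoning.Setoid setoid

  Rows : ℕ → ℕ → Set c
  Rows n d = Vector (Vector Carrier d) n

  infix 4 _≈ᵥ_
  _≈ᵥ_ : ∀ {d} → Vector Carrier d → Vector Carrier d → Set ℓ
  u ≈ᵥ v = ∀ j → u j ≈ v j

  δ : ∀ {n} → Matrix Carrier n
  δ i j = if does (i Fin.≟ j) then 1# else 0#

  δ-refl : ∀ {n} (i : Fin n) → δ i i ≡ 1#
  δ-refl i rewrite dec-true (i Fin.≟ i) ≡.refl = ≡.refl

  δ-≢ : ∀ {n} {i j : Fin n} → i ≢ j → δ i j ≡ 0#
  δ-≢ {i = i} {j} i≢j rewrite dec-false (i Fin.≟ j) i≢j = ≡.refl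

  sum-*δ : ∀ {n} (v : Vector Carrier n) i → sum (λ j → v j * δ j i) ≈ v i
  sum-*δ v i = trans
    (sum-single i λ j j≢i → trans (*-congˡ (reflexive (δ-≢ j≢i))) (zeroʳ _))
    (trans (*-congˡ (reflexive (δ-refl i))) (*-identityʳ _))

  sum-δ* : ∀ {n} (v : Vector Carrier n) i → sum (λ j → δ i j * v j) ≈ v i
  sum-δ* v i = trans
    (sum-single i λ j j≢i → trans (*-congʳ (reflexive (δ-≢ (j≢i ∘ ≡.sym)))) (zeroˡ _))
    (trans (*-congʳ (reflexive (δ-refl i))) (*-identityˡ _))

  sum-linear : ∀ {n} a b (u v : Vector Carrier n) →
               sum (λ j → a * u j + b * v j) ≈ a * sum u + b * sum v
  sum-linear a b u v = trans (∑-distrib-+ (λ j → a * u j) (λ j → b * v j))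
    (sym (+-cong (*-distribˡ-sum a u) (*-distribˡ-sum b v)))

  -- Linearity relates three families that agree off row `i` up to `≈`, not one family with row `i`
  -- updated: rows are functions, and families rebuilt in different ways agree only pointwise.
  record Multilinear {n d} (F : Rows n d → Carrier) : Set (c ⊔ ℓ) where
    field
      cong   : ∀ {L M} → (∀ i → L i ≈ᵥ M i) → F L ≈ F M
      linear : ∀ {L M N} i a b →
               (∀ k → k ≢ i → L k ≈ᵥ M k) → (∀ k → k ≢ i → L k ≈ᵥ N k) →
               (∀ j → L i j ≈ a * M i j + b * N i j) →
               F L ≈ a * F M + b * F N

  Alternating : ∀ {n d} → (Rows n d → Carrier) → Set (c ⊔ ℓ)
  Alternating F = ∀ M {i k} → i ≢ k → M i ≈ᵥ M k → F M ≈ 0#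

  module _ {n d} {F : Rows n d → Carrier} (ml : Multilinear F) where
    open Multilinear ml

    additive : ∀ {L M N} i →
               (∀ k → k ≢ i → L k ≈ᵥ M k) → (∀ k → k ≢ i → L k ≈ᵥ N k) →
               (∀ j → L i j ≈ M i j + N i j) → F L ≈ F M + F N
    additive i L≈M L≈N Li≈ = trans
      (linear i 1# 1# L≈M L≈N
        λ j → trans (Li≈ j) (sym (+-cong (*-identityˡ _) (*-identityˡ _))))
      (+-cong (*-identityˡ _) (*-identityˡ _))

    -- The factor `a` comes out by linearity and two equal rows remain. The second term that
    -- `linear` asks for is supplied with coefficient `0#`.
    scaledRow⇒0 : Alternating F → ∀ {M} a {i k} → i ≢ k → (∀ j → M i j ≈ a * M k j) → F M ≈ 0#
    scaledRow⇒0 alt {M} a {i} {k} i≢k Mi≈ = begin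
      F M                ≈⟨ linear i a 0# M≈M′ M≈M′ (λ j → trans (Mi≈ j) (sym (trans
                              (+-cong (*-congˡ (M′i≈ j)) (zeroˡ _)) (+-identityʳ _)))) ⟩
      a * F M′ + 0# * F M′  ≈⟨ +-cong (*-congˡ (alt M′ i≢k λ j → trans (M′i≈ j) (M≈M′ k (i≢k ∘ ≡.sym) j))) (zeroˡ _) ⟩
      a * 0# + 0#        ≈⟨ trans (+-identityʳ _) (zeroʳ a) ⟩
      0#                 ∎
      where
      M′ = updateAt M i (const (M k))
      M≈M′ : ∀ l → l ≢ i → M l ≈ᵥ M′ l
      M≈M′ l l≢i j = reflexive (≡.cong (λ r → r j) (≡.sym (updateAt-minimal l i M l≢i)))
      M′i≈ : M′ i ≈ᵥ M k
      M′i≈ j = reflexive (≡.cong (λ r → r j) (updateAt-updates i M))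

    -- Polarisation: with `u + w` in both places the value is 0, and so are the two diagonal terms
    -- of its expansion, which leaves the two mixed terms adding up to 0.
    swapRows : Alternating F → ∀ {L L′ i k} → i ≢ k →
               (∀ l → l ≢ i → l ≢ k → L l ≈ᵥ L′ l) → L i ≈ᵥ L′ k → L k ≈ᵥ L′ i →
               F L ≈ - F L′
    swapRows alt {L} {L′} {i} {k} i≢k L≈L′ Li≈ Lk≈ = +-inverseˡ-unique _ _ (begin
      F L + F L′                ≈⟨ +-cong (cong L≈) (cong L′≈) ⟩
      G u w + G w u             ≈⟨ +-cong (+-identityˡ _) (+-identityʳ _) ⟨
      0# + G u w + (G w u + 0#) ≈⟨ +-cong (+-congʳ (diagonal u)) (+-congˡ (diagonal w)) ⟨
      G u u + G u w + (G w u + G w w)  ≈⟨ +-cong (splitʳ u) (splitʳ w) ⟨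
      G u s + G w s             ≈⟨ splitˡ ⟨
      G s s                     ≈⟨ diagonal s ⟩
      0#                        ∎)
      where
      u = L i
      w = L k
      s = λ j → u j + w j
      put : Vector Carrier d → Vector Carrier d → Rows n d
      put x y = updateAt (updateAt L i (const x)) k (const y)
      G : Vector Carrier d → Vector Carrier d → Carrier
      G x y = F (put x y)
      putₖ : ∀ x y → put x y k ≡ y
      putₖ x y = updateAt-updates k _
      putᵢ : ∀ x y → put x y i ≡ x
      putᵢ x y = ≡.trans (updateAt-minimal i k _ i≢k) (updateAt-updates i L)
      put-≢ : ∀ x y l → l ≢ i → l ≢ k → put x y l ≡ L l
      put-≢ x y l l≢i l≢k = ≡.trans (updateAt-minimal l k _ l≢k) (updateAt-minimal l i L l≢i)
      at : ∀ {x y : Vector Carrier d} → x ≡ y → x ≈ᵥ y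
      at ≡.refl j = refl
      diagonal : ∀ x → G x x ≈ 0#
      diagonal x = alt (put x x) i≢k (at (≡.trans (putᵢ x x) (≡.sym (putₖ x x))))
      putˡ : ∀ x x′ y l → l ≢ i → put x y l ≈ᵥ put x′ y l
      putˡ x x′ y l l≢i with l Fin.≟ k
      ... | yes ≡.refl = at (≡.trans (putₖ x y) (≡.sym (putₖ x′ y)))
      ... | no  l≢k    = at (≡.trans (put-≢ x y l l≢i l≢k) (≡.sym (put-≢ x′ y l l≢i l≢k)))
      putʳ : ∀ x y y′ l → l ≢ k → put x y l ≈ᵥ put x y′ l
      putʳ x y y′ l l≢k with l Fin.≟ i
      ... | yes ≡.refl = at (≡.trans (putᵢ x y) (≡.sym (putᵢ x y′)))
      ... | no  l≢i    = at (≡.trans (put-≢ x y l l≢i l≢k) (≡.sym (put-≢ x y′ l l≢i l≢k)))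
      splitʳ : ∀ x → G x s ≈ G x u + G x w
      splitʳ x = additive k (putʳ x s u) (putʳ x s w)
        λ j → trans (at (putₖ x s) j) (sym (+-cong (at (putₖ x u) j) (at (putₖ x w) j)))
      splitˡ : G s s ≈ G u s + G w s
      splitˡ = additive i (putˡ s u s) (putˡ s w s)
        λ j → trans (at (putᵢ s s) j) (sym (+-cong (at (putᵢ u s) j) (at (putᵢ w s) j)))
      L≈ : ∀ l → L l ≈ᵥ put u w l
      L≈ l with l Fin.≟ i | l Fin.≟ k
      ... | yes ≡.refl | _          = at (≡.sym (putᵢ u w))
      ... | no _       | yes ≡.refl = at (≡.sym (putₖ u w))
      ... | no l≢i     | no l≢k     = at (≡.sym (put-≢ u w l l≢i l≢k))
      L′≈ : ∀ l → L′ l ≈ᵥ put w u l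
      L′≈ l j with l Fin.≟ i | l Fin.≟ k
      ... | yes ≡.refl | _          = trans (sym (Lk≈ j)) (at (≡.sym (putᵢ w u)) j)
      ... | no _       | yes ≡.refl = trans (sym (Li≈ j)) (at (≡.sym (putₖ w u)) j)
      ... | no l≢i     | no l≢k     =
        trans (sym (L≈L′ l l≢i l≢k j)) (at (≡.sym (put-≢ w u l l≢i l≢k)) j)

  cons-cong : ∀ {n d} {u v : Vector Carrier d} {M N : Rows n d} → u ≈ᵥ v → (∀ i → M i ≈ᵥ N i) →
              ∀ i → (u Vector.∷ M) i ≈ᵥ (v Vector.∷ N) i
  cons-cong e f zero    = e
  cons-cong e f (suc i) = f i

  module _ {n d} {F : Rows (suc n) d → Carrier} (ml : Multilinear F) where
    open Multilinear ml

    tail-multilinear : ∀ u → Multilinear (λ M → F (u Vector.∷ M))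
    tail-multilinear u = record
      { cong   = λ e → cong (cons-cong (λ _ → refl) e)
      ; linear = λ i a b e f g → linear (suc i) a b (extend e) (extend f) g
      }
      where
      extend : ∀ {i} {L M : Rows n d} → (∀ k → k ≢ i → L k ≈ᵥ M k) →
               ∀ k → k ≢ suc i → (u Vector.∷ L) k ≈ᵥ (u Vector.∷ M) k
      extend e zero    _   j = refl
      extend e (suc k) k≢i j = e k (k≢i ∘ ≡.cong suc) j

    tail-alternating : Alternating F → ∀ u → Alternating (λ M → F (u Vector.∷ M))
    tail-alternating alt u M i≢k e = alt (u Vector.∷ M) (i≢k ∘ Fin.suc-injective) e

    linear-sum : ∀ {m} (a : Vector Carrier m) (U : Rows m d) T →
                 F ((λ l → sum (λ j → a j * U j l)) Vector.∷ T) ≈ sum (λ j → a j * F (U j Vector.∷ T))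
    linear-sum {zero} a U T = trans
      (linear {M = zeros} {N = zeros} zero 0# 0# same same
        λ j → sym (trans (+-cong (zeroˡ _) (zeroˡ _)) (+-identityˡ _)))
      (trans (+-cong (zeroˡ _) (zeroˡ _)) (+-identityˡ _))
      where
      zeros = (λ _ → 0#) Vector.∷ T
      same : ∀ k → k ≢ zero → zeros k ≈ᵥ zeros k
      same k _ j = refl
    linear-sum {suc m} a U T = trans
      (linear zero (a zero) 1# same same λ j → +-congˡ (sym (*-identityˡ _)))
      (+-congˡ (trans (*-identityˡ _) (linear-sum (tail a) (tail U) T)))
      where
      same : ∀ {u v : Vector Carrier d} k → k ≢ zero → (u Vector.∷ T) k ≈ᵥ (v Vector.∷ T) k
      same zero    k≢0 = contradiction ≡.refl k≢0
      same (suc k) _ j = refl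

  -- Rows are exchanged one after the other, each time at the cost of a matrix with the difference
  -- in row `k`. The other rows of that matrix are partly old and partly new, which is why `vanish`
  -- must allow either at each index.
  replaceRows : ∀ {n d} {F : Rows n d → Carrier} → Multilinear F → ∀ {M N} →
                (∀ k L → (∀ l → l ≢ k → L l ≈ᵥ M l ⊎ L l ≈ᵥ N l) →
                         (∀ j → L k j ≈ M k j - N k j) → F L ≈ 0#) →
                F M ≈ F N
  replaceRows {zero} ml vanish = Multilinear.cong ml λ ()
  replaceRows {suc n} {d} {F} ml {M} {N} vanish = begin
    F M                         ≈⟨ additive ml zero same same split ⟩
    F (head N Vector.∷ tail M) + F (Δ Vector.∷ tail M)
      ≈⟨ +-congˡ (vanish zero _ (λ { zero 0≢0 → contradiction ≡.refl 0≢0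
                                   ; (suc l) _ → inj₁ λ j → refl }) λ j → refl) ⟩
    F (head N Vector.∷ tail M) + 0#  ≈⟨ +-identityʳ _ ⟩
    F (head N Vector.∷ tail M)
      ≈⟨ replaceRows (tail-multilinear ml (head N)) (λ k L L≈ Lk≈ → vanish (suc k) (head N Vector.∷ L)
           (λ { zero _ → inj₂ λ j → refl ; (suc l) l≢k → L≈ l (l≢k ∘ ≡.cong suc) }) Lk≈) ⟩
    F (head N Vector.∷ tail N)  ≈⟨ Multilinear.cong ml (λ { zero j → refl ; (suc l) j → refl }) ⟩
    F N                         ∎
    where
    Δ : Vector Carrier d
    Δ j = M zero j - N zero j
    same : ∀ {u} k → k ≢ zero → M k ≈ᵥ (u Vector.∷ tail M) k
    same zero    0≢0 = contradiction ≡.refl 0≢0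
    same (suc k) _ j = refl
    split : ∀ j → M zero j ≈ N zero j + (M zero j - N zero j)
    split j = sym (begin
      N zero j + (M zero j - N zero j)   ≈⟨ +-comm _ _ ⟩
      M zero j - N zero j + N zero j     ≈⟨ +-assoc _ _ _ ⟩
      M zero j + (- N zero j + N zero j) ≈⟨ +-congˡ (-‿inverseˡ _) ⟩
      M zero j + 0#                      ≈⟨ +-identityʳ _ ⟩
      M zero j                           ∎)

  insertAt-cong : ∀ {n} {u v : Vector Carrier n} i {a b} → u ≈ᵥ v → a ≈ b → insertAt u i a ≈ᵥ insertAt v i b
  insertAt-cong zero e f zero = f
  insertAt-cong zero e f (suc j) = e j
  insertAt-cong {suc n} (suc i) e f zero = e zero
  insertAt-cong {suc n} (suc i) e f (suc j) = insertAt-cong i (e ∘ suc) f j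

  insertAt-linear : ∀ {n} {u v w : Vector Carrier n} i {a b} → (∀ j → u j ≈ a * v j + b * w j) →
                    ∀ j → insertAt u i 0# j ≈ a * insertAt v i 0# j + b * insertAt w i 0# j
  insertAt-linear zero e zero = sym (trans (+-cong (zeroʳ _) (zeroʳ _)) (+-identityˡ _))
  insertAt-linear zero e (suc j) = e j
  insertAt-linear {suc n} (suc i) e zero = e zero
  insertAt-linear {suc n} (suc i) e (suc j) = insertAt-linear i (e ∘ suc) j

  insertAt-δ : ∀ {n} (j : Fin (suc n)) k → insertAt (δ k) j 0# ≈ᵥ δ (punchIn j k)
  insertAt-δ zero    k zero = refl
  insertAt-δ zero    k (suc l) = refl
  insertAt-δ (suc j) zero zero = refl
  insertAt-δ {suc n} (suc j) zero (suc l) = insertAt-0 j l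
    where
    insertAt-0 : ∀ {n} (j : Fin (suc n)) → insertAt {n = n} (λ _ → 0#) j 0# ≈ᵥ λ _ → 0#
    insertAt-0 zero zero = refl
    insertAt-0 zero (suc l) = refl
    insertAt-0 {suc n} (suc j) zero = refl
    insertAt-0 {suc n} (suc j) (suc l) = insertAt-0 j l
  insertAt-δ (suc j) (suc k) zero = refl
  insertAt-δ {suc n} (suc j) (suc k) (suc l) = insertAt-δ j k l

  -- What clearing column `j` takes away from a row is a multiple of the pivot row `δ j`, so that
  -- `scaledRow⇒0` applies to the difference.
  removed-coordinate : ∀ {n} (u : Vector Carrier (suc n)) j l →
                       u l - insertAt (removeAt u j) j 0# l ≈ u j * δ j l
  removed-coordinate u zero zero = trans (trans (+-congˡ -0#≈0#) (+-identityʳ _)) (sym (*-identityʳ _))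
  removed-coordinate u zero (suc l) = trans (-‿inverseʳ _) (sym (zeroʳ _))
  removed-coordinate {suc n} u (suc j) zero = trans (-‿inverseʳ _) (sym (zeroʳ _))
  removed-coordinate {suc n} u (suc j) (suc l) = removed-coordinate (tail u) j l

  -- Moving row `j` of the identity to the front costs `toℕ j` transpositions. One swap of the first
  -- two rows puts `δ zero` in its place; the other rows live on the remaining coordinates, where
  -- `G` is again multilinear and alternating.
  cycle-sign : ∀ {n} {F : Rows (suc n) (suc n) → Carrier} → Multilinear F → Alternating F → ∀ j →
               F (δ j Vector.∷ λ k → δ (punchIn j k)) ≈ (- 1#) ^ toℕ j * F δ
  cycle-sign ml alt zero = trans
    (Multilinear.cong ml λ { zero j → refl ; (suc k) j → refl }) (sym (*-identityˡ _))
  cycle-sign {suc n} {F} ml alt (suc j) = begin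
    F (δ (suc j) Vector.∷ λ k → δ (punchIn (suc j) k))
      ≈⟨ swapRows ml alt {i = zero} {k = suc zero} (λ ())
           (λ { zero 0≢0 _ → contradiction ≡.refl 0≢0
              ; (suc zero) _ 1≢1 → contradiction ≡.refl 1≢1
              ; (suc (suc l)) _ _ → shift-δ (punchIn j l) })
           (shift-δ j) (λ { zero → refl ; (suc k) → refl }) ⟩
    - G (δ j Vector.∷ λ k → δ (punchIn j k))   ≈⟨ -‿cong (cycle-sign G-ml G-alt j) ⟩
    - ((- 1#) ^ toℕ j * G δ)                   ≈⟨ -‿cong (*-congˡ (Multilinear.cong ml G-δ)) ⟩
    - ((- 1#) ^ toℕ j * F δ)                   ≈⟨ -1*x≈-x _ ⟨
    - 1# * ((- 1#) ^ toℕ j * F δ)              ≈⟨ *-assoc _ _ _ ⟨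
    (- 1#) ^ toℕ (suc j) * F δ                 ∎
    where
    shift : ∀ {d} → Vector Carrier d → Vector Carrier (suc d)
    shift u = 0# Vector.∷ u
    shift-δ : ∀ {m} (i : Fin m) → δ (suc i) ≈ᵥ shift (δ i)
    shift-δ i zero    = refl
    shift-δ i (suc l) = refl
    G : Rows (suc n) (suc n) → Carrier
    G M = F (δ zero Vector.∷ λ k → shift (M k))
    G-δ : ∀ k → (δ zero Vector.∷ λ k → shift (δ k)) k ≈ᵥ δ k
    G-δ zero    l = refl
    G-δ (suc k) zero = refl
    G-δ (suc k) (suc l) = refl
    shift-cong : ∀ {d} {u v : Vector Carrier d} → u ≈ᵥ v → shift u ≈ᵥ shift v
    shift-cong e zero    = refl
    shift-cong e (suc l) = e l
    G-ml : Multilinear G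
    G-ml = record
      { cong = λ e → Multilinear.cong (tail-multilinear ml (δ zero)) λ i → shift-cong (e i)
      ; linear = λ i a b e f g → Multilinear.linear (tail-multilinear ml (δ zero)) i a b
          (λ k k≢i → shift-cong (e k k≢i)) (λ k k≢i → shift-cong (f k k≢i))
          λ { zero → sym (trans (+-cong (zeroʳ _) (zeroʳ _)) (+-identityˡ _)) ; (suc l) → g l }
      }
    G-alt : Alternating G
    G-alt M i≢k e = tail-alternating ml alt (δ zero) (λ k → shift (M k)) i≢k (shift-cong e)

  detS : ∀ {n} → Matrix Carrier n → Carrier
  detS = det rawRing

  minor : ∀ {n} → Matrix Carrier (suc n) → Fin (suc n) → Matrix Carrier n
  minor M j i = removeAt (M (suc i)) j

  laplace : ∀ {n} → Matrix Carrier (suc n) → Vector Carrier (suc n)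
  laplace M j = (- 1#) ^ toℕ j * (M zero j * detS (minor M j))

  -- Expand the first row in the standard basis; row operations against that
  -- basis vector clear its column in the other rows.
  alternating-unique : ∀ {n} {F : Matrix Carrier n → Carrier} → Multilinear F → Alternating F →
                       ∀ M → F M ≈ detS M * F δ
  alternating-unique {zero} ml alt M = trans (Multilinear.cong ml λ ()) (sym (*-identityˡ _))
  alternating-unique {suc n} {F} ml alt M = begin
    F M
      ≈⟨ Multilinear.cong ml (λ { zero j → sym (sum-*δ (head M) j) ; (suc i) j → refl }) ⟩
    F ((λ l → sum (λ j → M zero j * δ j l)) Vector.∷ tail M)
      ≈⟨ linear-sum ml (head M) δ (tail M) ⟩
    sum (λ j → M zero j * F (δ j Vector.∷ tail M))
      ≈⟨ sum-cong-≋ {x = λ j → M zero j * F (δ j Vector.∷ tail M)} {λ j → laplace M j * F δ}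
           (λ j → trans (*-congˡ (pivot j)) (rearrange _ _ _ _)) ⟩
    sum (λ j → laplace M j * F δ)
      ≈⟨ *-distribʳ-sum (F δ) (laplace M) ⟨
    detS M * F δ ∎
    where
    embed : Fin (suc n) → Matrix Carrier n → Rows n (suc n)
    embed j N k = insertAt (N k) j 0#
    G : Fin (suc n) → Matrix Carrier n → Carrier
    G j N = F (δ j Vector.∷ embed j N)
    G-ml : ∀ j → Multilinear (G j)
    G-ml j = record
      { cong = λ e → Multilinear.cong (tail-multilinear ml (δ j)) λ i → insertAt-cong j (e i) refl
      ; linear = λ i a b e f g → Multilinear.linear (tail-multilinear ml (δ j)) i a b
          (λ k k≢i → insertAt-cong j (e k k≢i) refl) (λ k k≢i → insertAt-cong j (f k k≢i) refl)
          (insertAt-linear j g)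
      }
    G-alt : ∀ j → Alternating (G j)
    G-alt j N i≢k e = tail-alternating ml alt (δ j) (embed j N) i≢k (insertAt-cong j e refl)
    rearrange : ∀ m s d f → m * (d * (s * f)) ≈ s * (m * d) * f
    rearrange = solve 4 (λ m s d f → m :* (d :* (s :* f)) := s :* (m :* d) :* f) refl
    pivot : ∀ j → F (δ j Vector.∷ tail M) ≈ detS (minor M j) * ((- 1#) ^ toℕ j * F δ)
    pivot j = begin
      F (δ j Vector.∷ tail M)
        ≈⟨ replaceRows (tail-multilinear ml (δ j)) (λ k L _ Lk≈ →
             scaledRow⇒0 ml alt (M (suc k) j) {suc k} {zero} (λ ())
               λ l → trans (Lk≈ l) (removed-coordinate (M (suc k)) j l)) ⟩
      G j (minor M j)                 ≈⟨ alternating-unique (G-ml j) (G-alt j) (minor M j) ⟩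
      detS (minor M j) * G j δ
        ≈⟨ *-congˡ (Multilinear.cong (tail-multilinear ml (δ j)) (insertAt-δ j)) ⟩
      detS (minor M j) * F (δ j Vector.∷ λ k → δ (punchIn j k))
        ≈⟨ *-congˡ (cycle-sign ml alt j) ⟩
      detS (minor M j) * ((- 1#) ^ toℕ j * F δ) ∎

  -- The Laplace expansion is multilinear and alternating

  det-cong : ∀ {n} {M N : Matrix Carrier n} → (∀ i → M i ≈ᵥ N i) → detS M ≈ detS N
  det-cong {zero}  e = refl
  det-cong {suc n} {M} {N} e = sum-cong-≋ {x = laplace M} {laplace N} λ j →
    *-congˡ (*-cong (e zero j) (det-cong λ i → e (suc i) ∘ punchIn j))

  det-linear : ∀ {n} {L M N : Matrix Carrier n} i a b →
               (∀ k → k ≢ i → L k ≈ᵥ M k) → (∀ k → k ≢ i → L k ≈ᵥ N k) →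
               (∀ j → L i j ≈ a * M i j + b * N i j) →
               detS L ≈ a * detS M + b * detS N
  det-linear {suc n} {L} {M} {N} zero a b L≈M L≈N L₀≈ = trans
    (sum-cong-≋ {x = laplace L} {λ j → a * laplace M j + b * laplace N j} λ j → begin
      (- 1#) ^ toℕ j * (L zero j * detS (minor L j))
        ≈⟨ *-congˡ (trans (*-congʳ (L₀≈ j)) (distribʳ _ _ _)) ⟩
      (- 1#) ^ toℕ j * (a * M zero j * detS (minor L j) + b * N zero j * detS (minor L j))
        ≈⟨ *-congˡ (+-cong
             (*-congˡ (det-cong {M = minor L j} {minor M j} λ i → L≈M (suc i) (λ ()) ∘ punchIn j))
             (*-congˡ (det-cong {M = minor L j} {minor N j} λ i → L≈N (suc i) (λ ()) ∘ punchIn j))) ⟩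
      (- 1#) ^ toℕ j * (a * M zero j * detS (minor M j) + b * N zero j * detS (minor N j))
        ≈⟨ rearrange _ _ _ _ _ _ _ ⟩
      a * laplace M j + b * laplace N j ∎)
    (sum-linear a b (laplace M) (laplace N))
    where
    rearrange : ∀ s a b m d n e → s * (a * m * d + b * n * e) ≈ a * (s * (m * d)) + b * (s * (n * e))
    rearrange = solve 7 (λ s a b m d n e → s :* (a :* m :* d :+ b :* n :* e) :=
                                   a :* (s :* (m :* d)) :+ b :* (s :* (n :* e))) refl
  det-linear {suc n} {L} {M} {N} (suc i) a b L≈M L≈N Lᵢ≈ = trans
    (sum-cong-≋ {x = laplace L} {λ j → a * laplace M j + b * laplace N j} λ j → begin
      (- 1#) ^ toℕ j * (L zero j * detS (minor L j))
        ≈⟨ *-congˡ (*-congˡ (det-linear {L = minor L j} {minor M j} {minor N j} i a b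
             (λ k k≢i → L≈M (suc k) (k≢i ∘ Fin.suc-injective) ∘ punchIn j)
             (λ k k≢i → L≈N (suc k) (k≢i ∘ Fin.suc-injective) ∘ punchIn j)
             (Lᵢ≈ ∘ punchIn j))) ⟩
      (- 1#) ^ toℕ j * (L zero j * (a * detS (minor M j) + b * detS (minor N j)))
        ≈⟨ rearrange _ _ _ _ _ _ ⟩
      a * ((- 1#) ^ toℕ j * (L zero j * detS (minor M j))) +
      b * ((- 1#) ^ toℕ j * (L zero j * detS (minor N j)))
        ≈⟨ +-cong (*-congˡ (*-congˡ (*-congʳ (L≈M zero (λ ()) j))))
                  (*-congˡ (*-congˡ (*-congʳ (L≈N zero (λ ()) j)))) ⟩
      a * laplace M j + b * laplace N j ∎)
    (sum-linear a b (laplace M) (laplace N))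
    where
    rearrange : ∀ s l a d b e → s * (l * (a * d + b * e)) ≈ a * (s * (l * d)) + b * (s * (l * e))
    rearrange = solve 6 (λ s l a d b e → s :* (l :* (a :* d :+ b :* e)) :=
                                   a :* (s :* (l :* d)) :+ b :* (s :* (l :* e))) refl

  det-multilinear : ∀ {n} → Multilinear (detS {n})
  det-multilinear = record { cong = det-cong ; linear = det-linear }

  -- The terms at `(zero , k)` cancel those at `(suc k , zero)`, and the rest is the same sum one
  -- size smaller. Cancelling in pairs is valid in every ring, whereas a sum equal to its own
  -- negative need not vanish when 2 is not cancellable.
  sum-antisymmetric : ∀ {n} (f : Fin (suc n) → Fin n → Carrier) →
                      (∀ j k → f j k + f (punchIn j k) (pinch k j) ≈ 0#) →
                      sum (λ j → sum (f j)) ≈ 0#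
  sum-antisymmetric {zero}  f anti = +-identityʳ _
  sum-antisymmetric {suc n} f anti = begin
    sum (f zero) + sum (λ j → f (suc j) zero + sum (λ k → f (suc j) (suc k)))
      ≈⟨ +-congˡ (∑-distrib-+ (λ j → f (suc j) zero) (λ j → sum (λ k → f (suc j) (suc k)))) ⟩
    sum (f zero) + (sum (λ j → f (suc j) zero) + sum (λ j → sum (λ k → f (suc j) (suc k))))
      ≈⟨ +-assoc _ _ _ ⟨
    sum (f zero) + sum (λ j → f (suc j) zero) + sum (λ j → sum (λ k → f (suc j) (suc k)))
      ≈⟨ +-cong (trans (sym (∑-distrib-+ (f zero) (λ j → f (suc j) zero)))
                       (sum-≈ε {f = λ k → f zero k + f (suc k) zero} (anti zero)))
                (sum-antisymmetric (λ j k → f (suc j) (suc k)) λ j k → anti (suc j) (suc k)) ⟩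
    0# + 0#  ≈⟨ +-identityˡ _ ⟩
    0#       ∎

  -1*-1≈1 : - 1# * - 1# ≈ 1#
  -1*-1≈1 = trans (-1*x≈-x (- 1#)) (-‿involutive 1#)

  -- Of two distinct columns, the one deleted last has its index lowered by one exactly if it lies
  -- to the right of the other; changing the order therefore changes the total exponent by one.
  sign-antisymmetric : ∀ {n} (j : Fin (suc n)) k →
    (- 1#) ^ toℕ j * (- 1#) ^ toℕ k ≈ - ((- 1#) ^ toℕ (punchIn j k) * (- 1#) ^ toℕ (pinch k j))
  sign-antisymmetric {suc n} zero k = begin
    1# * s                ≈⟨ *-identityˡ s ⟩
    s                     ≈⟨ *-identityˡ s ⟨
    1# * s                ≈⟨ *-congʳ -1*-1≈1 ⟨
    - 1# * - 1# * s       ≈⟨ *-assoc _ _ _ ⟩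
    - 1# * (- 1# * s)     ≈⟨ -1*x≈-x _ ⟩
    - (- 1# * s)          ≈⟨ -‿cong (*-identityʳ _) ⟨
    - (- 1# * s * 1#)     ∎
    where s = (- 1#) ^ toℕ k
  sign-antisymmetric {suc n} (suc j) zero = begin
    - 1# * s * 1#      ≈⟨ *-identityʳ _ ⟩
    - 1# * s           ≈⟨ -1*x≈-x s ⟩
    - s                ≈⟨ -‿cong (*-identityˡ s) ⟨
    - (1# * s)         ∎
    where s = (- 1#) ^ toℕ j
  sign-antisymmetric {suc n} (suc j) (suc k) = begin
    - 1# * (- 1#) ^ toℕ j * (- 1# * (- 1#) ^ toℕ k)
      ≈⟨ rearrange (- 1#) _ _ ⟩
    - 1# * - 1# * ((- 1#) ^ toℕ j * (- 1#) ^ toℕ k)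
      ≈⟨ *-congˡ (sign-antisymmetric j k) ⟩
    - 1# * - 1# * - ((- 1#) ^ toℕ (punchIn j k) * (- 1#) ^ toℕ (pinch k j))
      ≈⟨ -‿distribʳ-* _ _ ⟨
    - (- 1# * - 1# * ((- 1#) ^ toℕ (punchIn j k) * (- 1#) ^ toℕ (pinch k j)))
      ≈⟨ -‿cong (rearrange (- 1#) _ _) ⟨
    - (- 1# * (- 1#) ^ toℕ (punchIn j k) * (- 1# * (- 1#) ^ toℕ (pinch k j))) ∎
    where
    rearrange : ∀ m s t → m * s * (m * t) ≈ m * m * (s * t)
    rearrange = solve 3 (λ m s t → m :* s :* (m :* t) := m :* m :* (s :* t)) refl

  -- Expanding along both rows gives a sum over ordered pairs of distinct columns. Reversing a pair
  -- keeps the product of entries, since the rows are equal, and the remaining minor, but reverses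
  -- the sign.
  det-firstTwoRowsEqual : ∀ {n} (M : Matrix Carrier (suc (suc n))) → M zero ≈ᵥ M (suc zero) → detS M ≈ 0#
  det-firstTwoRowsEqual {n} M e = trans
    (sum-cong-≋ {x = laplace M} {λ j → sum (f j)} λ j → trans
      (*-congˡ (*-distribˡ-sum (M zero j) (laplace (minor M j))))
      (*-distribˡ-sum ((- 1#) ^ toℕ j) (λ k → M zero j * laplace (minor M j) k)))
    (sum-antisymmetric f λ j k → trans (+-cong (normal j k) (normal′ j k)) (-‿inverseˡ _))
    where
    D : Fin (suc (suc n)) → Fin (suc n) → Carrier
    D j k = detS (λ i → removeAt (removeAt (M (suc (suc i))) j) k)
    f : Fin (suc (suc n)) → Fin (suc n) → Carrier
    f j k = (- 1#) ^ toℕ j * (M zero j * ((- 1#) ^ toℕ k * (M (suc zero) (punchIn j k) * D j k)))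
    shuffle : ∀ s x t y d → s * (x * (t * (y * d))) ≈ s * t * (x * y * d)
    shuffle = solve 5 (λ s x t y d → s :* (x :* (t :* (y :* d))) := s :* t :* (x :* y :* d)) refl
    common : Fin (suc (suc n)) → Fin (suc n) → Carrier
    common j k = (- 1#) ^ toℕ (punchIn j k) * (- 1#) ^ toℕ (pinch k j) *
                 (M zero j * M zero (punchIn j k) * D j k)
    normal : ∀ j k → f j k ≈ - common j k
    normal j k = begin
      f j k  ≈⟨ shuffle _ _ _ _ _ ⟩
      (- 1#) ^ toℕ j * (- 1#) ^ toℕ k * (M zero j * M (suc zero) (punchIn j k) * D j k)
        ≈⟨ *-cong (sign-antisymmetric j k) (*-congʳ (*-congˡ (sym (e (punchIn j k))))) ⟩
      - ((- 1#) ^ toℕ (punchIn j k) * (- 1#) ^ toℕ (pinch k j)) *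
        (M zero j * M zero (punchIn j k) * D j k)
        ≈⟨ -‿distribˡ-* _ _ ⟨
      - common j k ∎
    normal′ : ∀ j k → f (punchIn j k) (pinch k j) ≈ common j k
    normal′ j k = trans (shuffle _ _ _ _ _) (*-congˡ (*-cong
      (trans (*-congˡ (trans (sym (e _)) (reflexive (≡.cong (M zero) (punchIn-pinch j k))))) (*-comm _ _))
      (det-cong λ i l → reflexive (≡.cong (M (suc (suc i))) (≡.sym (punchIn-punchIn j k l))))))

  -- A swap below the first row brings the repeated row into second place. It changes the sign of
  -- every minor because the smaller determinant is alternating, so the whole expansion changes
  -- sign.
  det-firstRowRepeated : ∀ {n} → Alternating (detS {n}) → ∀ (M : Matrix Carrier (suc n)) k → M zero ≈ᵥ M (suc k) → detS M ≈ 0#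
  det-firstRowRepeated alt M zero e = det-firstTwoRowsEqual M e
  det-firstRowRepeated {suc (suc n)} alt M (suc k) e = begin
    detS M                     ≈⟨ sum-cong-≋ {x = laplace M} {λ j → - 1# * laplace M′ j} negated ⟩
    sum (λ j → - 1# * laplace M′ j)
                               ≈⟨ *-distribˡ-sum (- 1#) (laplace M′) ⟨
    - 1# * detS M′             ≈⟨ *-congˡ (det-firstTwoRowsEqual M′ e) ⟩
    - 1# * 0#                  ≈⟨ zeroʳ _ ⟩
    0#                         ∎
    where
    T : Rows (suc (suc n)) (suc (suc (suc n)))
    T = M (suc (suc k)) Vector.∷ updateAt (λ i → M (suc (suc i))) k (const (M (suc zero)))
    M′ : Matrix Carrier (suc (suc (suc n)))
    M′ = M zero Vector.∷ T
    at : ∀ {d} {u v : Vector Carrier d} → u ≡ v → u ≈ᵥ v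
    at ≡.refl j = refl
    swapMinors : ∀ j → detS (minor M j) ≈ - detS (minor M′ j)
    swapMinors j = swapRows det-multilinear alt
      {L = minor M j} {minor M′ j} {i = zero} {suc k} (λ ())
      (λ { zero 0≢0 _ → contradiction ≡.refl 0≢0
         ; (suc l) _ l≢k → at (≡.sym (updateAt-minimal l k (λ i → M (suc (suc i))) (l≢k ∘ ≡.cong suc)))
                           ∘ punchIn j })
      (at (≡.sym (updateAt-updates k (λ i → M (suc (suc i))))) ∘ punchIn j)
      (λ l → refl)
    negated : ∀ j → laplace M j ≈ - 1# * laplace M′ j
    negated j = begin
      (- 1#) ^ toℕ j * (M zero j * detS (minor M j))      ≈⟨ *-congˡ (*-congˡ (swapMinors j)) ⟩
      (- 1#) ^ toℕ j * (M zero j * - detS (minor M′ j))   ≈⟨ *-congˡ (-‿distribʳ-* _ _) ⟨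
      (- 1#) ^ toℕ j * - (M zero j * detS (minor M′ j))   ≈⟨ -‿distribʳ-* _ _ ⟨
      - laplace M′ j                                      ≈⟨ -1*x≈-x _ ⟨
      - 1# * laplace M′ j                                 ∎

  det-alternating : ∀ {n} → Alternating (detS {n})
  det-alternating {suc n} M {suc i} {suc k} i≢k e = sum-≈ε {f = laplace M} λ j → trans
    (*-congˡ (trans
      (*-congˡ (det-alternating (minor M j) {i} {k} (i≢k ∘ ≡.cong suc) (e ∘ punchIn j)))
      (zeroʳ _)))
    (zeroʳ _)
  det-alternating {suc n} M {zero}  {zero}  i≢k e = contradiction ≡.refl i≢k
  det-alternating {suc n} M {zero}  {suc k} i≢k e = det-firstRowRepeated det-alternating M k e
  det-alternating {suc n} M {suc i} {zero}  i≢k e = det-firstRowRepeated det-alternating M i (sym ∘ e)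

  -- Products and inverses of matrices

  infixl 7 _⊗_
  _⊗_ : ∀ {n} → Matrix Carrier n → Matrix Carrier n → Matrix Carrier n
  (M ⊗ N) i j = sum λ k → M i k * N k j

  -- With `N` fixed, the left-hand side is multilinear and alternating in the rows of `M`, hence
  -- determined by its value at the identity.
  det-⊗ : ∀ {n} (M N : Matrix Carrier n) → detS (M ⊗ N) ≈ detS M * detS N
  det-⊗ M N = trans (alternating-unique ⊗N-multilinear ⊗N-alternating M)
    (*-congˡ (det-cong λ i j → sum-δ* (λ k → N k j) i))
    where
    row-cong : ∀ {u v} → u ≈ᵥ v → ∀ j → sum (λ k → u k * N k j) ≈ sum (λ k → v k * N k j)
    row-cong e j = sum-cong-≋ λ k → *-congʳ (e k)
    ⊗N-multilinear : Multilinear (λ M → detS (M ⊗ N))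
    ⊗N-multilinear = record
      { cong   = λ e → det-cong λ i → row-cong (e i)
      ; linear = λ i a b e f g → det-linear i a b (λ k k≢i → row-cong (e k k≢i)) (λ k k≢i → row-cong (f k k≢i))
          λ j → trans (sum-cong-≋ λ k → trans (*-congʳ (g k)) (trans (distribʳ _ _ _)
            (+-cong (*-assoc _ _ _) (*-assoc _ _ _)))) (sum-linear a b (λ k → _ * N k j) (λ k → _ * N k j))
      }
    ⊗N-alternating : Alternating (λ M → detS (M ⊗ N))
    ⊗N-alternating M i≢k e = det-alternating (M ⊗ N) i≢k (row-cong e)

  det-diagonal : ∀ {n} (M : Matrix Carrier n) → (∀ i j → i ≢ j → M i j ≈ 0#) →
                 detS M ≈ product (λ i → M i i)
  det-diagonal {zero}  M off = refl
  det-diagonal {suc n} M off = begin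
    detS M ≈⟨ sum-single {f = laplace M} zero
                (λ j j≢0 → trans (*-congˡ (trans (*-congʳ (off zero j (j≢0 ∘ ≡.sym))) (zeroˡ _))) (zeroʳ _)) ⟩
    1# * (M zero zero * detS (λ i j → M (suc i) (suc j)))
      ≈⟨ *-identityˡ _ ⟩
    M zero zero * detS (λ i j → M (suc i) (suc j))
      ≈⟨ *-congˡ (det-diagonal _ λ i j i≢j → off (suc i) (suc j) (i≢j ∘ Fin.suc-injective)) ⟩
    M zero zero * product (λ i → M (suc i) (suc i)) ∎

  product-1 : ∀ {n} {f : Vector Carrier n} → (∀ i → f i ≈ 1#) → product f ≈ 1#
  product-1 {zero}  e = refl
  product-1 {suc n} e = trans (*-cong (e zero) (product-1 (e ∘ suc))) (*-identityˡ _)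

  det-δ : ∀ {n} → detS (δ {n}) ≈ 1#
  det-δ {n} = trans (det-diagonal (δ {n}) λ i j i≢j → reflexive (δ-≢ i≢j)) (product-1 {n} λ i → reflexive (δ-refl i))

  -- The solutions for the columns of the identity are the columns of a right inverse, and
  -- multiplicativity then makes the determinant a unit.
  det-rightInverse : ∀ {n} (M : Matrix Carrier n) →
    (∀ (w : Vector Carrier n) → Σ[ v ∈ Vector Carrier n ] (∀ i → sum (λ j → M i j * v j) ≈ w i)) → ∃[ d ] detS M * d ≈ 1#
  det-rightInverse {n} M solvable = detS N , trans (sym (det-⊗ M N)) (trans (det-cong MN≈δ) (det-δ {n}))
    where
    N : Matrix Carrier n
    N k j = proj₁ (solvable (λ i → δ i j)) k
    MN≈δ : ∀ i j → (M ⊗ N) i j ≈ δ i j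
    MN≈δ i j = proj₂ (solvable (λ i → δ i j)) i

module _ {c₁ ℓ₁ c₂ ℓ₂} (S : CommutativeRing c₁ ℓ₁) (T : CommutativeRing c₂ ℓ₂) where
  private
    module S = CommutativeRing S
    module T = CommutativeRing T
  open RingMorphisms S.rawRing T.rawRing using (IsRingHomomorphism)

  -- Applied to the constant coefficient of polynomials, this allows setting X = 0 before the
  -- determinant is taken.
  det-homo : ∀ {φ} → IsRingHomomorphism φ → ∀ {n} (M : Matrix S.Carrier n) →
             φ (det S.rawRing M) T.≈ det T.rawRing (λ i j → φ (M i j))
  det-homo {φ} hom = go
    where
    open IsRingHomomorphism hom
    open RawSemiringDefs (RawRing.rawSemiring S.rawRing) using () renaming (_^_ to _^ˢ_; sum to sumˢ)
    open RawSemiringDefs (RawRing.rawSemiring T.rawRing) using () renaming (_^_ to _^ᵗ_; sum to sumᵗ)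
    open Algebra.Properties.Semiring.Sum T.semiring using (sum-cong-≋)
    sum-homo : ∀ {n} (f : Vector S.Carrier n) → φ (sumˢ f) T.≈ sumᵗ (φ ∘ f)
    sum-homo {zero}  f = 0#-homo
    sum-homo {suc n} f = T.trans (+-homo _ _) (T.+-congˡ (sum-homo (tail f)))
    sign-homo : ∀ k → φ ((S.- S.1#) ^ˢ k) T.≈ (T.- T.1#) ^ᵗ k
    sign-homo zero    = 1#-homo
    sign-homo (suc k) = T.trans (*-homo _ _)
      (T.*-cong (T.trans (-‿homo _) (T.-‿cong 1#-homo)) (sign-homo k))
    go : ∀ {n} (M : Matrix S.Carrier n) → φ (det S.rawRing M) T.≈ det T.rawRing (λ i j → φ (M i j))
    go {zero}  M = 1#-homo
    go {suc n} M = T.trans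
      (sum-homo λ j → (S.- S.1#) ^ˢ toℕ j S.* (M zero j S.* det S.rawRing (λ i → removeAt (M (suc i)) j)))
      (sum-cong-≋ {y = λ j → (T.- T.1#) ^ᵗ toℕ j T.* (φ (M zero j) T.*
                       det T.rawRing (λ i → removeAt (λ l → φ (M (suc i) l)) j))}
        λ j → T.trans (*-homo _ _) (T.*-cong (sign-homo (toℕ j))
        (T.trans (*-homo _ _) (T.*-congˡ (go (λ i → removeAt (M (suc i)) j))))))

-- Matrices with repeated rows

open Algebra.Properties.Semiring.Sum ℕ.+-*-semiring using () renaming (sum to ∑ℕ)

moved : ∀ {n} → (Fin n → Fin n) → ℕ
moved f = ∑ℕ λ i → if does (f i Fin.≟ i) then 0 else 1

-- If A factors through the idempotent rep, then with R the matrix of rep and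
-- u = 1 - x one has x I - A = (x I + u R)(I - u R - A).
module RepeatedRows {c ℓ} (S : CommutativeRing c ℓ) where
  open CommutativeRing S hiding (zero)
  open Determinant S
  open RawSemiringDefs (RawRing.rawSemiring rawRing) using (_^_; product)
  open Algebra.Properties.Ring ring
  open Algebra.Properties.Semiring.Sum semiring
  open Algebra.Solver.Ring.NaturalCoefficients.Default commutativeSemiring
  open Relation.Binary.Reasoning.Setoid setoid

  module _ {n} (rep : Fin n → Fin n) (rep-idem : ∀ i → rep (rep i) ≡ rep i) (x : Carrier) where
    private
      u : Carrier
      u = 1# - x

      x+u≈1 : x + u ≈ 1#
      x+u≈1 = trans (+-comm _ _) (trans (+-assoc _ _ _)
        (trans (+-congˡ (-‿inverseˡ x)) (+-identityʳ 1#)))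

      T D : Matrix Carrier n
      T i j = x * δ i j + u * δ (rep i) j
      D i j = (if does (rep i Fin.≟ i) then 1# else x) * δ i j

      T-fixed : ∀ i → rep i ≡ i → T i ≈ᵥ δ i
      T-fixed i ri≡i j = begin
        x * δ i j + u * δ (rep i) j  ≡⟨ ≡.cong (λ k → x * δ i j + u * δ k j) ri≡i ⟩
        x * δ i j + u * δ i j        ≈⟨ distribʳ _ _ _ ⟨
        (x + u) * δ i j              ≈⟨ *-congʳ x+u≈1 ⟩
        1# * δ i j                   ≈⟨ *-identityˡ _ ⟩
        δ i j                        ∎

      D-fixed : ∀ i → rep i ≡ i → D i ≈ᵥ δ i
      D-fixed i ri≡i j with rep i Fin.≟ i
      ... | yes _ = *-identityˡ _
      ... | no ri≢i = contradiction ri≡i ri≢i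

      zeroRow⇒0 : ∀ {M : Matrix Carrier n} i → (∀ j → M i j ≈ 0#) → detS M ≈ 0#
      zeroRow⇒0 {M} i Mi≈0 = trans
        (det-linear {L = M} {M} {M} i 0# 0# (λ k _ j → refl) (λ k _ j → refl)
          λ j → trans (Mi≈0 j) (sym (trans (+-cong (zeroˡ _) (zeroˡ _)) (+-identityˡ _))))
        (trans (+-cong (zeroˡ _) (zeroˡ _)) (+-identityˡ _))

      -- In a row moved by `rep`, the term with `u` is a multiple of row `rep i`, which by
      -- idempotence and `x + u ≈ 1#` is `δ (rep i)`. Clearing it leaves a diagonal with `x` at the
      -- moved indices and `1#` at the others.
      det-T : detS T ≈ x ^ moved rep
      det-T = begin
        detS T                     ≈⟨ replaceRows det-multilinear {T} {D} vanish ⟩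
        detS D                     ≈⟨ det-diagonal D (λ i j i≢j → trans (*-congˡ (reflexive (δ-≢ i≢j))) (zeroʳ _)) ⟩
        product (λ i → D i i)      ≈⟨ product-moved rep ⟩
        x ^ moved rep              ∎
        where
        -- The embedding `e` stands in for the identity so that the induction can pass to a tail of
        -- the indices.
        product-moved : ∀ {m n} {e : Fin m → Fin n} (f : Fin m → Fin n) →
          product (λ i → (if does (f i Fin.≟ e i) then 1# else x) * δ (e i) (e i)) ≈
          x ^ ∑ℕ (λ i → if does (f i Fin.≟ e i) then 0 else 1)
        product-moved {zero} f = refl
        product-moved {suc m} {e = e} f with does (f zero Fin.≟ e zero)
        ... | true  = trans
          (*-cong (trans (*-identityˡ _) (reflexive (δ-refl (e zero)))) (product-moved (f ∘ suc))) (*-identityˡ _)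
        ... | false =
          *-cong (trans (*-congˡ (reflexive (δ-refl (e zero)))) (*-identityʳ _)) (product-moved (f ∘ suc))
        vanish : ∀ k L → (∀ l → l ≢ k → L l ≈ᵥ T l ⊎ L l ≈ᵥ D l) →
                 (∀ j → L k j ≈ T k j - D k j) → detS L ≈ 0#
        vanish k L L≈ Lk≈ with rep k Fin.≟ k
        ... | yes rk≡k = zeroRow⇒0 k λ j → trans (Lk≈ j)
          (trans (+-cong (T-fixed k rk≡k j) (-‿cong (*-identityˡ _))) (-‿inverseʳ _))
        ... | no rk≢k = scaledRow⇒0 det-multilinear det-alternating {L} u {k} {rep k} (rk≢k ∘ ≡.sym)
          λ j → trans (Lk≈ j) (trans (cancel _ _) (*-congˡ (sym (Lrk≈ j))))
          where
          cancel : ∀ a b → a + b - a ≈ b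
          cancel a b = trans (+-congʳ (+-comm a b))
            (trans (+-assoc _ _ _) (trans (+-congˡ (-‿inverseʳ a)) (+-identityʳ b)))
          -- Row `rep k` is the same in `T` and in `D`, so it does not matter whether it has been
          -- replaced already.
          Lrk≈ : L (rep k) ≈ᵥ δ (rep k)
          Lrk≈ j with L≈ (rep k) rk≢k
          ... | inj₁ e = trans (e j) (T-fixed (rep k) (rep-idem k) j)
          ... | inj₂ e = trans (e j) (D-fixed (rep k) (rep-idem k) j)

    reduced : Matrix Carrier n → Matrix Carrier n
    reduced A i j = δ i j + - u * δ (rep i) j + - A i j

    -- With R the matrix of `rep`, idempotence gives R R = R and the hypothesis gives R A = A. The
    -- product of the two factors is therefore x I + ((x + u)(- u) + u) R - (x + u) A, and
    -- `x + u ≈ 1#`.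
    det-reduced : ∀ A → (∀ i j → A (rep i) j ≈ A i j) →
                  detS (λ i j → x * δ i j + - A i j) ≈ x ^ moved rep * detS (reduced A)
    det-reduced A A-rep = begin
      detS (λ i j → x * δ i j + - A i j)  ≈⟨ det-cong factor ⟩
      detS (T ⊗ Q)                        ≈⟨ det-⊗ T Q ⟩
      detS T * detS Q                     ≈⟨ *-congʳ det-T ⟩
      x ^ moved rep * detS Q              ∎
      where
      Q = reduced A
      expand : ∀ x u d v r b →
        x * (d + v * r + b) + u * (r + v * r + b) ≈ x * d + ((x + u) * v + u) * r + (x + u) * b
      expand = solve 6 (λ x u d v r b →
        x :* (d :+ v :* r :+ b) :+ u :* (r :+ v :* r :+ b) :=
        x :* d :+ ((x :+ u) :* v :+ u) :* r :+ (x :+ u) :* b) refl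
      factor : ∀ i → (λ j → x * δ i j + - A i j) ≈ᵥ (T ⊗ Q) i
      factor i j = sym (begin
        sum (λ k → (x * δ i k + u * δ (rep i) k) * Q k j)
          ≈⟨ sum-cong-≋ {n} (λ k → trans (distribʳ _ _ _) (+-cong (*-assoc _ _ _) (*-assoc _ _ _))) ⟩
        sum (λ k → x * (δ i k * Q k j) + u * (δ (rep i) k * Q k j))
          ≈⟨ sum-linear x u (λ k → δ i k * Q k j) (λ k → δ (rep i) k * Q k j) ⟩
        x * sum (λ k → δ i k * Q k j) + u * sum (λ k → δ (rep i) k * Q k j)
          ≈⟨ +-cong (*-congˡ (sum-δ* (λ k → Q k j) i)) (*-congˡ (sum-δ* (λ k → Q k j) (rep i))) ⟩
        x * Q i j + u * Q (rep i) j
          ≈⟨ +-congˡ (*-congˡ (+-cong (+-congˡ (*-congˡ (reflexive (≡.cong (λ k → δ k j) (rep-idem i)))))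
                                      (-‿cong (A-rep i j)))) ⟩
        x * (δ i j + - u * δ (rep i) j + - A i j) + u * (δ (rep i) j + - u * δ (rep i) j + - A i j)
          ≈⟨ expand _ _ _ _ _ _ ⟩
        x * δ i j + ((x + u) * - u + u) * δ (rep i) j + (x + u) * - A i j
          ≈⟨ +-cong (+-congˡ (trans (*-congʳ vanishing) (zeroˡ _)))
                    (trans (*-congʳ x+u≈1) (*-identityˡ _)) ⟩
        x * δ i j + 0# + - A i j
          ≈⟨ +-congʳ (+-identityʳ _) ⟩
        x * δ i j + - A i j ∎)
        where
        vanishing : (x + u) * - u + u ≈ 0#
        vanishing = trans (+-congʳ (trans (*-congʳ x+u≈1) (*-identityˡ _))) (-‿inverseˡ u)

  -- The operator I - R kills class functions and fixes functions that vanish at the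
  -- representatives, such as `v₁`. For `v₀ + v₁` with a class function `v₀` the system thus becomes
  -- A v₀ = - w ∘ rep - A v₁, whose right-hand side is again a class function.
  reduced-solvable : ∀ {n} (rep : Fin n → Fin n) → (∀ i → rep (rep i) ≡ rep i) →
    (A : Matrix Carrier n) → (∀ i j → A (rep i) j ≈ A i j) →
    (∀ (f : Vector Carrier n) → (∀ i → f (rep i) ≈ f i) →
      Σ[ v ∈ Vector Carrier n ] ((∀ i → v (rep i) ≈ v i) × (∀ i → sum (λ j → A i j * v j) ≈ f i))) →
    ∀ (w : Vector Carrier n) → Σ[ v ∈ Vector Carrier n ]
      (∀ i → sum (λ j → (δ i j + - 1# * δ (rep i) j + - A i j) * v j) ≈ w i)
  reduced-solvable {n} rep rep-idem A A-rep solveClass w = v , solves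
    where
    v₁ f : Vector Carrier n
    v₁ i = w i - w (rep i)
    f i = - w (rep i) - sum (λ j → A i j * v₁ j)
    solution = solveClass f λ i → +-cong (-‿cong (reflexive (≡.cong w (rep-idem i))))
      (-‿cong (sum-cong-≋ {n} λ j → *-congʳ (A-rep i j)))
    v₀ v : Vector Carrier n
    v₀ = proj₁ solution
    v j = v₀ j + v₁ j
    v-moved : ∀ i → v i + - 1# * v (rep i) ≈ w i - w (rep i)
    v-moved i = begin
      v₀ i + v₁ i + - 1# * (v₀ (rep i) + (w (rep i) - w (rep (rep i))))
        ≈⟨ +-congˡ (-1*x≈-x _) ⟩
      v₀ i + v₁ i - (v₀ (rep i) + (w (rep i) - w (rep (rep i))))
        ≈⟨ +-congˡ (-‿cong (+-cong (proj₁ (proj₂ solution) i)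
             (trans (+-congˡ (-‿cong (reflexive (≡.cong w (rep-idem i))))) (-‿inverseʳ _)))) ⟩
      v₀ i + v₁ i - (v₀ i + 0#)   ≈⟨ +-congˡ (-‿cong (+-identityʳ _)) ⟩
      v₀ i + v₁ i - v₀ i          ≈⟨ +-congʳ (+-comm _ _) ⟩
      v₁ i + v₀ i - v₀ i          ≈⟨ +-assoc _ _ _ ⟩
      v₁ i + (v₀ i - v₀ i)        ≈⟨ +-congˡ (-‿inverseʳ _) ⟩
      v₁ i + 0#                   ≈⟨ +-identityʳ _ ⟩
      v₁ i                        ∎
    Av : ∀ i → sum (λ j → A i j * v j) ≈ - w (rep i)
    Av i = begin
      sum (λ j → A i j * (v₀ j + v₁ j))
        ≈⟨ sum-cong-≋ {n} (λ j → distribˡ _ _ _) ⟩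
      sum (λ j → A i j * v₀ j + A i j * v₁ j)
        ≈⟨ ∑-distrib-+ {n} _ _ ⟩
      sum (λ j → A i j * v₀ j) + sum (λ j → A i j * v₁ j)
        ≈⟨ +-congʳ (proj₂ (proj₂ solution) i) ⟩
      - w (rep i) - sum (λ j → A i j * v₁ j) + sum (λ j → A i j * v₁ j)
        ≈⟨ +-assoc _ _ _ ⟩
      - w (rep i) + (- sum (λ j → A i j * v₁ j) + sum (λ j → A i j * v₁ j))
        ≈⟨ trans (+-congˡ (-‿inverseˡ _)) (+-identityʳ _) ⟩
      - w (rep i) ∎
    spread : ∀ d e r a y → (d + e * r + a) * y ≈ (d * y + e * (r * y)) + a * y
    spread = solve 5 (λ d e r a y → (d :+ e :* r :+ a) :* y := (d :* y :+ e :* (r :* y)) :+ a :* y) refl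
    solves : ∀ i → sum (λ j → (δ i j + - 1# * δ (rep i) j + - A i j) * v j) ≈ w i
    solves i = begin
      sum (λ j → (δ i j + - 1# * δ (rep i) j + - A i j) * v j)
        ≈⟨ sum-cong-≋ {n} (λ j → trans (spread _ _ _ _ _) (+-cong (+-congʳ (sym (*-identityˡ _)))
             (trans (sym (-‿distribˡ-* _ _)) (sym (-1*x≈-x _))))) ⟩
      sum (λ j → 1# * (δ i j * v j) + - 1# * (δ (rep i) j * v j) + - 1# * (A i j * v j))
        ≈⟨ ∑-distrib-+ {n} _ _ ⟩
      sum (λ j → 1# * (δ i j * v j) + - 1# * (δ (rep i) j * v j)) + sum (λ j → - 1# * (A i j * v j))
        ≈⟨ +-cong (sum-linear {n} 1# (- 1#) _ _) (sym (*-distribˡ-sum {n} (- 1#) _)) ⟩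
      1# * sum (λ j → δ i j * v j) + - 1# * sum (λ j → δ (rep i) j * v j) + - 1# * sum (λ j → A i j * v j)
        ≈⟨ +-cong (+-cong (trans (*-identityˡ _) (sum-δ* v i)) (*-congˡ (sum-δ* v (rep i)))) (*-congˡ (Av i)) ⟩
      v i + - 1# * v (rep i) + - 1# * - w (rep i)
        ≈⟨ +-cong (v-moved i) (trans (-1*x≈-x _) (-‿involutive _)) ⟩
      w i - w (rep i) + w (rep i)
        ≈⟨ trans (+-assoc _ _ _) (trans (+-congˡ (-‿inverseˡ _)) (+-identityʳ _)) ⟩
      w i ∎

-- Spectra over a Heyting field

module PolynomialEvaluation {c ℓ} (K : CommutativeRing c ℓ) where
  open CommutativeRing K hiding (zero)
  open Polynomial K
  open PolynomialRing K
  open Algebra.Properties.Ring ring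
  open Algebra.Properties.CommutativeSemigroup +-commutativeSemigroup using (interchange)
  open Algebra.Properties.CommutativeSemigroup *-commutativeSemigroup using (x∙yz≈y∙xz)
  open Relation.Binary.Reasoning.Setoid setoid
  private module P = CommutativeRing polynomialRing
  open RingMorphisms P.rawRing rawRing using (IsRingHomomorphism)

  coeff₀-isRingHomomorphism : IsRingHomomorphism (λ p → coeff p 0)
  coeff₀-isRingHomomorphism = record
    { isSemiringHomomorphism = record
      { isNearSemiringHomomorphism = record
        { +-isMonoidHomomorphism = record
          { isMagmaHomomorphism = record
            { isRelHomomorphism = record { cong = λ e → e 0 }
            ; homo = λ p q → coeff-+ p q 0
            }
          ; ε-homo = refl
          }
        ; *-homo = coeff-*-zero
        }
      ; 1#-homo = refl
      }
    ; -‿homo = λ p → coeff-neg p 0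
    }

  eval-≈[] : ∀ p x → p ≈ₚ [] → eval p x ≈ 0#
  eval-≈[] []      x e = refl
  eval-≈[] (a ∷ p) x e = trans (+-cong (e 0) (trans (*-congˡ (eval-≈[] p x (e ∘ suc))) (zeroʳ x))) (+-identityˡ _)

  eval-cong : ∀ p q x → p ≈ₚ q → eval p x ≈ eval q x
  eval-cong []      q       x e = sym (eval-≈[] q x (sym ∘ e))
  eval-cong (a ∷ p) []      x e = eval-≈[] (a ∷ p) x e
  eval-cong (a ∷ p) (b ∷ q) x e = +-cong (e 0) (*-congˡ (eval-cong p q x (e ∘ suc)))

  eval-+ : ∀ p q x → eval (p +ₚ q) x ≈ eval p x + eval q x
  eval-+ []      q       x = sym (+-identityˡ _)
  eval-+ (a ∷ p) []      x = sym (+-identityʳ _)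
  eval-+ (a ∷ p) (b ∷ q) x = begin
    a + b + x * eval (p +ₚ q) x            ≈⟨ +-congˡ (trans (*-congˡ (eval-+ p q x)) (distribˡ _ _ _)) ⟩
    a + b + (x * eval p x + x * eval q x)  ≈⟨ interchange _ _ _ _ ⟩
    a + x * eval p x + (b + x * eval q x)  ∎

  eval-• : ∀ a q x → eval (a • q) x ≈ a * eval q x
  eval-• a []      x = sym (zeroʳ a)
  eval-• a (b ∷ q) x = begin
    a * b + x * eval (a • q) x    ≈⟨ +-congˡ (trans (*-congˡ (eval-• a q x)) (x∙yz≈y∙xz _ _ _)) ⟩
    a * b + a * (x * eval q x)    ≈⟨ distribˡ _ _ _ ⟨
    a * (b + x * eval q x)        ∎

  eval-* : ∀ p q x → eval (p *ₚ q) x ≈ eval p x * eval q x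
  eval-* []      q x = sym (zeroˡ _)
  eval-* (a ∷ p) q x = begin
    eval (a • q +ₚ (0# ∷ p *ₚ q)) x                 ≈⟨ eval-+ (a • q) _ x ⟩
    eval (a • q) x + (0# + x * eval (p *ₚ q) x)     ≈⟨ +-cong (eval-• a q x) (+-identityˡ _) ⟩
    a * eval q x + x * eval (p *ₚ q) x              ≈⟨ +-congˡ (trans (*-congˡ (eval-* p q x)) (sym (*-assoc _ _ _))) ⟩
    a * eval q x + x * eval p x * eval q x          ≈⟨ distribʳ _ _ _ ⟨
    (a + x * eval p x) * eval q x                   ∎

  eval-X- : ∀ a x → eval (X- a) x ≈ x - a
  eval-X- a x = trans (+-congˡ (trans (*-congˡ (trans (+-congˡ (zeroʳ x)) (+-identityʳ 1#))) (*-identityʳ x)))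
    (+-comm _ _)

  eval-root : ∀ {n} (μ : Vector Carrier n) i → eval (∏ₚ (λ j → X- (μ j))) (μ i) ≈ 0#
  eval-root μ zero = trans (eval-* (X- (μ zero)) (∏ₚ λ j → X- (μ (suc j))) (μ zero))
    (trans (*-congʳ (trans (eval-X- (μ zero) (μ zero)) (-‿inverseʳ _))) (zeroˡ _))
  eval-root μ (suc i) = trans (eval-* (X- (μ zero)) (∏ₚ λ j → X- (μ (suc j))) (μ (suc i)))
    (trans (*-congˡ (eval-root (tail μ) i)) (zeroʳ _))

  eval-0 : ∀ p → eval p 0# ≈ coeff p 0
  eval-0 []      = refl
  eval-0 (a ∷ p) = trans (+-congˡ (zeroˡ _)) (+-identityʳ a)

  -- The values at `x` and at 0 differ by a multiple of `x`, so an apartness between them passes on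
  -- to `x`.
  ∃-remainder : ∀ p x → ∃[ s ] eval p x ≈ coeff p 0 + x * s
  ∃-remainder []      x = 0# , sym (trans (+-identityˡ _) (zeroʳ x))
  ∃-remainder (a ∷ p) x = eval p x , refl

  X*-zero : ∀ p → coeff ((X- 0#) *ₚ p) 0 ≈ 0#
  X*-zero p = trans (coeff-*-zero (X- 0#) p) (trans (*-congʳ -0#≈0#) (zeroˡ _))

  X*-suc : ∀ p n → coeff ((X- 0#) *ₚ p) (suc n) ≈ coeff p n
  X*-suc p n = begin
    coeff ((X- 0#) *ₚ p) (suc n)                      ≈⟨ coeff-*-suc (- 0#) (1# ∷ []) p n ⟩
    - 0# * coeff p (suc n) + coeff ((1# ∷ []) *ₚ p) n ≈⟨ +-cong (trans (*-congʳ -0#≈0#) (zeroˡ _)) (*ₚ-identityˡ p n) ⟩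
    0# + coeff p n                                    ≈⟨ +-identityˡ _ ⟩
    coeff p n                                         ∎

  -- Together with `X^*-lowest` this reads the multiplicity of the root 0 off the coefficients.
  X^*-low : ∀ m p k → k ℕ.< m → coeff ((X- 0#) ^ₚ m *ₚ p) k ≈ 0#
  X^*-low (suc m) p zero    _ = trans (*ₚ-assoc (X- 0#) ((X- 0#) ^ₚ m) p 0) (X*-zero ((X- 0#) ^ₚ m *ₚ p))
  X^*-low (suc m) p (suc k) (ℕ.s≤s k<m) = trans (*ₚ-assoc (X- 0#) ((X- 0#) ^ₚ m) p (suc k))
    (trans (X*-suc ((X- 0#) ^ₚ m *ₚ p) k) (X^*-low m p k k<m))

  X^*-lowest : ∀ m p → coeff ((X- 0#) ^ₚ m *ₚ p) m ≈ coeff p 0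
  X^*-lowest zero    p = *ₚ-identityˡ p 0
  X^*-lowest (suc m) p = trans (*ₚ-assoc (X- 0#) ((X- 0#) ^ₚ m) p (suc m))
    (trans (X*-suc ((X- 0#) ^ₚ m *ₚ p) m) (X^*-lowest m p))

  open Determinant K using (δ) renaming (detS to detK; det-cong to detK-cong)
  private
    module D = Determinant polynomialRing
    module RR = RepeatedRows polynomialRing

  -- The factorisation of `det-reduced` is taken over the polynomial ring, with `X- 0#` in the role
  -- of X because `IsRootMultiplicity` counts powers of it. The constant coefficient of `1# - X` is
  -- 1, which accounts for the coefficient - 1 of `δ (rep i) j`.
  charPoly-repeatedRows : ∀ {n} (rep : Fin n → Fin n) → (∀ i → rep (rep i) ≡ rep i) →
    (A : Matrix Carrier n) → (∀ i j → A (rep i) j ≈ A i j) →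
    ∃[ q ] (charPoly A ≈ₚ (X- 0#) ^ₚ moved rep *ₚ q ×
            coeff q 0 ≈ detK (λ i j → δ i j + - 1# * δ (rep i) j + - A i j))
  charPoly-repeatedRows {n} rep rep-idem A A-rep =
    D.detS (RR.reduced rep rep-idem (X- 0#) Aₚ) ,
    P.trans {charPoly A} {D.detS (λ i j → (X- 0#) P.* D.δ i j P.+ P.- Aₚ i j)}
      {(X- 0#) ^ₚ moved rep *ₚ D.detS (RR.reduced rep rep-idem (X- 0#) Aₚ)}
      (D.det-cong entries)
      (RR.det-reduced rep rep-idem (X- 0#) Aₚ λ { i j zero → A-rep i j ; i j (suc k) → refl }) ,
    trans (det-homo polynomialRing K coeff₀-isRingHomomorphism (RR.reduced rep rep-idem (X- 0#) Aₚ))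
      (detK-cong constants)
    where
    Aₚ : Matrix Poly n
    Aₚ i j = A i j ∷ []
    entries : ∀ i j → (if does (i Fin.≟ j) then X- (A i j) else (- A i j ∷ [])) ≈ₚ
                      ((X- 0#) P.* D.δ i j P.+ P.- Aₚ i j)
    entries i j k with i Fin.≟ j
    entries i j zero | yes _ = sym (trans (+-congʳ (trans (+-identityʳ _) (trans (*-congʳ -0#≈0#) (zeroˡ _)))) (+-identityˡ _))
    entries i j (suc zero) | yes _ = sym (trans (+-identityʳ _) (*-identityˡ 1#))
    entries i j (suc (suc k)) | yes _ = refl
    entries i j zero | no _ = sym (+-identityˡ _)
    entries i j (suc zero) | no _ = refl
    entries i j (suc (suc k)) | no _ = refl
    coeff-δ : ∀ (i j : Fin n) → coeff (D.δ i j) 0 ≈ δ i j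
    coeff-δ i j with does (i Fin.≟ j)
    ... | true  = refl
    ... | false = refl
    constants : ∀ i j → coeff (RR.reduced rep rep-idem (X- 0#) Aₚ i j) 0 ≈ δ i j + - 1# * δ (rep i) j + - A i j
    constants i j = begin
      coeff (D.δ i j P.+ P.- u P.* D.δ (rep i) j P.+ P.- Aₚ i j) 0
        ≈⟨ coeff-+ (D.δ i j P.+ P.- u P.* D.δ (rep i) j) (P.- Aₚ i j) 0 ⟩
      coeff (D.δ i j P.+ P.- u P.* D.δ (rep i) j) 0 + - A i j
        ≈⟨ +-congʳ (coeff-+ (D.δ i j) (P.- u P.* D.δ (rep i) j) 0) ⟩
      coeff (D.δ i j) 0 + coeff (P.- u P.* D.δ (rep i) j) 0 + - A i j
        ≈⟨ +-congʳ (+-cong (coeff-δ i j) (trans (coeff-*-zero (P.- u) (D.δ (rep i) j))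
             (*-cong (-‿cong u₀) (coeff-δ (rep i) j)))) ⟩
      δ i j + - 1# * δ (rep i) j + - A i j ∎
      where
      u = P.1# P.- (X- 0#)
      u₀ : 1# + - - 0# ≈ 1#
      u₀ = trans (+-congˡ (-‿involutive 0#)) (+-identityʳ 1#)

module HeytingSpectrum {c ℓ₁ ℓ₂} (F : HeytingField c ℓ₁ ℓ₂) where
  open HeytingField F using (_#_; #-irrefl; #-cotrans; tight; heytingCommutativeRing)
  open FieldEigenvalues F
  open CommutativeRing commutativeRing hiding (zero)
  open PolynomialRing commutativeRing
  open PolynomialEvaluation commutativeRing
  open Determinant commutativeRing using (det-rightInverse)
  open RepeatedRows commutativeRing using (reduced-solvable)
  open Algebra.Apartness.Properties.HeytingCommutativeRing heytingCommutativeRing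
  open Algebra.Properties.Semiring.Sum semiring using (sum)
  open Relation.Binary.Reasoning.Setoid setoid
  private module P = CommutativeRing polynomialRing

  rightInverse⇒#0 : ∀ {x d} → x * d ≈ 1# → x # 0#
  rightInverse⇒#0 {x} {d} xd≈1 = invertibleʳ⇒# (d , trans (*-congʳ (x-0≈x x)) xd≈1)

  x*y#0⇒x#0 : ∀ {x y} → x * y # 0# → x # 0#
  x*y#0⇒x#0 {x} {y} xy#0 = rightInverse⇒#0 (trans (sym (*-assoc x y _)) (trans (*-congʳ (sym (x-0≈x _)))
    (proj₂ (proj₂ (HeytingField.#⇒invertible F xy#0)))))

  ^#0 : ∀ {x} m p → x # 0# → eval p x # 0# → eval ((X- 0#) ^ₚ m *ₚ p) x # 0#
  ^#0 zero    p x#0 px#0 = #-congʳ (sym (eval-cong (P.1# *ₚ p) p _ (*ₚ-identityˡ p))) px#0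
  ^#0 {x} (suc m) p x#0 px#0 = #-congʳ
    (sym (trans (eval-cong ((X- 0#) ^ₚ suc m *ₚ p) ((X- 0#) *ₚ ((X- 0#) ^ₚ m *ₚ p)) x (*ₚ-assoc (X- 0#) ((X- 0#) ^ₚ m) p))
      (trans (eval-* (X- 0#) ((X- 0#) ^ₚ m *ₚ p) x) (*-congʳ (trans (eval-X- 0# x) (x-0≈x x))))))
    (x#0y#0→xy#0 x#0 (^#0 m p x#0 px#0))

  -- One of q(x) and x is apart from 0, since q(0) = q(x) - x s is.
  root-#0-or-≈0 : ∀ {p q x m} → p ≈ₚ (X- 0#) ^ₚ m *ₚ q → coeff q 0 # 0# → eval p x ≈ 0# →
                  x # 0# ⊎ x ≈ 0#
  root-#0-or-≈0 {p} {q} {x} {m} p≈ q₀#0 px≈0 with #-cotrans q₀#0 (eval q x)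
  ... | inj₂ qx#0 = inj₂ (proj₁ (tight x 0#) λ x#0 →
    #-irrefl (trans (sym (eval-cong p ((X- 0#) ^ₚ m *ₚ q) x p≈)) px≈0) (^#0 m q x#0 qx#0))
  ... | inj₁ q₀#qx = inj₁ (x*y#0⇒x#0 {x} {s} (#-congʳ difference (x#y⇒y-x#0 q₀#qx)))
    where
    s = proj₁ (∃-remainder q x)
    x#y⇒y-x#0 : ∀ {a b} → a # b → b - a # 0#
    x#y⇒y-x#0 a#b with HeytingField.#⇒invertible F (HeytingField.#-sym F a#b)
    ... | inv , _ , e = rightInverse⇒#0 e
    difference : eval q x - coeff q 0 ≈ x * s
    difference = begin
      eval q x - coeff q 0              ≈⟨ +-congʳ (proj₂ (∃-remainder q x)) ⟩
      coeff q 0 + x * s - coeff q 0     ≈⟨ +-congʳ (+-comm _ _) ⟩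
      x * s + coeff q 0 - coeff q 0     ≈⟨ +-assoc _ _ _ ⟩
      x * s + (coeff q 0 - coeff q 0)   ≈⟨ +-congˡ (-‿inverseʳ _) ⟩
      x * s + 0#                        ≈⟨ +-identityʳ _ ⟩
      x * s                             ∎

  -- If the exponents differed, the coefficient at the smaller one would be the constant term of one
  -- cofactor and also 0 by the other factorisation.
  multiplicity-unique : ∀ {p q s a b} → p ≈ₚ (X- 0#) ^ₚ a *ₚ q → coeff q 0 # 0# →
                        p ≈ₚ (X- 0#) ^ₚ b *ₚ s → coeff s 0 # 0# → a ≡ b
  multiplicity-unique {p} {q} {s} {a} {b} p≈q q₀#0 p≈s s₀#0 with ℕ.<-cmp a b
  ... | tri≈ _ a≡b _ = a≡b
  ... | tri< a<b _ _ = contradiction q₀#0 (#-irrefl (trans (sym (X^*-lowest a q))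
    (trans (sym (p≈q a)) (trans (p≈s a) (X^*-low b s a a<b)))))
  ... | tri> _ _ b<a = contradiction s₀#0 (#-irrefl (trans (sym (X^*-lowest b s))
    (trans (sym (p≈s b)) (trans (p≈q b) (X^*-low a q b b<a)))))

  -- The entries equal to 0 contribute the power of X. The other factors are gathered in `u`, whose
  -- constant coefficient is the product of the negated entries and so apart from 0.
  nonZeroPart : ∀ {n} (μ : Vector Carrier n) → (∀ i → μ i # 0# ⊎ μ i ≈ 0#) →
    Σ[ S ∈ Subset n ] ∃[ z ] ∃[ u ]
      ((∀ i → i ∈ S → μ i # 0#) × (∀ i → i ∉ S → μ i ≈ 0#) × z ℕ.+ ∣ S ∣ ≡ n ×
       ∏ₚ (λ i → X- (μ i)) ≈ₚ (X- 0#) ^ₚ z *ₚ u × coeff u 0 # 0#)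
  nonZeroPart {zero} μ dec =
    Vec.[] , 0 , P.1# , (λ ()) , (λ ()) , ≡.refl , P.sym {P.1# *ₚ P.1#} {P.1#} (P.*-identityˡ P.1#) , 1#0
  nonZeroPart {suc n} μ dec with nonZeroPart (tail μ) (dec ∘ suc)
  ... | S , z , u , in# , out≈ , z+S≡n , factors , u₀#0 with dec zero
  ... | inj₁ μ₀#0 =
    inside Vec.∷ S , z , (X- (μ zero)) *ₚ u ,
    (λ { zero _ → μ₀#0 ; (suc i) i∈S → in# i (drop-there i∈S) }) ,
    (λ { zero 0∉S → contradiction here 0∉S ; (suc i) i∉S → out≈ i (i∉S ∘ there) }) ,
    ≡.trans (ℕ.+-suc z ∣ S ∣) (≡.cong suc z+S≡n) ,
    P.trans {(X- (μ zero)) *ₚ ∏ₚ (λ i → X- (μ (suc i)))} {(X- (μ zero)) *ₚ ((X- 0#) ^ₚ z *ₚ u)}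
      {(X- 0#) ^ₚ z *ₚ ((X- (μ zero)) *ₚ u)}
      (*ₚ-congˡ (X- (μ zero)) {∏ₚ (λ i → X- (μ (suc i)))} {(X- 0#) ^ₚ z *ₚ u} factors) (x∙yz≈y∙xz (X- (μ zero)) ((X- 0#) ^ₚ z) u) ,
    #-congʳ (sym (coeff-*-zero (X- (μ zero)) u))
      (x#0y#0→xy#0 (x#0⇒-x#0 μ₀#0) u₀#0)
    where
    open Algebra.Properties.CommutativeSemigroup P.*-commutativeSemigroup using (x∙yz≈y∙xz)
    open Algebra.Properties.Ring ring
    x#0⇒-x#0 : ∀ {x} → x # 0# → - x # 0#
    x#0⇒-x#0 {x} x#0 = x*y#0⇒x#0 {y = - 1#} (#-congʳ
      (sym (trans (sym (-‿distribˡ-* x (- 1#))) (trans (-‿distribʳ-* x (- 1#))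
        (trans (*-congˡ (-‿involutive 1#)) (*-identityʳ x))))) x#0)
  ... | inj₂ μ₀≈0 =
    outside Vec.∷ S , suc z , u ,
    (λ { zero () ; (suc i) i∈S → in# i (drop-there i∈S) }) ,
    (λ { zero _ → μ₀≈0 ; (suc i) i∉S → out≈ i (i∉S ∘ there) }) ,
    ≡.cong suc z+S≡n ,
    P.trans {(X- (μ zero)) *ₚ ∏ₚ (λ i → X- (μ (suc i)))} {(X- 0#) *ₚ ((X- 0#) ^ₚ z *ₚ u)}
      {(X- 0#) ^ₚ suc z *ₚ u}
      (*ₚ-cong {X- (μ zero)} {X- 0#} {∏ₚ (λ i → X- (μ (suc i)))} {(X- 0#) ^ₚ z *ₚ u}
        (λ { zero → -‿cong μ₀≈0 ; (suc k) → refl }) factors)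
      (P.sym {((X- 0#) *ₚ (X- 0#) ^ₚ z) *ₚ u} {(X- 0#) *ₚ ((X- 0#) ^ₚ z *ₚ u)} (*ₚ-assoc (X- 0#) ((X- 0#) ^ₚ z) u)) ,
    u₀#0

  -- Solvability makes the determinant of I - R - A a unit, and this determinant is the value at 0
  -- of the cofactor of the power of X.
  nullity-repeatedRows : ∀ {n} (rep : Fin n → Fin n) → (∀ i → rep (rep i) ≡ rep i) →
    (A : Matrix Carrier n) → (∀ i j → A (rep i) j ≈ A i j) →
    (∀ (f : Vector Carrier n) → (∀ i → f (rep i) ≈ f i) →
      Σ[ v ∈ Vector Carrier n ] ((∀ i → v (rep i) ≈ v i) × (∀ i → sum (λ j → A i j * v j) ≈ f i))) →
    IsRootMultiplicity (charPoly A) 0# (moved rep)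
  nullity-repeatedRows rep rep-idem A A-rep solveClass =
    q , factors , #-congʳ (sym (trans (eval-0 q) q₀≈)) (rightInverse⇒#0 inverse)
    where
    factorisation = charPoly-repeatedRows rep rep-idem A A-rep
    q = proj₁ factorisation
    factors = proj₁ (proj₂ factorisation)
    q₀≈ = proj₂ (proj₂ factorisation)
    inverse = proj₂ (det-rightInverse _ (reduced-solvable rep rep-idem A A-rep solveClass))

  -- Every `μ i` is a root of `p`, so `root-#0-or-≈0` decides whether it vanishes. The product over
  -- `μ` is then a second factorisation of `p`, and uniqueness identifies its power of X with `m`.
  nonZeroCount : ∀ {n p m} (μ : Vector Carrier n) → IsRootMultiplicity p 0# m →
                 p ≈ₚ ∏ₚ (λ i → X- (μ i)) → ∃[ k ] (NonZeroCount μ k × m ℕ.+ k ≡ n)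
  nonZeroCount {n} {p} {m} μ (q , p≈q , q0#0) p≈∏ =
    let S , z , u , in# , out≈ , z+S≡n , ∏≈ , u₀#0 = nonZeroPart μ decide in
    ∣ S ∣ , (S , ≡.refl , in# , out≈) ,
    ≡.trans (≡.cong (ℕ._+ ∣ S ∣) (multiplicity-unique {p} {q} {u} {m} {z} p≈q q₀#0
      (P.trans {p} {∏ₚ (λ i → X- (μ i))} {(X- 0#) ^ₚ z *ₚ u} p≈∏ ∏≈) u₀#0)) z+S≡n
    where
    q₀#0 : coeff q 0 # 0#
    q₀#0 = #-congʳ (eval-0 q) q0#0
    decide : ∀ i → μ i # 0# ⊎ μ i ≈ 0#
    decide i = root-#0-or-≈0 {p} {q} {μ i} {m} p≈q q₀#0
      (trans (eval-cong p (∏ₚ (λ j → X- (μ j))) (μ i) p≈∏) (eval-root μ i))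

-- Valuations of residues

module Valuation where
  open import Data.Nat.Base using (_≤_; _<_; z≤n; s≤s; _+_; _*_; _∸_; _^_)
  open ≡ using (refl; sym; trans; cong; subst)
  open FiniteSums ℕ.+-0-commutativeMonoid
  open Algebra.Properties.CommutativeMonoid.Sum ℕ.+-0-commutativeMonoid

  sum-const-1 : ∀ n → sum {n} (const 1) ≡ n
  sum-const-1 zero    = refl
  sum-const-1 (suc n) = cong suc (sum-const-1 n)

  -- The p-adic valuation of y, capped at t; in particular val p t 0 ≡ t.
  val : (p t y : ℕ) → ℕ
  val p zero    y = 0
  val p (suc t) y = if does (p ^ suc t ℕ.∣? y) then suc t else val p t y

  val≤ : ∀ p t y → val p t y ≤ t
  val≤ p zero    y = z≤n
  val≤ p (suc t) y with p ^ suc t ℕ.∣? y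
  ... | yes _ = ℕ.≤-refl
  ... | no  _ = ℕ.m≤n⇒m≤1+n (val≤ p t y)

  p^val∣ : ∀ p t y → p ^ val p t y ∣ y
  p^val∣ p zero    y = ℕ.1∣ y
  p^val∣ p (suc t) y with p ^ suc t ℕ.∣? y
  ... | yes d = d
  ... | no  _ = p^val∣ p t y

  val-greatest : ∀ p t {b y} → b ≤ t → p ^ b ∣ y → b ≤ val p t y
  val-greatest p zero    {zero} z≤n _ = z≤n
  val-greatest p (suc t) {b} {y} b≤1+t d with p ^ suc t ℕ.∣? y
  ... | yes _ = b≤1+t
  ... | no ¬d = val-greatest p t (ℕ.≤-pred (ℕ.≤∧≢⇒< b≤1+t λ { refl → ¬d d })) d

  ^-mono-∣ : ∀ p {a b} → a ≤ b → p ^ a ∣ p ^ b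
  ^-mono-∣ p {a} {b} a≤b = divides (p ^ (b ∸ a)) (trans (cong (p ^_) (sym (ℕ.m∸n+n≡m a≤b)))
    (ℕ.^-distribˡ-+-* p (b ∸ a) a))

  val≥⇒∣ : ∀ p t {b y} → b ≤ val p t y → p ^ b ∣ y
  val≥⇒∣ p t {y = y} b≤ = ℕ.∣-trans (^-mono-∣ p b≤) (p^val∣ p t y)

  val-0 : ∀ p t → val p t 0 ≡ t
  val-0 p t = ℕ.≤-antisym (val≤ p t 0) (val-greatest p t ℕ.≤-refl ((p ^ t) ℕ.∣0))

  val-top : ∀ p t {y} → y < p ^ t → val p t y ≡ t → y ≡ 0
  val-top p t {zero}  _    _ = refl
  val-top p t {suc y} y<pᵗ e =
    contradiction (ℕ.∣⇒≤ (val≥⇒∣ p t (ℕ.≤-reflexive (sym e)))) (ℕ.<⇒≱ y<pᵗ)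

  -- The residue of p ^ a modulo p ^ t, for a ≤ t.
  rep^ : (p t a : ℕ) → ℕ
  rep^ p t a = if does (a ℕ.<? t) then p ^ a else 0

  module _ {p} (pr : Prime p) where
    private instance
      p≢0 : ℕ.NonZero p
      p≢0 = prime⇒nonZero pr

    1<p : 1 < p
    1<p = ℕ.nonTrivial⇒n>1 p {{prime⇒nonTrivial pr}}

    p^a∣p^b⇒a≤b : ∀ {a b} → p ^ a ∣ p ^ b → a ≤ b
    p^a∣p^b⇒a≤b {a} {b} d = ℕ.≮⇒≥ λ b<a → contradiction (ℕ.∣⇒≤ {{ℕ.m^n≢0 p b}} d) (ℕ.<⇒≱ (ℕ.^-monoʳ-< p 1<p b<a))

    rep^<p^t : ∀ t a → rep^ p t a < p ^ t
    rep^<p^t t a with a ℕ.<? t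
    ... | yes a<t = subst (_< p ^ t) (sym (if-yes (a ℕ.<? t) a<t)) (ℕ.^-monoʳ-< p 1<p a<t)
    ... | no  a≮t = subst (_< p ^ t) (sym (if-no (a ℕ.<? t) a≮t)) (ℕ.m^n>0 p t)

    val-rep^ : ∀ t {a} → a ≤ t → val p t (rep^ p t a) ≡ a
    val-rep^ t {a} a≤t with a ℕ.<? t
    ... | yes a<t = trans (cong (val p t) (if-yes (a ℕ.<? t) a<t))
      (ℕ.≤-antisym (p^a∣p^b⇒a≤b (p^val∣ p t (p ^ a))) (val-greatest p t a≤t ℕ.∣-refl))
    ... | no  a≮t = trans (cong (val p t) (if-no (a ℕ.<? t) a≮t))
      (trans (val-0 p t) (ℕ.≤-antisym (ℕ.≮⇒≥ a≮t) a≤t))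

    -- If the valuations added up to less than `t`, both would lie below the cap, so the cofactors
    -- `x′` and `y′` would not be divisible by `p`. But `p ^ suc (a + b)` divides the product, so
    -- `p` divides `x′ * y′`.
    ∣*⇒≤val+val : ∀ t {x y} → p ^ t ∣ x * y → t ≤ val p t x + val p t y
    ∣*⇒≤val+val t {x} {y} d with t ℕ.≤? val p t x + val p t y
    ... | yes t≤ = t≤
    ... | no  t≰ = contradiction (euclidsLemma x′ y′ pr p∣x′y′) [ p∤x′ , p∤y′ ]′
      where
      a b x′ y′ : ℕ
      a = val p t x
      b = val p t y
      x′ = _∣_.quotient (p^val∣ p t x)
      y′ = _∣_.quotient (p^val∣ p t y)
      x≡ : x ≡ x′ * p ^ a
      x≡ = _∣_.equality (p^val∣ p t x)
      y≡ : y ≡ y′ * p ^ b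
      y≡ = _∣_.equality (p^val∣ p t y)
      a+b<t : a + b < t
      a+b<t = ℕ.≰⇒> t≰
      cofactor : ∀ {c z z′} → c < t → c ≡ val p t z → z ≡ z′ * p ^ c → ¬ p ∣ z′
      cofactor {c} {z} {z′} c<t c≡ refl p∣z′ = ℕ.<-irrefl (c≡) (val-greatest p t c<t (ℕ.*-monoˡ-∣ (p ^ c) p∣z′))
      p∤x′ : ¬ p ∣ x′
      p∤x′ = cofactor (ℕ.≤-<-trans (ℕ.m≤m+n a b) a+b<t) refl x≡
      p∤y′ : ¬ p ∣ y′
      p∤y′ = cofactor (ℕ.≤-<-trans (ℕ.m≤n+m b a) a+b<t) refl y≡
      regroup : x * y ≡ x′ * y′ * p ^ (a + b)
      regroup = trans (≡.cong₂ _*_ x≡ y≡) (trans (ℕ.[m*n]*[o*p]≡[m*o]*[n*p] x′ (p ^ a) y′ (p ^ b))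
        (cong (x′ * y′ *_) (sym (ℕ.^-distribˡ-+-* p a b))))
      p∣x′y′ : p ∣ x′ * y′
      p∣x′y′ = ℕ.*-cancelʳ-∣ (p ^ (a + b)) {{ℕ.m^n≢0 p (a + b)}}
        (subst (p ^ suc (a + b) ∣_) regroup (ℕ.∣-trans (^-mono-∣ p a+b<t) d))

    ≤val+val⇒∣* : ∀ t {x y} → t ≤ val p t x + val p t y → p ^ t ∣ x * y
    ≤val+val⇒∣* t {x} {y} t≤ = ℕ.∣-trans (^-mono-∣ p t≤)
      (subst (_∣ x * y) (sym (ℕ.^-distribˡ-+-* p (val p t x) (val p t y)))
        (ℕ.*-pres-∣ (p^val∣ p t x) (p^val∣ p t y)))

    -- The residues of positive valuation are the multiples `p * k` with `k < p ^ t`, so there are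
    -- `p ^ t` of them. Adding this number to both sides avoids truncated subtraction.
    count-unit-residues : ∀ t → sum {p ^ suc t} (λ y → if does (val p (suc t) (toℕ y) ℕ.≟ 0) then 1 else 0) ≡
                                p ^ t * (p ∸ 1)
    count-unit-residues t = ℕ.+-cancelʳ-≡ (p ^ t) _ _ (begin
      sum {p ^ suc t} (unit ∘ toℕ) + p ^ t                       ≡⟨ cong (λ k → sum {p ^ suc t} (unit ∘ toℕ) + k) multiples ⟨
      sum {p ^ suc t} (unit ∘ toℕ) + sum {p ^ suc t} (nonunit ∘ toℕ)
                                                                 ≡⟨ ∑-distrib-+ {p ^ suc t} (unit ∘ toℕ) (nonunit ∘ toℕ) ⟨
      sum {p ^ suc t} (λ y → unit (toℕ y) + nonunit (toℕ y))     ≡⟨ sum-cong-≋ {p ^ suc t} (total ∘ toℕ) ⟩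
      sum {p ^ suc t} (const 1)                                  ≡⟨ sum-const-1 (p ^ suc t) ⟩
      p * p ^ t                                                  ≡⟨ cong (_* p ^ t) (ℕ.m∸n+n≡m (ℕ.<⇒≤ 1<p)) ⟨
      (p ∸ 1 + 1) * p ^ t                                        ≡⟨ ℕ.*-comm (p ∸ 1 + 1) (p ^ t) ⟩
      p ^ t * (p ∸ 1 + 1)                                        ≡⟨ ℕ.*-distribˡ-+ (p ^ t) (p ∸ 1) 1 ⟩
      p ^ t * (p ∸ 1) + p ^ t * 1                                ≡⟨ cong (λ k → p ^ t * (p ∸ 1) + k) (ℕ.*-identityʳ (p ^ t)) ⟩
      p ^ t * (p ∸ 1) + p ^ t                                    ∎)
      where
      open ≡.≡-Reasoning
      unit nonunit : ℕ → ℕ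
      unit y    = if does (val p (suc t) y ℕ.≟ 0) then 1 else 0
      nonunit y = if does (val p (suc t) y ℕ.≟ 0) then 0 else 1
      total : ∀ y → unit y + nonunit y ≡ 1
      total y with does (val p (suc t) y ℕ.≟ 0)
      ... | true  = refl
      ... | false = refl
      nonunit-multiple : ∀ k → nonunit (p * k) ≡ 1
      nonunit-multiple k = if-no (val p (suc t) (p * k) ℕ.≟ 0) λ e →
        contradiction (ℕ.≤-trans (val-greatest p (suc t) {1} (s≤s z≤n)
          (subst (_∣ p * k) (sym (ℕ.*-identityʳ p)) (ℕ.m∣m*n k))) (ℕ.≤-reflexive e)) λ ()
      multiples : sum {p ^ suc t} (nonunit ∘ toℕ) ≡ p ^ t
      multiples = begin
        sum {p ^ suc t} (nonunit ∘ toℕ)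
          ≡⟨ sum-reindex₁ {p ^ t} (p ^ suc t) (λ k → p * toℕ k) (λ k → ℕ.*-monoʳ-< p (Fin.toℕ<n k))
               (λ eq → Fin.toℕ-injective (ℕ.*-cancelˡ-≡ _ _ p eq)) nonunit not-multiple ⟨
        sum {p ^ t} (λ k → nonunit (p * toℕ k))  ≡⟨ sum-cong-≋ {p ^ t} (nonunit-multiple ∘ toℕ) ⟩
        sum {p ^ t} (const 1)                    ≡⟨ sum-const-1 (p ^ t) ⟩
        p ^ t                                    ∎
        where
        not-multiple : ∀ y → y < p ^ suc t → (∀ k → p * toℕ {p ^ t} k ≢ y) → nonunit y ≡ 0
        not-multiple y y< none with val p (suc t) y ℕ.≟ 0
        ... | yes v≡0 = if-yes (val p (suc t) y ℕ.≟ 0) v≡0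
        ... | no v≢0 with val≥⇒∣ p (suc t) {1} {y} (ℕ.n≢0⇒n>0 v≢0)
        ...   | divides k refl = contradiction (trans (cong (p *_) (Fin.toℕ-fromℕ< k<)) eq) (none (fromℕ< k<))
          where
          eq : p * k ≡ k * (p ^ 1)
          eq = trans (ℕ.*-comm p k) (cong (k *_) (sym (ℕ.*-identityʳ p)))
          k< : k < p ^ t
          k< = ℕ.*-cancelˡ-< p k (p ^ t) (subst (_< p ^ suc t) (sym eq) y<)

    -- The fixed residues are the values `rep^ p t a` for `a` from 0 to `t`, distinct because their
    -- valuations are; `a = t` gives the residue 0.
    count-representatives : ∀ t → sum {p ^ t} (λ y → if does (rep^ p t (val p t (toℕ y)) ℕ.≟ toℕ y) then 1 else 0) ≡ t + 1
    count-representatives t = begin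
      sum {p ^ t} (fixed ∘ toℕ)
        ≡⟨ sum-reindex₁ {suc t} (p ^ t) (λ a → rep^ p t (toℕ a)) (λ a → rep^<p^t t (toℕ a)) injective fixed absent ⟨
      sum {suc t} (λ a → fixed (rep^ p t (toℕ a)))  ≡⟨ sum-cong-≋ {suc t} {y = const 1} (λ a → fixed-rep^ (ℕ.≤-pred (Fin.toℕ<n a))) ⟩
      sum {suc t} (const 1)                         ≡⟨ sum-const-1 (suc t) ⟩
      suc t                                         ≡⟨ ℕ.+-comm 1 t ⟩
      t + 1                                         ∎
      where
      open ≡.≡-Reasoning
      fixed : ℕ → ℕ
      fixed y = if does (rep^ p t (val p t y) ℕ.≟ y) then 1 else 0
      fixed-rep^ : ∀ {a} → a ≤ t → fixed (rep^ p t a) ≡ 1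
      fixed-rep^ {a} a≤t = if-yes (rep^ p t (val p t (rep^ p t a)) ℕ.≟ rep^ p t a) (cong (rep^ p t) (val-rep^ t a≤t))
      injective : ∀ {a b : Fin (suc t)} → rep^ p t (toℕ a) ≡ rep^ p t (toℕ b) → a ≡ b
      injective {a} {b} eq = Fin.toℕ-injective (trans (sym (val-rep^ t (ℕ.≤-pred (Fin.toℕ<n a))))
        (trans (cong (val p t) eq) (val-rep^ t (ℕ.≤-pred (Fin.toℕ<n b)))))
      absent : ∀ y → y < p ^ t → (∀ a → rep^ p t (toℕ {suc t} a) ≢ y) → fixed y ≡ 0
      absent y _ none with rep^ p t (val p t y) ℕ.≟ y
      ... | no neq = if-no (rep^ p t (val p t y) ℕ.≟ y) neq
      ... | yes eq = contradiction (trans (cong (rep^ p t) (Fin.toℕ-fromℕ< (s≤s (val≤ p t y)))) eq)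
                       (none (fromℕ< (s≤s (val≤ p t y))))

open Valuation

-- The linear system of the valuation classes

-- Defined by recursion and not by tabulation, so that it unfolds in step with `∑ᵇ` and `solve`.
valᵛ : ∀ {r} (p t : Vector ℕ r) → Vec ℕ r → Vec ℕ r
valᵛ p t []       = []
valᵛ p t (y ∷ ys) = val (p zero) (t zero) y ∷ valᵛ (tail p) (tail t) ys

-- Elements with valuation vectors as and bs have product zero iff t ≤ᵇ as ⊕ bs.
infix 4 _≤ᵇ_⊕_ _≤ᵇ?_⊕_
_≤ᵇ_⊕_ : ∀ {r} → Vector ℕ r → Vec ℕ r → Vec ℕ r → Set
t ≤ᵇ as ⊕ bs = ∀ j → t j ℕ.≤ Vec.lookup as j ℕ.+ Vec.lookup bs j

_≤ᵇ?_⊕_ : ∀ {r} (t : Vector ℕ r) as bs → Dec (t ≤ᵇ as ⊕ bs)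
t ≤ᵇ? as ⊕ bs = Fin.all? λ j → t j ℕ.≤? Vec.lookup as j ℕ.+ Vec.lookup bs j

module ValuationSystem {c ℓ} (K : CommutativeRing c ℓ) where
  open CommutativeRing K hiding (zero)
  open RawSemiringDefs (RawRing.rawSemiring rawRing) using () renaming (_×_ to _·_)
  open Algebra.Properties.Ring ring
  open Algebra.Properties.Semiring.Sum semiring
  open FiniteSums +-commutativeMonoid
  open Relation.Binary.Reasoning.Setoid setoid

  -- A class size enters the linear system as an element of `K`. Keeping the natural number beside
  -- it lets characteristic zero be applied as soon as the class has a member.
  count : ∀ {n p} {P : Fin n → Set p} (P? : ∀ i → Dec (P i)) →
          ∃[ k ] (sum (λ i → if does (P? i) then 1# else 0#) ≈ k · 1# × (∀ i → P i → k ≢ 0))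
  count {zero}  P? = 0 , refl , λ ()
  count {suc n} P? with count (P? ∘ suc)
  ... | k , sum≈ , k≢0 with P? zero
  ...   | yes _ = suc k , +-congˡ sum≈ , λ _ _ ()
  ...   | no ¬p = k , trans (+-identityˡ _) sum≈ , λ { zero p → contradiction p ¬p ; (suc i) p → k≢0 i p }

  module _ (invertible : ∀ k → ∃[ d ] (suc k · 1#) * d ≈ 1#) where

    module _ {p} (pr : Prime p) (t : ℕ) where
      private
        class : ℕ → Carrier
        class b = sum {p ℕ.^ t} λ y → if does (val p t (toℕ y) ℕ.≟ b) then 1# else 0#

        class-invertible : ∀ a → ∃[ d ] class (t ℕ.∸ a) * d ≈ 1#
        class-invertible a with count {p ℕ.^ t} (λ y → val p t (toℕ y) ℕ.≟ t ℕ.∸ a)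
        -- The class is inhabited by its representative `rep^ p t (t ∸ a)`, so its size cannot be
        -- zero.
        ... | zero , _ , k≢0 = contradiction ≡.refl (k≢0 (fromℕ< (rep^<p^t pr t (t ℕ.∸ a)))
              (≡.trans (≡.cong (val p t) (Fin.toℕ-fromℕ< (rep^<p^t pr t (t ℕ.∸ a)))) (val-rep^ pr t (ℕ.m∸n≤m t a))))
        ... | suc k , class≈ , _ = let d , e = invertible k in d , trans (*-congʳ class≈) e

        d : ℕ → Carrier
        d a = proj₁ (class-invertible a)

        difference : (ℕ → Carrier) → ℕ → Carrier
        difference f zero    = f 0
        difference f (suc a) = f (suc a) - f a

      -- Passing from a to a + 1 adds to the sum the class of valuation t - a - 1.
      solve₁ : (ℕ → Carrier) → ℕ → Carrier
      solve₁ f b = d (t ℕ.∸ b) * difference f (t ℕ.∸ b)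

      class*solve₁ : ∀ f a → a ℕ.≤ t → class (t ℕ.∸ a) * solve₁ f (t ℕ.∸ a) ≈ difference f a
      class*solve₁ f a a≤t = begin
        class (t ℕ.∸ a) * solve₁ f (t ℕ.∸ a)
          ≡⟨ ≡.cong (λ b → class (t ℕ.∸ a) * (d b * difference f b)) (ℕ.m∸[m∸n]≡n a≤t) ⟩
        class (t ℕ.∸ a) * (d a * difference f a)  ≈⟨ *-assoc _ _ _ ⟨
        class (t ℕ.∸ a) * d a * difference f a    ≈⟨ *-congʳ (proj₂ (class-invertible a)) ⟩
        1# * difference f a                       ≈⟨ *-identityˡ _ ⟩
        difference f a                            ∎

      -- The sum telescopes: the class that joins at `suc a` contributes exactly `f (suc a) - f a`.
      -- At `a = 0` only valuation `t` satisfies the condition, because valuations are capped there.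
      solve₁-solves : ∀ f a → a ℕ.≤ t →
        sum {p ℕ.^ t} (λ y → if does (t ℕ.≤? a ℕ.+ val p t (toℕ y)) then solve₁ f (val p t (toℕ y)) else 0#) ≈ f a
      solve₁-solves f zero _ = trans
        (trans (sum-cong-≋ {p ℕ.^ t} (summand ∘ toℕ)) (sym (*-distribʳ-sum {p ℕ.^ t} (solve₁ f t) _)))
        (class*solve₁ f 0 ℕ.z≤n)
        where
        summand : ∀ y → (if does (t ℕ.≤? val p t y) then solve₁ f (val p t y) else 0#) ≈
                        (if does (val p t y ℕ.≟ t) then 1# else 0#) * solve₁ f t
        summand y with val p t y ℕ.≟ t
        ... | yes v≡t = trans (reflexive (if-yes (t ℕ.≤? val p t y) (ℕ.≤-reflexive (≡.sym v≡t))))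
          (trans (reflexive (≡.cong (solve₁ f) v≡t))
            (sym (trans (*-congʳ (reflexive (if-yes (val p t y ℕ.≟ t) v≡t))) (*-identityˡ _))))
        ... | no v≢t = trans (reflexive (if-no (t ℕ.≤? val p t y) λ t≤v → v≢t (ℕ.≤-antisym (val≤ p t y) t≤v)))
          (sym (trans (*-congʳ (reflexive (if-no (val p t y ℕ.≟ t) v≢t))) (zeroˡ _)))
      solve₁-solves f (suc a) a<t = begin
        sum {p ℕ.^ t} (upTo (suc a) ∘ toℕ)
          ≈⟨ sum-cong-≋ {p ℕ.^ t} (summand ∘ toℕ) ⟩
        sum {p ℕ.^ t} (λ y → upTo a (toℕ y) + new (toℕ y) * solve₁ f b)
          ≈⟨ ∑-distrib-+ {p ℕ.^ t} (upTo a ∘ toℕ) (λ y → new (toℕ y) * solve₁ f b) ⟩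
        sum {p ℕ.^ t} (upTo a ∘ toℕ) + sum {p ℕ.^ t} (λ y → new (toℕ y) * solve₁ f b)
          ≈⟨ +-cong (solve₁-solves f a (ℕ.<⇒≤ a<t)) (sym (*-distribʳ-sum {p ℕ.^ t} (solve₁ f b) (new ∘ toℕ))) ⟩
        f a + class b * solve₁ f b
          ≈⟨ +-congˡ (class*solve₁ f (suc a) a<t) ⟩
        f a + (f (suc a) - f a)
          ≈⟨ trans (+-comm _ _) (trans (+-assoc _ _ _) (trans (+-congˡ (-‿inverseˡ _)) (+-identityʳ _))) ⟩
        f (suc a) ∎
        where
        b : ℕ
        b = t ℕ.∸ suc a
        a+b<t : a ℕ.+ b ℕ.< t
        a+b<t = ℕ.≤-reflexive (ℕ.m+[n∸m]≡n a<t)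
        upTo : ℕ → ℕ → Carrier
        upTo a y = if does (t ℕ.≤? a ℕ.+ val p t y) then solve₁ f (val p t y) else 0#
        new : ℕ → Carrier
        new y = if does (val p t y ℕ.≟ b) then 1# else 0#
        summand : ∀ y → upTo (suc a) y ≈ upTo a y + new y * solve₁ f b
        summand y with val p t y ℕ.≟ b
        ... | yes v≡b = trans (reflexive (if-yes (t ℕ.≤? suc a ℕ.+ val p t y)
                (ℕ.≤-reflexive (≡.trans (≡.sym (ℕ.m+[n∸m]≡n a<t)) (≡.cong (suc a ℕ.+_) (≡.sym v≡b))))))
          (trans (reflexive (≡.cong (solve₁ f) v≡b)) (sym (trans
            (+-cong (reflexive (if-no (t ℕ.≤? a ℕ.+ val p t y) λ t≤ →
                      ℕ.<⇒≱ a+b<t (≡.subst (λ v → t ℕ.≤ a ℕ.+ v) v≡b t≤)))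
                    (trans (*-congʳ (reflexive (if-yes (val p t y ℕ.≟ b) v≡b))) (*-identityˡ _)))
            (+-identityˡ _))))
        ... | no v≢b = trans unchanged (sym (trans
                (+-congˡ (trans (*-congʳ (reflexive (if-no (val p t y ℕ.≟ b) v≢b))) (zeroˡ _))) (+-identityʳ _)))
          where
          unchanged : upTo (suc a) y ≈ upTo a y
          unchanged with t ℕ.≤? a ℕ.+ val p t y
          ... | yes t≤ = trans (reflexive (if-yes (t ℕ.≤? suc a ℕ.+ val p t y) (ℕ.m≤n⇒m≤1+n t≤)))
                  (reflexive (≡.sym (if-yes (t ℕ.≤? a ℕ.+ val p t y) t≤)))
          ... | no t≰ = trans (reflexive (if-no (t ℕ.≤? suc a ℕ.+ val p t y) λ t≤ →
                  v≢b (ℕ.+-cancelˡ-≡ (suc a) _ _ (≡.trans (ℕ.≤-antisym (ℕ.≰⇒> t≰) t≤) (≡.sym (ℕ.m+[n∸m]≡n a<t))))))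
                  (reflexive (≡.sym (if-no (t ℕ.≤? a ℕ.+ val p t y) t≰)))

    -- The condition `t ≤ᵇ as ⊕ bs` is a conjunction over the factors, so the matrix is a tensor
    -- product and is inverted one factor at a time. The first coordinate is solved with the others
    -- as parameters, and the result is the right-hand side for the remaining factors.
    solve : ∀ {r} (p t : Vector ℕ r) → (∀ i → Prime (p i)) → (Vec ℕ r → Carrier) → Vec ℕ r → Carrier
    solve p t pr f []       = f []
    solve p t pr f (b ∷ bs) =
      solve (tail p) (tail t) (pr ∘ suc) (λ as → solve₁ (pr zero) (t zero) (λ a → f (a ∷ as)) b) bs

    solve-solves : ∀ {r} (p t : Vector ℕ r) (pr : ∀ i → Prime (p i)) f as → (∀ j → Vec.lookup as j ℕ.≤ t j) →
      ∑ᵇ (λ j → p j ℕ.^ t j) (λ ys →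
        if does (t ≤ᵇ? as ⊕ valᵛ p t ys) then solve p t pr f (valᵛ p t ys) else 0#) ≈ f as
    solve-solves {zero}  p t pr f []       _    = refl
    solve-solves {suc r} p t pr f (a ∷ as) as≤t = begin
      sum {p zero ℕ.^ t zero} (λ y → ∑ᵇ q′ λ ys →
        if does (t ≤ᵇ? (a ∷ as) ⊕ valᵛ p t (toℕ y ∷ ys)) then solve p t pr f (valᵛ p t (toℕ y ∷ ys)) else 0#)
        ≈⟨ sum-cong-≋ {p zero ℕ.^ t zero} (λ y → inner (val (p zero) (t zero) (toℕ y))) ⟩
      sum {p zero ℕ.^ t zero} (λ y → let b = val (p zero) (t zero) (toℕ y) in
        if does (t zero ℕ.≤? a ℕ.+ b) then solve₁ (pr zero) (t zero) (λ a → f (a ∷ as)) b else 0#)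
        ≈⟨ solve₁-solves (pr zero) (t zero) (λ a → f (a ∷ as)) a (as≤t zero) ⟩
      f (a ∷ as) ∎
      where
      q′ = λ j → p (suc j) ℕ.^ t (suc j)
      g : ℕ → Vec ℕ r → Carrier
      g b as = solve₁ (pr zero) (t zero) (λ a → f (a ∷ as)) b
      v : ℕ → Vec ℕ r → Carrier
      v b = solve (tail p) (tail t) (pr ∘ suc) (g b)
      -- For a fixed first valuation `b` the sum over the other coordinates is either empty or the
      -- smaller system with right-hand side `g b`.
      inner : ∀ b → ∑ᵇ q′ (λ ys → if does (t ≤ᵇ? (a ∷ as) ⊕ (b ∷ valᵛ (tail p) (tail t) ys))
                                  then v b (valᵛ (tail p) (tail t) ys) else 0#) ≈
                    (if does (t zero ℕ.≤? a ℕ.+ b) then g b as else 0#)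
      inner b with t zero ℕ.≤? a ℕ.+ b
      ... | yes t≤ = trans (∑ᵇ-cong q′ λ ys _ → same ys)
        (trans (solve-solves (tail p) (tail t) (pr ∘ suc) (g b) as (as≤t ∘ suc))
          (reflexive (≡.sym (if-yes (t zero ℕ.≤? a ℕ.+ b) t≤))))
        where
        same : ∀ ys → (if does (t ≤ᵇ? (a ∷ as) ⊕ (b ∷ valᵛ (tail p) (tail t) ys))
                       then v b (valᵛ (tail p) (tail t) ys) else 0#) ≈
                      (if does (tail t ≤ᵇ? as ⊕ valᵛ (tail p) (tail t) ys)
                       then v b (valᵛ (tail p) (tail t) ys) else 0#)
        same ys with tail t ≤ᵇ? as ⊕ valᵛ (tail p) (tail t) ys
        ... | yes le = trans (reflexive (if-yes (t ≤ᵇ? (a ∷ as) ⊕ (b ∷ valᵛ (tail p) (tail t) ys))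
                         λ { zero → t≤ ; (suc j) → le j }))
                       (reflexive (≡.sym (if-yes (tail t ≤ᵇ? as ⊕ valᵛ (tail p) (tail t) ys) le)))
        ... | no ¬le = trans (reflexive (if-no (t ≤ᵇ? (a ∷ as) ⊕ (b ∷ valᵛ (tail p) (tail t) ys))
                         λ le → ¬le (le ∘ suc)))
                       (reflexive (≡.sym (if-no (tail t ≤ᵇ? as ⊕ valᵛ (tail p) (tail t) ys) ¬le)))
      ... | no t≰ = trans (trans (∑ᵇ-cong q′ λ ys _ → reflexive (if-no (t ≤ᵇ? (a ∷ as) ⊕ (b ∷ valᵛ (tail p) (tail t) ys))
                       λ le → t≰ (le zero))) (∑ᵇ-ε q′))
                     (reflexive (≡.sym (if-no (t zero ℕ.≤? a ℕ.+ b) t≰)))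

-- Counting residues by class

module ClassCounting where
  open import Data.Nat.Base using (_≤_; _<_; z≤n; s≤s; _+_; _*_; _∸_; _^_)
  open ≡ using (refl; sym; trans; cong; cong₂; subst)
  open FiniteSums ℕ.+-0-commutativeMonoid
  open Algebra.Properties.CommutativeMonoid.Sum ℕ.+-0-commutativeMonoid
  open Algebra.Properties.Semiring.Sum ℕ.+-*-semiring using (*-distribˡ-sum; *-distribʳ-sum)

  ∏-cong : ∀ {r} {f g : Vector ℕ r} → (∀ j → f j ≡ g j) → ∏ f ≡ ∏ g
  ∏-cong {zero}  e = refl
  ∏-cong {suc r} e = cong₂ _*_ (e zero) (∏-cong (e ∘ suc))

  ∏-* : ∀ {r} (f g : Vector ℕ r) → ∏ (λ j → f j * g j) ≡ ∏ f * ∏ g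
  ∏-* {zero}  f g = refl
  ∏-* {suc r} f g = trans (cong (f zero * g zero *_) (∏-* (tail f) (tail g)))
    (ℕ.[m*n]*[o*p]≡[m*o]*[n*p] (f zero) (g zero) (∏ (tail f)) (∏ (tail g)))

  ∑ᵇ-*ˡ : ∀ {r} (q : Vector ℕ r) a F → ∑ᵇ q (λ ys → a * F ys) ≡ a * ∑ᵇ q F
  ∑ᵇ-*ˡ {zero}  q a F = refl
  ∑ᵇ-*ˡ {suc r} q a F = trans (sum-cong-≋ {q zero} λ y → ∑ᵇ-*ˡ (tail q) a (λ ys → F (toℕ y ∷ ys)))
    (sym (*-distribˡ-sum {q zero} a _))

  ∑ᵇ-∏ : ∀ {r} (q : Vector ℕ r) (g : Fin r → ℕ → ℕ) →
         ∑ᵇ q (λ ys → ∏ (λ j → g j (Vec.lookup ys j))) ≡ ∏ (λ j → sum {q j} (g j ∘ toℕ))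
  ∑ᵇ-∏ {zero}  q g = refl
  ∑ᵇ-∏ {suc r} q g = trans
    (sum-cong-≋ {q zero} λ y → trans (∑ᵇ-*ˡ (tail q) (g zero (toℕ y)) (λ ys → ∏ (λ j → g (suc j) (Vec.lookup ys j))))
      (cong (g zero (toℕ y) *_) (∑ᵇ-∏ (tail q) (g ∘ suc))))
    (sym (*-distribʳ-sum {q zero} (∏ (λ j → sum {q (suc j)} (g (suc j) ∘ toℕ))) (g zero ∘ toℕ)))

  -- Conjunctions over the factors become products of indicators, so that with `∑ᵇ-∏` a count over
  -- the box factorises into one count per factor.
  indicator-∏ : ∀ {a b r} {Q : Set a} {P : Fin r → Set b} (Q? : Dec Q) (P? : ∀ j → Dec (P j)) →
                (Q → ∀ j → P j) → ((∀ j → P j) → Q) →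
                (if does Q? then 1 else 0) ≡ ∏ (λ j → if does (P? j) then 1 else 0)
  indicator-∏ (yes q) P? to from = sym (all-1 λ j → if-yes (P? j) (to q j))
    where
    all-1 : ∀ {r} {f : Vector ℕ r} → (∀ j → f j ≡ 1) → ∏ f ≡ 1
    all-1 {zero}  e = refl
    all-1 {suc r} e = cong₂ _*_ (e zero) (all-1 (e ∘ suc))
  indicator-∏ (no ¬q) P? to from = sym (some-0 P? λ all → ¬q (from all))
    where
    some-0 : ∀ {b r} {P : Fin r → Set b} (P? : ∀ j → Dec (P j)) → ¬ (∀ j → P j) →
             ∏ (λ j → if does (P? j) then 1 else 0) ≡ 0
    some-0 {r = zero}  P? ¬all = contradiction (λ ()) ¬all
    some-0 {r = suc r} P? ¬all with P? zero
    ... | no _  = refl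
    ... | yes p = trans (ℕ.*-identityˡ _) (some-0 (P? ∘ suc) λ all → ¬all λ { zero → p ; (suc j) → all j })

  lookup-valᵛ : ∀ {r} (p t : Vector ℕ r) ys j → Vec.lookup (valᵛ p t ys) j ≡ val (p j) (t j) (Vec.lookup ys j)
  lookup-valᵛ p t (y ∷ ys) zero    = refl
  lookup-valᵛ p t (y ∷ ys) (suc j) = lookup-valᵛ (tail p) (tail t) ys j

  repᵛ : ∀ {r} (p t : Vector ℕ r) → Vec ℕ r → Vec ℕ r
  repᵛ p t as = Vec.tabulate λ j → rep^ (p j) (t j) (Vec.lookup as j)

  module Classes {r} (p t : Vector ℕ r) (pr : ∀ j → Prime (p j)) (0<t : ∀ j → 0 < t j) where

    q : Vector ℕ r
    q j = p j ^ t j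

    0ᵛ tᵛ : Vec ℕ r
    0ᵛ = Vec.replicate r 0
    tᵛ = Vec.tabulate t

    valᵛ≤ : ∀ ys j → Vec.lookup (valᵛ p t ys) j ≤ t j
    valᵛ≤ ys j = subst (_≤ t j) (sym (lookup-valᵛ p t ys j)) (val≤ (p j) (t j) (Vec.lookup ys j))

    0ᵛ≤t : ∀ j → Vec.lookup 0ᵛ j ≤ t j
    0ᵛ≤t j = subst (_≤ t j) (sym (Vec.lookup-replicate j 0)) z≤n

    tᵛ≤t : ∀ j → Vec.lookup tᵛ j ≤ t j
    tᵛ≤t j = ℕ.≤-reflexive (Vec.lookup∘tabulate t j)

    repᵛ<q : ∀ as → repᵛ p t as <ᵇ q
    repᵛ<q as j = subst (_< q j) (sym (Vec.lookup∘tabulate _ j)) (rep^<p^t (pr j) (t j) (Vec.lookup as j))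

    valᵛ-repᵛ : ∀ {as} → (∀ j → Vec.lookup as j ≤ t j) → valᵛ p t (repᵛ p t as) ≡ as
    valᵛ-repᵛ {as} as≤t = lookup-ext λ j → trans (lookup-valᵛ p t (repᵛ p t as) j)
      (trans (cong (val (p j) (t j)) (Vec.lookup∘tabulate _ j)) (val-rep^ (pr j) (t j) (as≤t j)))

    valᵛ-0ᵛ : valᵛ p t 0ᵛ ≡ tᵛ
    valᵛ-0ᵛ = lookup-ext λ j → trans (lookup-valᵛ p t 0ᵛ j)
      (trans (cong (val (p j) (t j)) (Vec.lookup-replicate j 0))
        (trans (val-0 (p j) (t j)) (sym (Vec.lookup∘tabulate t j))))

    valᵛ-top : ∀ {ys} → ys <ᵇ q → valᵛ p t ys ≡ tᵛ → ys ≡ 0ᵛ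
    valᵛ-top {ys} ys<q e = lookup-ext λ j → trans
      (val-top (p j) (t j) (ys<q j) (trans (sym (lookup-valᵛ p t ys j))
        (trans (cong (λ v → Vec.lookup v j) e) (Vec.lookup∘tabulate t j))))
      (sym (Vec.lookup-replicate j 0))

    0ᵛ<q : 0ᵛ <ᵇ q
    0ᵛ<q j = subst (_< q j) (sym (Vec.lookup-replicate j 0)) (ℕ.≤-<-trans z≤n (rep^<p^t (pr j) (t j) 0))

    count-all : ∑ᵇ q (const 1) ≡ ∏ q
    count-all = trans (∑ᵇ-cong q λ ys _ → sym (∏-1 r)) (trans (∑ᵇ-∏ q (λ _ _ → 1)) (∏-cong λ j → sum-const-1 (q j)))
      where
      ∏-1 : ∀ r → ∏ {r} (const 1) ≡ 1
      ∏-1 zero    = refl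
      ∏-1 (suc r) = trans (ℕ.*-identityˡ _) (∏-1 r)

    -- Valuation 0 is a condition on each factor separately; the result is the product of Euler's
    -- totients of the `p j ^ t j`.
    count-units : ∑ᵇ q (λ ys → if does (valᵛ p t ys ≟ᵛ 0ᵛ) then 1 else 0) ≡
                  ∏ (λ j → p j ^ (t j ∸ 1)) * ∏ (λ j → p j ∸ 1)
    count-units = begin
      ∑ᵇ q (λ ys → if does (valᵛ p t ys ≟ᵛ 0ᵛ) then 1 else 0)
        ≡⟨ ∑ᵇ-cong q (λ ys _ → indicator-∏ (valᵛ p t ys ≟ᵛ 0ᵛ) (λ j → val (p j) (t j) (Vec.lookup ys j) ℕ.≟ 0)
             (λ e j → trans (sym (lookup-valᵛ p t ys j)) (trans (cong (λ v → Vec.lookup v j) e) (Vec.lookup-replicate j 0)))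
             (λ e → lookup-ext λ j → trans (lookup-valᵛ p t ys j) (trans (e j) (sym (Vec.lookup-replicate j 0))))) ⟩
      ∑ᵇ q (λ ys → ∏ (λ j → if does (val (p j) (t j) (Vec.lookup ys j) ℕ.≟ 0) then 1 else 0))
        ≡⟨ ∑ᵇ-∏ q (λ j y → if does (val (p j) (t j) y ℕ.≟ 0) then 1 else 0) ⟩
      ∏ (λ j → sum {q j} (λ y → if does (val (p j) (t j) (toℕ y) ℕ.≟ 0) then 1 else 0))
        ≡⟨ ∏-cong (λ j → count-factor (pr j) (0<t j)) ⟩
      ∏ (λ j → p j ^ (t j ∸ 1) * (p j ∸ 1))
        ≡⟨ ∏-* (λ j → p j ^ (t j ∸ 1)) (λ j → p j ∸ 1) ⟩
      ∏ (λ j → p j ^ (t j ∸ 1)) * ∏ (λ j → p j ∸ 1) ∎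
      where
      open ≡.≡-Reasoning
      count-factor : ∀ {p t} → Prime p → 0 < t →
        sum {p ^ t} (λ y → if does (val p t (toℕ y) ℕ.≟ 0) then 1 else 0) ≡ p ^ (t ∸ 1) * (p ∸ 1)
      count-factor {t = suc t} pr _ = count-unit-residues pr t

    fixed : Vec ℕ r → ℕ
    fixed ys = if does (repᵛ p t (valᵛ p t ys) ≟ᵛ ys) then 1 else 0

    count-fixed : ∑ᵇ q fixed ≡ ∏ (λ j → t j + 1)
    count-fixed = begin
      ∑ᵇ q fixed
        ≡⟨ ∑ᵇ-cong q (λ ys _ → indicator-∏ (repᵛ p t (valᵛ p t ys) ≟ᵛ ys)
             (λ j → rep^ (p j) (t j) (val (p j) (t j) (Vec.lookup ys j)) ℕ.≟ Vec.lookup ys j)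
             (λ e j → trans (sym (lookup-rep-val ys j)) (cong (λ v → Vec.lookup v j) e))
             (λ e → lookup-ext λ j → trans (lookup-rep-val ys j) (e j))) ⟩
      ∑ᵇ q (λ ys → ∏ (λ j → if does (rep^ (p j) (t j) (val (p j) (t j) (Vec.lookup ys j)) ℕ.≟ Vec.lookup ys j) then 1 else 0))
        ≡⟨ ∑ᵇ-∏ q (λ j y → if does (rep^ (p j) (t j) (val (p j) (t j) y) ℕ.≟ y) then 1 else 0) ⟩
      ∏ (λ j → sum {q j} (λ y → if does (rep^ (p j) (t j) (val (p j) (t j) (toℕ y)) ℕ.≟ toℕ y) then 1 else 0))
        ≡⟨ ∏-cong (λ j → count-representatives (pr j) (t j)) ⟩
      ∏ (λ j → t j + 1) ∎
      where
      open ≡.≡-Reasoning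
      lookup-rep-val : ∀ ys j → Vec.lookup (repᵛ p t (valᵛ p t ys)) j ≡ rep^ (p j) (t j) (val (p j) (t j) (Vec.lookup ys j))
      lookup-rep-val ys j = trans (Vec.lookup∘tabulate _ j) (cong (rep^ (p j) (t j)) (lookup-valᵛ p t ys j))

    -- The only fixed vector of a class is its representative `repᵛ p t as`. This serves to discount
    -- the classes of the units and of zero.
    count-fixed-class : ∀ as → (∀ j → Vec.lookup as j ≤ t j) →
                        ∑ᵇ q (λ ys → if does (valᵛ p t ys ≟ᵛ as) then fixed ys else 0) ≡ 1
    count-fixed-class as as≤t = trans
      (∑ᵇ-single q (repᵛ p t as) (repᵛ<q as) others)
      (trans (if-yes (valᵛ p t (repᵛ p t as) ≟ᵛ as) (valᵛ-repᵛ {as} as≤t))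
        (if-yes (repᵛ p t (valᵛ p t (repᵛ p t as)) ≟ᵛ repᵛ p t as) (cong (repᵛ p t) (valᵛ-repᵛ {as} as≤t))))
      where
      others : ∀ zs → zs <ᵇ q → zs ≢ repᵛ p t as → (if does (valᵛ p t zs ≟ᵛ as) then fixed zs else 0) ≡ 0
      others zs _ zs≢ = go (valᵛ p t zs ≟ᵛ as)
        where
        go : (d : Dec (valᵛ p t zs ≡ as)) → (if does d then fixed zs else 0) ≡ 0
        go (no _)  = refl
        go (yes v) = if-no (repᵛ p t (valᵛ p t zs) ≟ᵛ zs) λ e → zs≢ (trans (sym e) (cong (repᵛ p t) v))

    count-zero : ∑ᵇ q (λ ys → if does (valᵛ p t ys ≟ᵛ tᵛ) then 1 else 0) ≡ 1
    count-zero = trans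
      (∑ᵇ-single q 0ᵛ 0ᵛ<q λ zs zs<q zs≢0 → if-no (valᵛ p t zs ≟ᵛ tᵛ) λ e → zs≢0 (valᵛ-top zs<q e))
      (if-yes (valᵛ p t 0ᵛ ≟ᵛ tᵛ) valᵛ-0ᵛ)

    -- A residue vector is a unit if its valuation vector is 0ᵛ, and zero if it is tᵛ.
    module Enumerated (0ᵛ≢tᵛ : 0ᵛ ≢ tᵛ) {n} (e : Fin n → Vec ℕ r)
      (e<q : ∀ i → e i <ᵇ q) (e-injective : ∀ {i j} → e i ≡ e j → i ≡ j)
      (e≢unit : ∀ i → valᵛ p t (e i) ≢ 0ᵛ) (e≢zero : ∀ i → valᵛ p t (e i) ≢ tᵛ)
      (e-onto : ∀ ys → ys <ᵇ q → valᵛ p t ys ≢ 0ᵛ → valᵛ p t ys ≢ tᵛ → ∃[ i ] e i ≡ ys)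
      where

      -- Every residue vector is a vertex, a unit or zero. The weight is arbitrary because the
      -- identity is read twice: with weight 1 it gives the order of the graph, with `fixed` the
      -- number of representatives.
      partition : ∀ w → sum (w ∘ e) +
        (∑ᵇ q (λ ys → if does (valᵛ p t ys ≟ᵛ 0ᵛ) then w ys else 0) +
         ∑ᵇ q (λ ys → if does (valᵛ p t ys ≟ᵛ tᵛ) then w ys else 0)) ≡ ∑ᵇ q w
      partition w = begin
        sum (w ∘ e) + (∑ᵇ q units + ∑ᵇ q zeros)   ≡⟨ cong (_+ (∑ᵇ q units + ∑ᵇ q zeros)) (sum-cong-≋ {n} λ i →
                                                       rest-other (e≢unit i) (e≢zero i)) ⟨
        sum (rest ∘ e) + (∑ᵇ q units + ∑ᵇ q zeros) ≡⟨ cong₂ _+_ (sum-reindex q e e<q e-injective rest missed)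
                                                                  (sym (∑ᵇ-∙ q units zeros)) ⟩
        ∑ᵇ q rest + ∑ᵇ q (λ ys → units ys + zeros ys) ≡⟨ ∑ᵇ-∙ q rest (λ ys → units ys + zeros ys) ⟨
        ∑ᵇ q (λ ys → rest ys + (units ys + zeros ys)) ≡⟨ ∑ᵇ-cong q (λ ys _ → total ys) ⟩
        ∑ᵇ q w ∎
        where
        open ≡.≡-Reasoning
        units zeros rest : Vec ℕ r → ℕ
        units ys = if does (valᵛ p t ys ≟ᵛ 0ᵛ) then w ys else 0
        zeros ys = if does (valᵛ p t ys ≟ᵛ tᵛ) then w ys else 0
        -- Being 0 on units and zero, `rest` satisfies the condition of `sum-reindex` at the points
        -- that `e` misses.
        rest ys = if does (valᵛ p t ys ≟ᵛ 0ᵛ) then 0 else if does (valᵛ p t ys ≟ᵛ tᵛ) then 0 else w ys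
        rest-other : ∀ {ys} → valᵛ p t ys ≢ 0ᵛ → valᵛ p t ys ≢ tᵛ → rest ys ≡ w ys
        rest-other {ys} ≢0 ≢t = trans (if-no (valᵛ p t ys ≟ᵛ 0ᵛ) ≢0) (if-no (valᵛ p t ys ≟ᵛ tᵛ) ≢t)
        missed : ∀ ys → ys <ᵇ q → (∀ i → e i ≢ ys) → rest ys ≡ 0
        missed ys ys<q none = go (valᵛ p t ys ≟ᵛ 0ᵛ) (valᵛ p t ys ≟ᵛ tᵛ)
          where
          go : (d : Dec (valᵛ p t ys ≡ 0ᵛ)) (d′ : Dec (valᵛ p t ys ≡ tᵛ)) →
               (if does d then 0 else if does d′ then 0 else w ys) ≡ 0
          go (yes _) _       = refl
          go (no _)  (yes _) = refl
          go (no ≢0) (no ≢t) = let i , eq = e-onto ys ys<q ≢0 ≢t in contradiction eq (none i)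
        total : ∀ ys → rest ys + (units ys + zeros ys) ≡ w ys
        total ys = go (valᵛ p t ys ≟ᵛ 0ᵛ) (valᵛ p t ys ≟ᵛ tᵛ)
          where
          go : (d : Dec (valᵛ p t ys ≡ 0ᵛ)) (d′ : Dec (valᵛ p t ys ≡ tᵛ)) →
               (if does d then 0 else if does d′ then 0 else w ys) +
               ((if does d then w ys else 0) + (if does d′ then w ys else 0)) ≡ w ys
          go (yes ≡0) (yes ≡t) = contradiction (trans (sym ≡0) ≡t) 0ᵛ≢tᵛ
          go (yes _)  (no _)   = ℕ.+-identityʳ (w ys)
          go (no _)   (yes _)  = refl
          go (no _)   (no _)   = ℕ.+-identityʳ (w ys)

      order-count : n + (∏ (λ j → p j ^ (t j ∸ 1)) * ∏ (λ j → p j ∸ 1) + 1) ≡ ∏ q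
      order-count = trans (cong₂ _+_ (sym (sum-const-1 n)) (cong₂ _+_ (sym count-units) (sym count-zero)))
        (trans (partition (const 1)) count-all)

      -- The 2 stands for the representatives of the units and of zero, which are fixed but are not
      -- vertices.
      fixed-count : sum (fixed ∘ e) + 2 ≡ ∏ (λ j → t j + 1)
      fixed-count = trans
        (cong (λ k → sum (fixed ∘ e) + k) (sym (cong₂ _+_ (count-fixed-class 0ᵛ 0ᵛ≤t) (count-fixed-class tᵛ tᵛ≤t))))
        (trans (partition fixed) count-fixed)

      class : Fin n → Vec ℕ r
      class i = valᵛ p t (e i)

      -- Passing to the representative keeps the valuation vector, so the result is again neither a
      -- unit nor zero and occurs among the vertices.
      representative : ∀ i → ∃[ k ] e k ≡ repᵛ p t (class i)
      representative i = e-onto (repᵛ p t (class i)) (repᵛ<q (class i))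
        (e≢unit i ∘ trans (sym same)) (e≢zero i ∘ trans (sym same))
        where
        same : valᵛ p t (repᵛ p t (class i)) ≡ class i
        same = valᵛ-repᵛ {class i} (valᵛ≤ (e i))

      module Represented (rep : Fin n → Fin n) (e-rep : ∀ i → e (rep i) ≡ repᵛ p t (class i)) where

        class-rep : ∀ i → class (rep i) ≡ class i
        class-rep i = trans (cong (valᵛ p t) (e-rep i)) (valᵛ-repᵛ {class i} (valᵛ≤ (e i)))

        rep-class : ∀ {i j} → class i ≡ class j → rep i ≡ rep j
        rep-class eq = e-injective (trans (e-rep _) (trans (cong (repᵛ p t) eq) (sym (e-rep _))))

        -- A vertex is fixed by `rep` exactly if its residue vector is a representative, so moved
        -- and fixed vertices add up to `n`.
        moved-count : moved rep + ∏ (λ j → t j + 1) ≡ n + 2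
        moved-count = begin
          moved rep + ∏ (λ j → t j + 1)          ≡⟨ cong (λ k → moved rep + k) fixed-count ⟨
          moved rep + (sum (fixed ∘ e) + 2)      ≡⟨ ℕ.+-assoc (moved rep) _ 2 ⟨
          moved rep + sum (fixed ∘ e) + 2        ≡⟨ cong (_+ 2) (∑-distrib-+ {n} _ (fixed ∘ e)) ⟨
          sum (λ i → (if does (rep i Fin.≟ i) then 0 else 1) + fixed (e i)) + 2
                                                 ≡⟨ cong (_+ 2) (sum-cong-≋ {n} either) ⟩
          sum {n} (const 1) + 2                  ≡⟨ cong (_+ 2) (sum-const-1 n) ⟩
          n + 2                                  ∎
          where
          open ≡.≡-Reasoning
          either : ∀ i → (if does (rep i Fin.≟ i) then 0 else 1) + fixed (e i) ≡ 1
          either i with rep i Fin.≟ i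
          ... | yes ri≡i = if-yes (repᵛ p t (valᵛ p t (e i)) ≟ᵛ e i) (trans (sym (e-rep i)) (cong e ri≡i))
          ... | no  ri≢i = cong suc (if-no (repᵛ p t (valᵛ p t (e i)) ≟ᵛ e i) λ eq → ri≢i (e-injective (trans (e-rep i) eq)))

        module _ {k ℓ₁} (K : CommutativeRing k ℓ₁) where
          open CommutativeRing K using (Carrier; _≈_; 0#; 1#; reflexive)
            renaming (_*_ to _*ᴷ_; refl to ≈-refl; sym to ≈-sym; trans to ≈-trans)
          private module K = CommutativeRing K
          open RawSemiringDefs (RawRing.rawSemiring K.rawRing) using () renaming (_×_ to _·_; sum to sumᴷ)
          open Algebra.Properties.Semiring.Sum K.semiring using () renaming (sum-cong-≋ to sumᴷ-cong)
          open FiniteSums K.+-commutativeMonoid using () renaming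
            (∑ᵇ to ∑ᴷ; ∑ᵇ-single to ∑ᴷ-single; sum-reindex to sumᴷ-reindex)
          open ValuationSystem K

          module _ (A : Matrix Carrier n)
            (A-entry : ∀ i j → A i j ≡ (if does (t ≤ᵇ? class i ⊕ class j) then 1# else 0#)) where

            A-rep : ∀ i j → A (rep i) j ≈ A i j
            A-rep i j = reflexive (trans (A-entry (rep i) j)
              (trans (cong (λ a → if does (t ≤ᵇ? a ⊕ class j) then 1# else 0#) (class-rep i)) (sym (A-entry i j))))

            module _ (invertible : ∀ k → ∃[ d ] (suc k · 1#) *ᴷ d ≈ 1#)
              (f : Vector Carrier n) (f-rep : ∀ i → f (rep i) ≈ f i) where

              private
                -- Which vertex of the class is found does not matter, since `f` respects `rep`. The
                -- default `0#` applies at `0ᵛ`, the class of the units, and is what makes `V`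
                -- vanish at zero.
                F : Vec ℕ r → Carrier
                F as with Fin.any? (λ i → class i ≟ᵛ as)
                ... | yes (i , _) = f i
                ... | no _        = 0#

                F-class : ∀ i → F (class i) ≈ f i
                F-class i with Fin.any? (λ j → class j ≟ᵛ class i)
                ... | yes (j , eq) = ≈-trans (≈-sym (f-rep j)) (≈-trans (reflexive (cong f (rep-class eq))) (f-rep i))
                ... | no none = contradiction (i , refl) none

                F-0ᵛ : F 0ᵛ ≈ 0#
                F-0ᵛ with Fin.any? (λ i → class i ≟ᵛ 0ᵛ)
                ... | yes (i , eq) = contradiction eq (e≢unit i)
                ... | no _ = ≈-refl

                V : Vec ℕ r → Carrier
                V = solve invertible p t pr F

                term : Vec ℕ r → Vec ℕ r → Carrier
                term as ys = if does (t ≤ᵇ? as ⊕ valᵛ p t ys) then V (valᵛ p t ys) else 0#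

                V-solves : ∀ as → (∀ j → Vec.lookup as j ≤ t j) → ∑ᴷ q (term as) ≈ F as
                V-solves = solve-solves invertible p t pr F

                -- The equation at the units involves only the zero element.
                V-tᵛ : V tᵛ ≈ 0#
                V-tᵛ = ≈-trans (≈-sym (≈-trans (∑ᴷ-single q {term 0ᵛ} 0ᵛ 0ᵛ<q others)
                    (≈-trans (reflexive (if-yes (t ≤ᵇ? 0ᵛ ⊕ valᵛ p t 0ᵛ) top)) (reflexive (cong V valᵛ-0ᵛ)))))
                  (≈-trans (V-solves 0ᵛ 0ᵛ≤t) F-0ᵛ)
                  where
                  top : t ≤ᵇ 0ᵛ ⊕ valᵛ p t 0ᵛ
                  top j = ℕ.≤-trans (ℕ.≤-reflexive (sym (trans (cong (λ v → Vec.lookup v j) valᵛ-0ᵛ) (Vec.lookup∘tabulate t j))))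
                    (ℕ.m≤n+m _ (Vec.lookup 0ᵛ j))
                  others : ∀ zs → zs <ᵇ q → zs ≢ 0ᵛ → term 0ᵛ zs ≈ 0#
                  others zs zs<q zs≢0 = reflexive (if-no (t ≤ᵇ? 0ᵛ ⊕ valᵛ p t zs) λ le → zs≢0 (valᵛ-top zs<q
                    (lookup-ext λ j → trans (ℕ.≤-antisym (valᵛ≤ zs j)
                      (subst (λ a → t j ≤ a + Vec.lookup (valᵛ p t zs) j) (Vec.lookup-replicate j 0) (le j)))
                      (sym (Vec.lookup∘tabulate t j)))))

              -- The solution on the whole box restricts to the vertices because the remaining
              -- points contribute nothing to the equation at a vertex.
              solveClass : Σ[ v ∈ Vector Carrier n ] ((∀ i → v (rep i) ≈ v i) × (∀ i → sumᴷ (λ j → A i j *ᴷ v j) ≈ f i))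
              solveClass = V ∘ class , (λ i → reflexive (cong V (class-rep i))) , solves
                where
                missed : ∀ i ys → ys <ᵇ q → (∀ j → e j ≢ ys) → term (class i) ys ≈ 0#
                missed i ys ys<q none with valᵛ p t ys ≟ᵛ 0ᵛ | valᵛ p t ys ≟ᵛ tᵛ
                ... | no v≢0 | no v≢t = let j , eq = e-onto ys ys<q v≢0 v≢t in contradiction eq (none j)
                -- A unit meeting the condition would force valuation `t` in every factor of vertex
                -- `i`, which would then be zero.
                ... | yes v≡0 | _ = reflexive (if-no (t ≤ᵇ? class i ⊕ valᵛ p t ys) λ le → e≢zero i (lookup-ext λ j →
                  trans (ℕ.≤-antisym (valᵛ≤ (e i) j) (subst (t j ≤_)
                    (trans (cong (λ a → Vec.lookup (class i) j + a) (trans (cong (λ v → Vec.lookup v j) v≡0) (Vec.lookup-replicate j 0)))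
                      (ℕ.+-identityʳ _)) (le j)))
                    (sym (Vec.lookup∘tabulate t j))))
                -- The zero element does satisfy the condition; its term is the value `V tᵛ`, which
                -- vanishes.
                ... | no _ | yes v≡t with t ≤ᵇ? class i ⊕ valᵛ p t ys
                ...   | yes le = ≈-trans (reflexive (if-yes (t ≤ᵇ? class i ⊕ valᵛ p t ys) le)) (≈-trans (reflexive (cong V v≡t)) V-tᵛ)
                ...   | no ¬le = reflexive (if-no (t ≤ᵇ? class i ⊕ valᵛ p t ys) ¬le)
                entry : ∀ i j → A i j *ᴷ V (class j) ≈ term (class i) (e j)
                entry i j with t ≤ᵇ? class i ⊕ class j
                ... | yes le = ≈-trans (K.*-congʳ (reflexive (trans (A-entry i j) (if-yes (t ≤ᵇ? class i ⊕ class j) le))))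
                  (≈-trans (K.*-identityˡ _) (reflexive (sym (if-yes (t ≤ᵇ? class i ⊕ class j) le))))
                ... | no ¬le = ≈-trans (K.*-congʳ (reflexive (trans (A-entry i j) (if-no (t ≤ᵇ? class i ⊕ class j) ¬le))))
                  (≈-trans (K.zeroˡ _) (reflexive (sym (if-no (t ≤ᵇ? class i ⊕ class j) ¬le))))
                solves : ∀ i → sumᴷ (λ j → A i j *ᴷ V (class j)) ≈ f i
                solves i = ≈-trans (sumᴷ-cong {n} (entry i))
                  (≈-trans (sumᴷ-reindex q e e<q e-injective (term (class i)) (missed i))
                    (≈-trans (V-solves (class i) (valᵛ≤ (e i))) (F-class i)))

open ClassCounting

open import Data.Nat.Base using (_≤_; _<_; _∸_; _^_; z≤n; s≤s)

-- Residues of the elements of R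

module _ (d : ℕ) .{{_ : ℕ.NonZero d}} where

  %ℕ-congruent : ∀ z → z ≡ + (z ℤ.%ℕ d) [mod d ]
  %ℕ-congruent z = congruent (divides (z ℤ./ℕ d)
    (≡.trans (≡.cong (ℤ._- + (z ℤ.%ℕ d)) (ℤ.a≡a%ℕn+[a/ℕn]*n z d)) (cancel (+ (z ℤ.%ℕ d)) _)))
    where
    cancel : ∀ a b → a ℤ.+ b ℤ.- a ≡ b
    cancel = solve-∀

  residue-unique : ∀ {a b} → a < d → b < d → + a ≡ + b [mod d ] → a ≡ b
  residue-unique {a} {b} a<d b<d a≡b = ℕ.≤-antisym (below b<d a<d (sym a≡b)) (below a<d b<d a≡b)
    where
    open CommutativeRing (ℤ/ d) using (sym)
    below : ∀ {a b} → a < d → b < d → + a ≡ + b [mod d ] → b ≤ a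
    below {a} {b} a<d b<d (congruent d∣a-b) with ℕ.≤-total a b
    ... | inj₂ b≤a = b≤a
    ... | inj₁ a≤b = ℕ.m∸n≡0⇒m≤n (multiple-small (ℕ.≤-<-trans (ℕ.m∸n≤m b a) b<d)
        (≡.subst (d ∣_) distance (ℤ.∣⇒∣ᵤ d∣a-b)))
      where
      distance : ℤ.∣ + a ℤ.- + b ∣ ≡ b ∸ a
      distance = ≡.trans (≡.cong ℤ.∣_∣ (ℤ.[+m]-[+n]≡m⊖n a b)) (ℤ.∣⊖∣-≤ a≤b)
      multiple-small : ∀ {c} → c < d → d ∣ c → c ≡ 0
      multiple-small {zero}  _   _   = ≡.refl
      multiple-small {suc c} c<d d∣c = contradiction (ℕ.∣⇒≤ d∣c) (ℕ.<⇒≱ c<d)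

pos-*≈0⇒∣ : ∀ {d} a b → (+ a ℤ.* + b) ≡ + 0 [mod d ] → d ∣ a ℕ.* b
pos-*≈0⇒∣ {d} a b (congruent e) = ≡.subst (d ∣_)
  (≡.cong ℤ.∣_∣ (≡.trans (ℤ.+-identityʳ (+ a ℤ.* + b)) (≡.sym (ℤ.pos-* a b)))) (ℤ.∣⇒∣ᵤ e)

∣⇒pos-*≈0 : ∀ {d} a b → d ∣ a ℕ.* b → (+ a ℤ.* + b) ≡ + 0 [mod d ]
∣⇒pos-*≈0 {d} a b d∣ab = congruent (ℤ.∣ᵤ⇒∣ (≡.subst (d ∣_)
  (≡.sym (≡.cong ℤ.∣_∣ (≡.trans (ℤ.+-identityʳ (+ a ℤ.* + b)) (≡.sym (ℤ.pos-* a b))))) d∣ab))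

module Residues {c ℓ} (R : CommutativeRing c ℓ) {r} (p t : Vector ℕ r)
  (pr : ∀ j → Prime (p j)) (0<t : ∀ j → 0 < t j) (iso : R ≅ Πᴿ (λ j → ℤ/ (p j ^ t j))) where
  open CommutativeRing R hiding (zero)
  open Classes p t pr 0<t
  private
    module Z (j : Fin r) = CommutativeRing (ℤ/ (q j))
    φ = proj₁ iso
    open RingMorphisms rawRing (CommutativeRing.rawRing (Πᴿ (λ j → ℤ/ (p j ^ t j)))) using (IsRingIsomorphism)
    open IsRingIsomorphism (proj₂ iso)
    instance
      q≢0 : ∀ {j} → ℕ.NonZero (q j)
      q≢0 {j} = ℕ.m^n≢0 (p j) (t j) {{prime⇒nonZero (pr j)}}

  -- Least non-negative residues in all factors turn the setoid equality of `R` into propositional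
  -- equality of vectors, on which classes and indices can be compared.
  residue : Carrier → Vec ℕ r
  residue x = Vec.tabulate λ j → φ x j ℤ.%ℕ q j

  residue<q : ∀ x → residue x <ᵇ q
  residue<q x j = ≡.subst (_< q j) (≡.sym (Vec.lookup∘tabulate _ j)) (ℤ.n%ℕd<d (φ x j) (q j))

  φ≋residue : ∀ x j → Z._≈_ j (φ x j) (+ Vec.lookup (residue x) j)
  φ≋residue x j = ≡.subst (λ a → Z._≈_ j (φ x j) (+ a)) (≡.sym (Vec.lookup∘tabulate _ j)) (%ℕ-congruent (q j) (φ x j))

  residue-of : ∀ x {ys} → ys <ᵇ q → (∀ j → Z._≈_ j (φ x j) (+ Vec.lookup ys j)) → residue x ≡ ys
  residue-of x ys<q e = lookup-ext λ j → residue-unique (q j) (residue<q x j) (ys<q j)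
    (Z.trans j (Z.sym j (φ≋residue x j)) (e j))

  residue-cong : ∀ {x y} → x ≈ y → residue x ≡ residue y
  residue-cong {x} {y} x≈y = residue-of x (residue<q y) λ j → Z.trans j (⟦⟧-cong x≈y j) (φ≋residue y j)

  residue-injective : ∀ {x y} → residue x ≡ residue y → x ≈ y
  residue-injective {x} {y} e = injective λ j → Z.trans j (φ≋residue x j)
    (≡.subst (λ ys → Z._≈_ j (+ Vec.lookup ys j) (φ y j)) (≡.sym e) (Z.sym j (φ≋residue y j)))

  residue-onto : ∀ ys → ys <ᵇ q → ∃[ x ] residue x ≡ ys
  residue-onto ys ys<q = let x , e = surjective (λ j → + Vec.lookup ys j) in x , residue-of x ys<q (e refl)

  residue-0# : residue 0# ≡ 0ᵛ
  residue-0# = residue-of 0# 0ᵛ<q λ j →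
    ≡.subst (λ a → Z._≈_ j (φ 0# j) (+ a)) (≡.sym (Vec.lookup-replicate j 0)) (0#-homo j)

  val-top⇒≈0 : ∀ {x} → valᵛ p t (residue x) ≡ tᵛ → x ≈ 0#
  val-top⇒≈0 {x} e = residue-injective (≡.trans (valᵛ-top (residue<q x) e) (≡.sym residue-0#))

  ≈0⇒val-top : ∀ {x} → x ≈ 0# → valᵛ p t (residue x) ≡ tᵛ
  ≈0⇒val-top x≈0 = ≡.trans (≡.cong (valᵛ p t) (≡.trans (residue-cong x≈0) residue-0#)) valᵛ-0ᵛ

  *≈0⇒≤ : ∀ {x y} → x * y ≈ 0# → t ≤ᵇ valᵛ p t (residue x) ⊕ valᵛ p t (residue y)
  *≈0⇒≤ {x} {y} xy≈0 j = ≡.subst₂ (λ a b → t j ≤ a ℕ.+ b)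
    (≡.sym (lookup-valᵛ p t (residue x) j)) (≡.sym (lookup-valᵛ p t (residue y) j))
    (∣*⇒≤val+val (pr j) (t j) (pos-*≈0⇒∣ (Vec.lookup (residue x) j) (Vec.lookup (residue y) j)
      (Z.trans j (Z.sym j (Z.*-cong j (φ≋residue x j) (φ≋residue y j)))
        (Z.trans j (Z.sym j (*-homo x y j)) (Z.trans j (⟦⟧-cong xy≈0 j) (0#-homo j))))))

  ≤⇒*≈0 : ∀ {x y} → t ≤ᵇ valᵛ p t (residue x) ⊕ valᵛ p t (residue y) → x * y ≈ 0#
  ≤⇒*≈0 {x} {y} le = injective λ j → Z.trans j (*-homo x y j)
    (Z.trans j (Z.*-cong j (φ≋residue x j) (φ≋residue y j))
      (Z.trans j (∣⇒pos-*≈0 (Vec.lookup (residue x) j) (Vec.lookup (residue y) j) (≤val+val⇒∣* (pr j) (t j) (≡.subst₂ (λ a b → t j ≤ a ℕ.+ b)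
        (lookup-valᵛ p t (residue x) j) (lookup-valᵛ p t (residue y) j) (le j))))
        (Z.sym j (0#-homo j))))

  -- With valuation 0 on the side of `x`, a vanishing product leaves valuation `t` in every factor
  -- for `y`, which makes `y` zero.
  unit⇒¬zeroDivisor : ∀ {x} → valᵛ p t (residue x) ≡ 0ᵛ → ¬ IsZeroDivisor R x
  unit⇒¬zeroDivisor {x} v≡0 (y , y≉0 , xy≈0) = y≉0 (val-top⇒≈0 (lookup-ext λ j →
    ≡.trans (ℕ.≤-antisym (valᵛ≤ (residue y) j) (≡.subst (λ a → t j ≤ a ℕ.+ Vec.lookup (valᵛ p t (residue y)) j)
      (≡.trans (≡.cong (λ v → Vec.lookup v j) v≡0) (Vec.lookup-replicate j 0)) (*≈0⇒≤ xy≈0 j)))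
      (≡.sym (Vec.lookup∘tabulate t j))))

  -- Where x has positive valuation at the factor j, it is killed by p ^ (t - 1) in that factor.
  nonunit⇒zeroDivisor : ∀ {x} → valᵛ p t (residue x) ≢ 0ᵛ → IsZeroDivisor R x
  nonunit⇒zeroDivisor {x} v≢0 = y , y≉0 , ≤⇒*≈0 killed
    where
    positive : ∃[ j ] Vec.lookup (valᵛ p t (residue x)) j ≢ 0
    positive = Fin.¬∀⟶∃¬ r _ (λ j → Vec.lookup (valᵛ p t (residue x)) j ℕ.≟ 0)
      λ all → v≢0 (lookup-ext λ j → ≡.trans (all j) (≡.sym (Vec.lookup-replicate j 0)))
    k = proj₁ positive
    bs : Vec ℕ r
    bs = Vec.tabulate λ j → if does (j Fin.≟ k) then t j ∸ 1 else t j
    lookup-bs : ∀ j → Vec.lookup bs j ≡ (if does (j Fin.≟ k) then t j ∸ 1 else t j)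
    lookup-bs = Vec.lookup∘tabulate _
    bs≤t : ∀ j → Vec.lookup bs j ≤ t j
    bs≤t j = ≡.subst (_≤ t j) (≡.sym (lookup-bs j)) (go (does (j Fin.≟ k)))
      where
      go : ∀ b → (if b then t j ∸ 1 else t j) ≤ t j
      go true  = ℕ.m∸n≤m (t j) 1
      go false = ℕ.≤-refl
    preimage = residue-onto (repᵛ p t bs) (repᵛ<q bs)
    y = proj₁ preimage
    val-y : valᵛ p t (residue y) ≡ bs
    val-y = ≡.trans (≡.cong (valᵛ p t) (proj₂ preimage)) (valᵛ-repᵛ {bs} bs≤t)
    y≉0 : y ≉ 0#
    y≉0 y≈0 = ℕ.<-irrefl (≡.trans (≡.sym (≡.trans (lookup-bs k) (if-yes (k Fin.≟ k) ≡.refl)))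
      (≡.trans (≡.cong (λ v → Vec.lookup v k) (≡.trans (≡.sym val-y) (≈0⇒val-top y≈0))) (Vec.lookup∘tabulate t k)))
      (ℕ.∸-monoʳ-< {t k} {1} {0} (s≤s z≤n) (0<t k))
    killed : t ≤ᵇ valᵛ p t (residue x) ⊕ valᵛ p t (residue y)
    killed j = ≡.subst (λ b → t j ≤ Vec.lookup (valᵛ p t (residue x)) j ℕ.+ b)
      (≡.sym (≡.trans (≡.cong (λ v → Vec.lookup v j) val-y) (lookup-bs j))) (go (j Fin.≟ k))
      where
      go : (d : Dec (j ≡ k)) → t j ≤ Vec.lookup (valᵛ p t (residue x)) j ℕ.+ (if does d then t j ∸ 1 else t j)
      go (yes ≡.refl) = ℕ.≤-trans (ℕ.≤-reflexive (≡.sym (ℕ.m+[n∸m]≡n (0<t j))))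
                          (ℕ.+-monoˡ-≤ (t j ∸ 1) (ℕ.n≢0⇒n>0 (proj₂ positive)))
      go (no _) = ℕ.m≤n+m (t j) _

  module Vertices (fin : Finite (Γ R)) where
    open Finite fin
    open Bijection enumeration using () renaming (injective to vertex-injective; surjective to vertex-surjective)

    e : Fin order → Vec ℕ r
    e i = residue (proj₁ (vertex i))

    e-injective : ∀ {i j} → e i ≡ e j → i ≡ j
    e-injective eq = vertex-injective (residue-injective eq)

    e≢unit : ∀ i → valᵛ p t (e i) ≢ 0ᵛ
    e≢unit i v≡0 = unit⇒¬zeroDivisor v≡0 (proj₂ (proj₂ (vertex i)))

    e≢zero : ∀ i → valᵛ p t (e i) ≢ tᵛ
    e≢zero i v≡t = proj₁ (proj₂ (vertex i)) (val-top⇒≈0 v≡t)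

    e-onto : ∀ ys → ys <ᵇ q → valᵛ p t ys ≢ 0ᵛ → valᵛ p t ys ≢ tᵛ → ∃[ i ] e i ≡ ys
    e-onto ys ys<q v≢0 v≢t =
      let x , eq = residue-onto ys ys<q
          i , at = vertex-surjective (x , (λ x≈0 → v≢t (≡.trans (≡.cong (valᵛ p t) (≡.sym eq)) (≈0⇒val-top x≈0)))
                     , nonunit⇒zeroDivisor (v≢0 ∘ ≡.trans (≡.cong (valᵛ p t) (≡.sym eq))))
      in i , ≡.trans (residue-cong (at ≡.refl)) eq

    -- The procedure `~?` is known only to decide adjacency, so its verdict is matched with that of
    -- the valuations. Arbitrary branches let the result describe the adjacency matrix over any `K`.
    adjacent : ∀ {a} {A : Set a} {x y : A} i j →
      (if does (vertex i ~? vertex j) then x else y) ≡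
      (if does (t ≤ᵇ? valᵛ p t (e i) ⊕ valᵛ p t (e j)) then x else y)
    adjacent i j with vertex i ~? vertex j
    ... | yes i~j = ≡.sym (if-yes (t ≤ᵇ? valᵛ p t (e i) ⊕ valᵛ p t (e j)) (*≈0⇒≤ i~j))
    ... | no  i≁j = ≡.sym (if-no (t ≤ᵇ? valᵛ p t (e i) ⊕ valᵛ p t (e j)) (i≁j ∘ ≤⇒*≈0))

open import Data.Nat.Base using (_+_)

-- The zero-divisor graph

module ZeroDivisorGraph {c ℓ} (R : CommutativeRing c ℓ) {r} (p t : Vector ℕ r) (0<r : 0 < r)
  (pr : ∀ j → Prime (p j)) (0<t : ∀ j → 0 < t j) (iso : R ≅ Πᴿ (λ j → ℤ/ (p j ^ t j)))
  (fin : Finite (Γ R)) where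
  open Classes p t pr 0<t
  open Residues R p t pr 0<t iso
  open Vertices fin public
  open Finite fin

  -- A single factor with positive exponent separates the class of the units from that of zero; in
  -- the zero ring, the case without factors, they would coincide and not count as 2.
  0ᵛ≢tᵛ : 0ᵛ ≢ tᵛ
  0ᵛ≢tᵛ eq = ℕ.<-irrefl (≡.trans (≡.sym (Vec.lookup-replicate j 0))
    (≡.trans (≡.cong (λ v → Vec.lookup v j) eq) (Vec.lookup∘tabulate t j))) (0<t j)
    where j = fromℕ< 0<r

  open Enumerated 0ᵛ≢tᵛ e (λ i → residue<q _) e-injective e≢unit e≢zero e-onto

  rep : Fin order → Fin order
  rep i = proj₁ (representative i)

  open Represented rep (λ i → proj₂ (representative i)) public

  private
    T Π P Φ : ℕ
    T = ∏ (λ j → t j + 1)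
    Π = ∏ p
    P = ∏ (λ j → p j ^ (t j ∸ 1))
    Φ = ∏ (λ j → p j ∸ 1)

  moved+count : moved rep + T ≡ order + 2
  moved+count = moved-count

  order+count : order + (P ℕ.* Φ + 1) ≡ P ℕ.* Π
  order+count = ≡.trans order-count (≡.trans (∏-cong λ j → power (p j) (0<t j)) (∏-* (λ j → p j ^ (t j ∸ 1)) p))
    where
    power : ∀ p {t} → 0 < t → p ^ t ≡ p ^ (t ∸ 1) ℕ.* p
    power p {suc t} _ = ℕ.*-comm p (p ^ t)

  nonZero-formula : ∀ {k} → moved rep + k ≡ order → + k ≡ + T ℤ.- + 2
  nonZero-formula {k} eq = ≡.trans (add-sub (+ k)) (≡.cong (ℤ._- + 2) (≡.cong +_ (ℕ.+-cancelˡ-≡ (moved rep) _ _ (begin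
    moved rep + (k + 2)    ≡⟨ ℕ.+-assoc (moved rep) k 2 ⟨
    moved rep + k + 2      ≡⟨ ≡.cong (_+ 2) eq ⟩
    order + 2              ≡⟨ moved+count ⟨
    moved rep + T          ∎))))
    where
    open ≡.≡-Reasoning
    add-sub : ∀ a → a ≡ a ℤ.+ + 2 ℤ.- + 2
    add-sub = solve-∀

  -- Counting classes gives moved = order + 2 - T, and counting elements gives order = P Π - P Φ -
  -- 1. The computation is made in the integers because of the subtractions.
  nullity-formula : + moved rep ≡ + P ℤ.* (+ Π ℤ.- + Φ) ℤ.- + T ℤ.+ + 1
  nullity-formula = begin
    + moved rep
      ≡⟨ isolate (+ moved rep) (+ T) (+ P) (+ Φ) ⟩
    (+ moved rep ℤ.+ + T ℤ.+ (+ P ℤ.* + Φ ℤ.+ + 1)) ℤ.- + P ℤ.* + Φ ℤ.- + T ℤ.- + 1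
      ≡⟨ ≡.cong (λ a → a ℤ.- + P ℤ.* + Φ ℤ.- + T ℤ.- + 1) total ⟩
    (+ P ℤ.* + Π ℤ.+ + 2) ℤ.- + P ℤ.* + Φ ℤ.- + T ℤ.- + 1
      ≡⟨ collect (+ T) (+ P) (+ Φ) (+ Π) ⟩
    + P ℤ.* (+ Π ℤ.- + Φ) ℤ.- + T ℤ.+ + 1 ∎
    where
    open ≡.≡-Reasoning
    isolate : ∀ m T P Φ → m ≡ (m ℤ.+ T ℤ.+ (P ℤ.* Φ ℤ.+ + 1)) ℤ.- P ℤ.* Φ ℤ.- T ℤ.- + 1
    isolate = solve-∀
    collect : ∀ T P Φ Π → (P ℤ.* Π ℤ.+ + 2) ℤ.- P ℤ.* Φ ℤ.- T ℤ.- + 1 ≡ P ℤ.* (Π ℤ.- Φ) ℤ.- T ℤ.+ + 1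
    collect = solve-∀
    swap : ∀ n u → n + 2 + u ≡ n + u + 2
    swap = ℕ.solve-∀
    total : + moved rep ℤ.+ + T ℤ.+ (+ P ℤ.* + Φ ℤ.+ + 1) ≡ + P ℤ.* + Π ℤ.+ + 2
    total = begin
      + (moved rep + T) ℤ.+ (+ P ℤ.* + Φ ℤ.+ + 1)
        ≡⟨ ≡.cong (λ a → + (moved rep + T) ℤ.+ (a ℤ.+ + 1)) (ℤ.pos-* P Φ) ⟨
      + (moved rep + T + (P ℕ.* Φ + 1))
        ≡⟨ ≡.cong (λ a → + (a + (P ℕ.* Φ + 1))) moved+count ⟩
      + (order + 2 + (P ℕ.* Φ + 1))
        ≡⟨ ≡.cong +_ (≡.trans (swap order (P ℕ.* Φ + 1)) (≡.cong (_+ 2) order+count)) ⟩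
      + (P ℕ.* Π) ℤ.+ + 2
        ≡⟨ ≡.cong (ℤ._+ + 2) (ℤ.pos-* P Π) ⟩
      + P ℤ.* + Π ℤ.+ + 2 ∎

theorem4p2 : ∀ {c ℓ} (R : CommutativeRing c ℓ)
    {r} (p t : Vector ℕ r) → 0 < r →
    (∀ i → Prime (p i)) → (∀ i → 0 < t i) →
    R ≅ Πᴿ (λ i → ℤ/ (p i ^ t i)) →
    (fin : Finite (Γ R)) →
    ∀ {k ℓ₁ ℓ₂} (K : HeytingField k ℓ₁ ℓ₂) → let open FieldEigenvalues K in
    CharacteristicZero →
    (∀ μ → IsSpectrum (adjacencyMatrix commutativeRing fin) μ →
    ∃[ m ] (NonZeroCount μ m × + m ≡ + ∏ (λ i → t i + 1) ℤ.- + 2))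
    ×
    (∃[ η ] (IsNullity fin η ×
    + η ≡ + ∏ (λ i → p i ^ (t i ∸ 1)) ℤ.* (+ ∏ p ℤ.- + ∏ (λ i → p i ∸ 1))
    ℤ.- + ∏ (λ i → t i + 1) ℤ.+ + 1))
theorem4p2 R p t 0<r pr 0<t iso fin K char0 =
  (λ μ spectrum → let k , nonZero , total = nonZeroCount {p = charPoly A} μ nullity spectrum
                  in k , nonZero , nonZero-formula total) ,
  (moved rep , nullity , nullity-formula)
  where
  open FieldEigenvalues K
  open HeytingSpectrum K
  open ZeroDivisorGraph R p t 0<r pr 0<t iso fin
  A = adjacencyMatrix commutativeRing fin
  open CommutativeRing commutativeRing using (_≈_; _*_; 1#; trans; sym; *-congʳ)
  open RawSemiringDefs (RawRing.rawSemiring (CommutativeRing.rawRing commutativeRing)) using () renaming (_×_ to _·_)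
  open Algebra.Apartness.Properties.HeytingCommutativeRing (HeytingField.heytingCommutativeRing K) using (x-0≈x)
  -- Apartness from `0#` yields an inverse of the difference with `0#`, hence the passage through
  -- `x-0≈x`.
  invertible : ∀ k → ∃[ d ] (suc k · 1#) * d ≈ 1#
  invertible k = let d , _ , e = HeytingField.#⇒invertible K (char0 k)
                 in d , trans (*-congʳ (sym (x-0≈x _))) e
  -- `rep` is idempotent because `rep i` lies in the class of `i` and `rep` depends only on the
  -- class.
  nullity : IsNullity fin (moved rep)
  nullity = nullity-repeatedRows rep (λ i → rep-class (class-rep i)) A
    (A-rep commutativeRing A adjacent) (solveClass commutativeRing A adjacent invertible)
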